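{- Let $k\ge 3$ and $1\le j \le k-1$ be integers. Consider the random $k$-uniform hypergraph process on vertex set $[n]$, and let $\tau_C$ be the hitting time for $j$-connectivity and $\tau_I$ the time-step at which the last isolated $j$-set disappears. Then with probability tending to $1$ as $n\to\infty$, $\tau_C=\tau_I$.
   Context: The $k$-uniform random hypergraph process $\{\mathcal{H}^k(n,M)\}_M$ on vertex set $[n]=\{1,\dots,n\}$ starts with no edges, and in each step adds as an edge a $k$-set chosen uniformly at random among all $k$-sets that are not yet edges. A $j$-set is a set of $j$ distinct vertices; it is isolated if it is contained in no edge. Two $j$-sets $J,J'$ are $j$-connected if there is a sequence of edges $e_1,\dots,e_m$ with $J\subset e_1$, $J'\subset e_m$ and $|e_i\cap e_{i+1}|\ge j$ for all $1\le i\le m-1$. The hypergraph is $j$-connected if every two $j$-sets are $j$-connected. $\tau_C$ is the minimal $M$ such that $\mathcal{H}^k(n,M)$ is $j$-connected, and $\tau_I$ is the minimal $M$ such that $\mathcal{H}^k(n,M)$ has no isolated $j$-set. -}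

module Defs where

open import Data.Nat using (ℕ; zero; suc; _≤_; _<_; _≟_)
open import Data.Bool using (Bool; true; false)
open import Data.Fin.Subset using (Subset; inside; outside; _⊆_; _∩_; ∣_∣)
open import Data.Vec using (_∷_; [])
open import Data.List using (List; []; _∷_; map; concatMap; filter; take; _++_)
open import Data.List.Membership.Propositional using (_∈_)
open import Data.Product using (Σ; _×_; _,_)
open import Relation.Nullary using (¬_)
open import Relation.Binary.PropositionalEquality using (_≡_)

allSubsets : (n : ℕ) → List (Subset n)
allSubsets zero = [] ∷ []
allSubsets (suc n) = map (inside ∷_) (allSubsets n) ++ map (outside ∷_) (allSubsets n)

ksets : (n k : ℕ) → List (Subset n)
ksets n k = filter (λ s → ∣ s ∣ ≟ k) (allSubsets n)

insertions : {A : Set} → A → List A → List (List A)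
insertions x [] = (x ∷ []) ∷ []
insertions x (y ∷ ys) = (x ∷ y ∷ ys) ∷ map (y ∷_) (insertions x ys)

permutations : {A : Set} → List A → List (List A)
permutations [] = [] ∷ []
permutations (x ∷ xs) = concatMap (insertions x) (permutations xs)

-- The sample space of the k-uniform random hypergraph process on [n]:
-- all orderings of the k-sets of [n], each equally likely.
-- H^k(n,M) for the ordering σ is  take M σ.
orderings : (n k : ℕ) → List (List (Subset n))
orderings n k = permutations (ksets n k)

Hypergraph : ℕ → Set
Hypergraph n = List (Subset n)

Isolated : {n : ℕ} → Hypergraph n → Subset n → Set
Isolated H J = ¬ (Σ _ λ e → e ∈ H × J ⊆ e)

NoIsolated : {n : ℕ} → ℕ → Hypergraph n → Set
NoIsolated j H = ∀ J → ∣ J ∣ ≡ j → ¬ Isolated H J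

data Chain {n : ℕ} (H : Hypergraph n) (j : ℕ) : Subset n → Subset n → Set where
  single : ∀ {e} → e ∈ H → Chain H j e e
  step   : ∀ {e e' e''} → e ∈ H → j ≤ ∣ e ∩ e' ∣ → Chain H j e' e'' → Chain H j e e''

JConnected : {n : ℕ} → ℕ → Hypergraph n → Subset n → Subset n → Set
JConnected j H J J' = Σ _ λ e → Σ _ λ e' → J ⊆ e × J' ⊆ e' × Chain H j e e'

JConnectedHG : {n : ℕ} → ℕ → Hypergraph n → Set
JConnectedHG {n} j H = ∀ (J J' : Subset n) → ∣ J ∣ ≡ j → ∣ J' ∣ ≡ j → JConnected j H J J'

IsHittingTime : {n : ℕ} → (Hypergraph n → Set) → List (Subset n) → ℕ → Set
IsHittingTime P σ M = P (take M σ) × (∀ M' → M' < M → ¬ P (take M' σ))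

TauCEqTauI : {n : ℕ} → ℕ → List (Subset n) → Set
TauCEqTauI j σ = Σ ℕ λ M → IsHittingTime (JConnectedHG j) σ M × IsHittingTime (NoIsolated j) σ M

{-# OPTIONS --safe #-}
module Submission where

-- Idea.  Let N, D and T be the numbers of j-sets, of k-sets containing a given j-set, and of k-sets.  Fix
-- w = N/u with u large, and let M₀ be the last time at which a given j-set is isolated with probability at
-- least 1/w.  By Chebyshev's inequality, with probability 1 - O(1/u) some j-set is isolated at time M₀, so
-- that τ_I > M₀.
--
-- If the hypergraph is not j-connected at time τ_I, then it has a component with at most N/2 j-sets, at least
-- one edge, and no edge in its boundary, the k-sets which contain both a j-set of the component and another
-- one.  A component is encoded by an exploration which records s edges, each containing a new j-set; there
-- are at most about N (2^(κ+1) D)^s of these, where κ = C(k,j).  If the boundary has b elements, then the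
-- probability that the s edges and at least M₀ + 1 edges in all precede the boundary is at most s! (4/b)^s
-- times the probability that the first M₀ + 1 edges avoid a given set of size 3b/4, which is at most w^(-t)
-- when 3b/4 ≥ tD.  For bounded s, b is at least 8D/3, as an edge has κ ≥ 3 j-subsets, so t = 2, which beats
-- the factor N.  For large s, b is at least a constant times sD, as the walk on j-sets which goes up to a
-- random k-set and down again connects any two j-sets in j steps; so t grows linearly in s.
--
-- No logarithms occur: 1/w plays the role of exp(-M₀ D/T), and falling factorials that of exponentials.

open import Defs
open import Data.Nat using (ℕ; zero; suc; _+_; _*_; _∸_; _^_; _!; _≤_; _<_; _≡ᵇ_; _≤ᵇ_; z≤n; s≤s; NonZero; _≟_; _≤?_; _/_; _%_; >-nonZero)
open import Data.Nat.Properties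
open import Data.Nat.DivMod using (m≡m%n+[m/n]*n; m%n<n; m/n*n≤m; m*n/n≡m; /-monoˡ-≤)
open import Data.Nat.Tactic.RingSolver using (solve-∀)
open import Data.Bool using (Bool; true; false; if_then_else_; not; _∧_; _∨_)
open import Data.Empty using (⊥)
open import Data.Fin.Subset using (Subset; ∣_∣; _∩_; _∪_)
open import Data.Fin.Subset.Properties using (drop-there; p⊆q⇒∣p∣≤∣q∣; ∩-comm; x∈p∩q⁺)
open import Data.List using (List; []; _∷_; _++_; map; concatMap; filter; filterᵇ; length; take)
open import Data.List.Properties using (length-++; take-all)
open import Data.List.Membership.Propositional using (_∈_; find; lose)
open import Data.List.Membership.Propositional.Properties using (∈-++⁺ˡ; ∈-++⁺ʳ; ∈-++⁻; ∈-map⁺; ∈-map⁻; ∈-filter⁺; ∈-filter⁻; ∈-concatMap⁺; ∈-concatMap⁻)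
open import Data.List.Relation.Binary.Sublist.Propositional using (_⊆_)
open import Data.List.Relation.Binary.Sublist.Propositional.Properties using (filter-⊆)
open import Data.List.Relation.Unary.All using (All; []; _∷_)
open import Data.List.Relation.Unary.Any using (here; there)
open import Data.Product using (Σ; ∃; _×_; _,_; proj₁; proj₂)
open import Data.Sum using (_⊎_; inj₁; inj₂)
open import Data.Unit using (tt)
open import Data.Vec using ([]; _∷_)
open import Function using (_∘_; id)
open import Relation.Nullary using (¬_; Dec; yes; no; does)
open import Relation.Nullary.Negation using (contradiction)
open import Relation.Binary.PropositionalEquality using (_≡_; refl; sym; trans; cong; cong₂; subst; module ≡-Reasoning)

-- The hitting time is random, whereas a first-moment bound wants a fixed time. Hence the event
-- `before` speaks only of the order of C relative to its boundary and of the time M₀ + 1. It holds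
-- whatever value above M₀ the hitting time takes, so no union over times is paid for. The positions
-- of the s edges are left free; accounting for them uses up a quarter of the boundary, and only 3/4
-- of it counts as avoided.
--
-- This loss fixes the constants. Since w is about N/u, beating N starting points takes w^(-2), that
-- is an avoided set of size 2D and a boundary of 8D/3. A single edge has a boundary of about κD,
-- and k ≥ 3 gives κ ≥ 3. The gap between 3 and 8/3 absorbs the k-sets that meet the vertices of C
-- in more than one j-set of the edge.
--
-- At time M₀ the expected number of isolated j-sets is at least u, a constant. So Chebyshev's
-- inequality needs pair correlations within a factor 1 + 1/u and leaves an error of order 1/u; u is
-- chosen according to the error that is wanted.

private
  variable
    A B : Set
    n : ℕ

-- Finite sums

∑ : List A → (A → ℕ) → ℕ
∑ []       f = 0
∑ (x ∷ xs) f = f x + ∑ xs f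

𝟙 : Bool → ℕ
𝟙 true  = 1
𝟙 false = 0

count : (A → Bool) → List A → ℕ
count p xs = ∑ xs (λ x → 𝟙 (p x))

𝟙≤1 : ∀ b → 𝟙 b ≤ 1
𝟙≤1 true  = ≤-refl
𝟙≤1 false = z≤n

𝟙+𝟙-not : ∀ b → 𝟙 b + 𝟙 (not b) ≡ 1
𝟙+𝟙-not true  = refl
𝟙+𝟙-not false = refl

𝟙-∧ : ∀ a b → 𝟙 (a ∧ b) ≡ 𝟙 a * 𝟙 b
𝟙-∧ true  b = sym (+-identityʳ (𝟙 b))
𝟙-∧ false b = refl

𝟙-∧-≤ : ∀ a b → 𝟙 (a ∧ b) ≤ 𝟙 a
𝟙-∧-≤ true  b = 𝟙≤1 b
𝟙-∧-≤ false b = z≤n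

𝟙-∨-≤ : ∀ a b → 𝟙 (a ∨ b) ≤ 𝟙 a + 𝟙 b
𝟙-∨-≤ true  b = s≤s z≤n
𝟙-∨-≤ false b = ≤-refl

module _ {f g : A → ℕ} where

  ∑-cong : ∀ xs → (∀ x → x ∈ xs → f x ≡ g x) → ∑ xs f ≡ ∑ xs g
  ∑-cong []       h = refl
  ∑-cong (x ∷ xs) h = cong₂ _+_ (h x (here refl)) (∑-cong xs (λ y y∈ → h y (there y∈)))

  ∑-mono : ∀ xs → (∀ x → x ∈ xs → f x ≤ g x) → ∑ xs f ≤ ∑ xs g
  ∑-mono []       h = z≤n
  ∑-mono (x ∷ xs) h = +-mono-≤ (h x (here refl)) (∑-mono xs (λ y y∈ → h y (there y∈)))

∑-+ : ∀ xs (f g : A → ℕ) → ∑ xs (λ x → f x + g x) ≡ ∑ xs f + ∑ xs g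
∑-+ []       f g = refl
∑-+ (x ∷ xs) f g = trans (cong ((f x + g x) +_) (∑-+ xs f g)) (lem (f x) (g x) (∑ xs f) (∑ xs g))
  where
  lem : ∀ a b c d → (a + b) + (c + d) ≡ (a + c) + (b + d)
  lem = solve-∀

∑-*ˡ : ∀ xs c (f : A → ℕ) → ∑ xs (λ x → c * f x) ≡ c * ∑ xs f
∑-*ˡ []       c f = sym (*-zeroʳ c)
∑-*ˡ (x ∷ xs) c f = trans (cong (c * f x +_) (∑-*ˡ xs c f)) (sym (*-distribˡ-+ c (f x) (∑ xs f)))

∑-*ʳ : ∀ xs c (f : A → ℕ) → ∑ xs (λ x → f x * c) ≡ ∑ xs f * c
∑-*ʳ []       c f = refl
∑-*ʳ (x ∷ xs) c f = trans (cong (f x * c +_) (∑-*ʳ xs c f)) (sym (*-distribʳ-+ c (f x) (∑ xs f)))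

∑-const : ∀ (xs : List A) c → ∑ xs (λ _ → c) ≡ length xs * c
∑-const []       c = refl
∑-const (x ∷ xs) c = cong (c +_) (∑-const xs c)

∑-bound : ∀ (xs : List A) c {f : A → ℕ} → (∀ x → x ∈ xs → f x ≤ c) → ∑ xs f ≤ length xs * c
∑-bound xs c h = ≤-trans (∑-mono xs h) (≤-reflexive (∑-const xs c))

∑-one : ∀ (xs : List A) → ∑ xs (λ _ → 1) ≡ length xs
∑-one xs = trans (∑-const xs 1) (*-identityʳ _)

∑-swap : ∀ (xs : List A) (ys : List B) (f : A → B → ℕ) →
  ∑ xs (λ x → ∑ ys (f x)) ≡ ∑ ys (λ y → ∑ xs (λ x → f x y))
∑-swap []       ys f = sym (trans (∑-const ys 0) (*-zeroʳ (length ys)))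
∑-swap (x ∷ xs) ys f = trans (cong (∑ ys (f x) +_) (∑-swap xs ys f))
  (sym (∑-+ ys (f x) (λ y → ∑ xs (λ x′ → f x′ y))))

∑-++ : ∀ xs ys (f : A → ℕ) → ∑ (xs ++ ys) f ≡ ∑ xs f + ∑ ys f
∑-++ []       ys f = refl
∑-++ (x ∷ xs) ys f = trans (cong (f x +_) (∑-++ xs ys f)) (sym (+-assoc (f x) _ _))

∑-map : ∀ (g : A → B) xs (f : B → ℕ) → ∑ (map g xs) f ≡ ∑ xs (λ x → f (g x))
∑-map g []       f = refl
∑-map g (x ∷ xs) f = cong (f (g x) +_) (∑-map g xs f)

∑-concatMap : ∀ (g : A → List B) xs (f : B → ℕ) → ∑ (concatMap g xs) f ≡ ∑ xs (λ x → ∑ (g x) f)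
∑-concatMap g []       f = refl
∑-concatMap g (x ∷ xs) f = trans (∑-++ (g x) (concatMap g xs) f) (cong (∑ (g x) f +_) (∑-concatMap g xs f))

∑-∈ : ∀ {xs} {x : A} (f : A → ℕ) → x ∈ xs → f x ≤ ∑ xs f
∑-∈ f (here refl) = m≤m+n _ _
∑-∈ f (there x∈)  = ≤-trans (∑-∈ f x∈) (m≤n+m _ _)

∑-strict : ∀ {xs} {x : A} {f g : A → ℕ} → x ∈ xs → (∀ y → f y ≤ g y) → f x < g x → ∑ xs f < ∑ xs g
∑-strict {xs = _ ∷ xs} (here refl) h lt = +-mono-<-≤ lt (∑-mono xs (λ y _ → h y))
∑-strict {xs = y ∷ xs} (there x∈) h lt = +-mono-≤-< (h y) (∑-strict x∈ h lt)

∑-filter : ∀ {P : A → Set} (P? : ∀ x → Dec (P x)) xs (f : A → ℕ) →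
  ∑ (filter P? xs) f ≡ ∑ xs (λ x → 𝟙 (does (P? x)) * f x)
∑-filter P? []       f = refl
∑-filter P? (x ∷ xs) f with does (P? x)
... | true  = cong₂ _+_ (sym (+-identityʳ (f x))) (∑-filter P? xs f)
... | false = ∑-filter P? xs f

∑-filterᵇ : ∀ (p : A → Bool) xs (f : A → ℕ) → ∑ (filterᵇ p xs) f ≡ ∑ xs (λ x → 𝟙 (p x) * f x)
∑-filterᵇ p []       f = refl
∑-filterᵇ p (x ∷ xs) f with p x
... | true  = cong₂ _+_ (sym (+-identityʳ (f x))) (∑-filterᵇ p xs f)
... | false = ∑-filterᵇ p xs f

length-filterᵇ : ∀ (p : A → Bool) xs → length (filterᵇ p xs) ≡ count p xs
length-filterᵇ p xs = trans (sym (∑-one (filterᵇ p xs))) (trans (∑-filterᵇ p xs (λ _ → 1))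
  (∑-cong xs (λ x _ → *-identityʳ _)))

count-not : ∀ (p : A → Bool) xs → count p xs + count (λ x → not (p x)) xs ≡ length xs
count-not p xs = trans (sym (∑-+ xs _ _)) (trans (∑-cong xs (λ x _ → 𝟙+𝟙-not (p x))) (∑-one xs))

-- Summing over orderings by their first element

-- Every way to take out one entry, paired with what is left. Taking out by position matches
-- `permutations`, which also treats equal entries as different.
sel : List A → List (A × List A)
sel []       = []
sel (x ∷ xs) = (x , xs) ∷ map (λ p → proj₁ p , x ∷ proj₂ p) (sel xs)

∑-sel₁ : ∀ xs (f : A → ℕ) → ∑ (sel xs) (λ p → f (proj₁ p)) ≡ ∑ xs f
∑-sel₁ []       f = refl
∑-sel₁ (x ∷ xs) f = cong (f x +_) (trans (∑-map _ (sel xs) _) (∑-sel₁ xs f))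

∑-sel : ∀ xs (f : A → ℕ) {p} → p ∈ sel xs → ∑ xs f ≡ f (proj₁ p) + ∑ (proj₂ p) f
∑-sel (x ∷ xs) f (here refl) = refl
∑-sel (x ∷ xs) f (there p∈) with ∈-map⁻ _ p∈
... | (y , r) , q∈ , refl = trans (cong (f x +_) (∑-sel xs f q∈)) (lem (f x) (f y) (∑ r f))
  where
  lem : ∀ a b c → a + (b + c) ≡ b + (a + c)
  lem = solve-∀

length-sel : ∀ (xs : List A) {p} → p ∈ sel xs → length xs ≡ suc (length (proj₂ p))
length-sel xs {p} p∈ = trans (sym (∑-one xs)) (trans (∑-sel xs (λ _ → 1) p∈) (cong suc (∑-one (proj₂ p))))

uncons : (A → List A → ℕ) → List A → ℕ
uncons G []      = 0
uncons G (y ∷ τ) = G y τ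

∑-insertions : ∀ (x : A) τ F →
  ∑ (insertions x τ) F ≡ F (x ∷ τ) + uncons (λ y ys → ∑ (insertions x ys) (λ ρ → F (y ∷ ρ))) τ
∑-insertions x []      F = refl
∑-insertions x (y ∷ τ) F = cong (F (x ∷ y ∷ τ) +_) (∑-map (y ∷_) (insertions x τ) F)

-- `permutations` is built by insertion, but conditioning on the first step of the process wants a
-- split by first entry. An inserted x either lands in front or leaves the old head in front; the
-- second case is the same statement for the shorter list, hence the mutual recursion.
∑-permutations : ∀ (x : A) xs F → ∑ (permutations (x ∷ xs)) F ≡
  ∑ (sel (x ∷ xs)) (λ p → ∑ (permutations (proj₂ p)) (λ τ → F (proj₁ p ∷ τ)))

∑-permutations-uncons : ∀ (xs : List A) G → ∑ (permutations xs) (uncons G) ≡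
  ∑ (sel xs) (λ p → ∑ (permutations (proj₂ p)) (G (proj₁ p)))

∑-permutations x xs F = trans (∑-concatMap (insertions x) (permutations xs) F)
  (trans (∑-cong (permutations xs) (λ τ _ → ∑-insertions x τ F))
  (trans (∑-+ (permutations xs) _ _) (cong (∑ (permutations xs) (λ τ → F (x ∷ τ)) +_)
  (trans (∑-permutations-uncons xs _)
  (trans (∑-cong (sel xs) (λ p _ → sym (∑-concatMap (insertions x) (permutations (proj₂ p)) _)))
         (sym (∑-map _ (sel xs) _)))))))

∑-permutations-uncons []       G = refl
∑-permutations-uncons (x ∷ xs) G = ∑-permutations x xs (uncons G)

length-permutations : ∀ U (xs : List A) → length xs ≡ U → ∑ (permutations xs) (λ _ → 1) ≡ U !
length-permutations zero    []       refl = refl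
length-permutations (suc U) (x ∷ xs) eq = trans (∑-permutations x xs (λ _ → 1))
  (trans (∑-cong (sel (x ∷ xs)) (λ p p∈ → length-permutations U (proj₂ p)
            (suc-injective (trans (sym (length-sel (x ∷ xs) p∈)) eq))))
  (trans (∑-sel₁ (x ∷ xs) (λ _ → U !)) (trans (∑-const (x ∷ xs) (U !)) (cong (_* (U !)) eq))))

-- Falling factorials

-- x(x-1)...(x-M+1), which truncated subtraction makes 0 for M > x. For M ≤ T, the quotient of
-- `ff (T ∸ d) M` by `ff T M` is the probability that the first M of T edges avoid d given ones.
ff : ℕ → ℕ → ℕ
ff x zero    = 1
ff x (suc M) = x * ff (x ∸ 1) M

ff-mono : ∀ {x y} M → x ≤ y → ff x M ≤ ff y M
ff-mono zero    x≤y = ≤-refl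
ff-mono (suc M) x≤y = *-mono-≤ x≤y (ff-mono M (∸-monoˡ-≤ 1 x≤y))

∸-swap : ∀ a b c → a ∸ b ∸ c ≡ a ∸ c ∸ b
∸-swap a b c = trans (∸-+-assoc a b c) (trans (cong (a ∸_) (+-comm b c)) (sym (∸-+-assoc a c b)))

-- As long as nothing is truncated, the sides differ by d e; otherwise the left side is 0.
∸-logconcave : ∀ a d e → (a ∸ d ∸ e) * a ≤ (a ∸ d) * (a ∸ e)
∸-logconcave a d e with d ≤? a
... | no d≰a rewrite m≤n⇒m∸n≡0 (<⇒≤ (≰⇒> d≰a)) | 0∸n≡0 e = z≤n
... | yes d≤a with e ≤? (a ∸ d)
... | no e≰ rewrite m≤n⇒m∸n≡0 (<⇒≤ (≰⇒> e≰)) = z≤n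
... | yes e≤ = go (a ∸ d ∸ e) a≡
  where
  a≡ : a ≡ (a ∸ d ∸ e) + e + d
  a≡ = sym (trans (cong (_+ d) (m∸n+n≡m e≤)) (m∸n+n≡m d≤a))
  go : ∀ c → a ≡ c + e + d → c * a ≤ (a ∸ d) * (a ∸ e)
  go c refl rewrite m+n∸n≡m (c + e) d | +-assoc c e d | +-comm e d | sym (+-assoc c d e) | m+n∸n≡m (c + d) e =
    ≤-trans (m≤m+n _ (e * d)) (≤-reflexive (lem c d e))
    where
    lem : ∀ c d e → c * (c + d + e) + e * d ≡ (c + e) * (c + d)
    lem = solve-∀

-- Factor by factor. In terms of probabilities: avoiding two disjoint sets is negatively correlated.
ff-logconcave : ∀ M x d e → ff (x ∸ d ∸ e) M * ff x M ≤ ff (x ∸ d) M * ff (x ∸ e) M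
ff-logconcave zero    x d e = ≤-refl
ff-logconcave (suc M) x d e = begin
  (x ∸ d ∸ e) * ff (x ∸ d ∸ e ∸ 1) M * (x * ff (x ∸ 1) M)
    ≡⟨ lem (x ∸ d ∸ e) _ x _ ⟩
  (x ∸ d ∸ e) * x * (ff (x ∸ d ∸ e ∸ 1) M * ff (x ∸ 1) M)
    ≤⟨ *-mono-≤ (∸-logconcave x d e) (≤-trans (≤-reflexive (cong (λ y → ff y M * ff (x ∸ 1) M) eq)) (ff-logconcave M (x ∸ 1) d e)) ⟩
  (x ∸ d) * (x ∸ e) * (ff (x ∸ 1 ∸ d) M * ff (x ∸ 1 ∸ e) M)
    ≡⟨ cong₂ (λ y z → (x ∸ d) * (x ∸ e) * (ff y M * ff z M)) (∸-swap x 1 d) (∸-swap x 1 e) ⟩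
  (x ∸ d) * (x ∸ e) * (ff (x ∸ d ∸ 1) M * ff (x ∸ e ∸ 1) M)
    ≡⟨ lem2 (x ∸ d) (x ∸ e) _ _ ⟩
  (x ∸ d) * ff (x ∸ d ∸ 1) M * ((x ∸ e) * ff (x ∸ e ∸ 1) M) ∎
  where
  open ≤-Reasoning
  eq : x ∸ d ∸ e ∸ 1 ≡ x ∸ 1 ∸ d ∸ e
  eq = trans (∸-swap (x ∸ d) e 1) (cong (_∸ e) (∸-swap x d 1))
  lem : ∀ a b c d → a * b * (c * d) ≡ a * c * (b * d)
  lem = solve-∀
  lem2 : ∀ a b c d → a * b * (c * d) ≡ a * c * (b * d)
  lem2 = solve-∀

-- Log-concavity iterated. This is where the bound w^(-t) for avoiding t D elements comes from.
ff-power : ∀ M x d t → ff (x ∸ t * d) M * ff x M ^ t ≤ ff (x ∸ d) M ^ t * ff x M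
ff-power M x d zero    = ≤-reflexive (*-comm (ff x M) 1)
ff-power M x d (suc t) = begin
  ff (x ∸ (d + t * d)) M * (ff x M * ff x M ^ t)
    ≡⟨ cong (λ y → ff y M * (ff x M * ff x M ^ t)) (sym (∸-+-assoc x d (t * d))) ⟩
  ff (x ∸ d ∸ t * d) M * (ff x M * ff x M ^ t)
    ≡⟨ sym (*-assoc (ff (x ∸ d ∸ t * d) M) (ff x M) (ff x M ^ t)) ⟩
  ff (x ∸ d ∸ t * d) M * ff x M * ff x M ^ t
    ≤⟨ *-monoˡ-≤ _ (ff-logconcave M x d (t * d)) ⟩
  ff (x ∸ d) M * ff (x ∸ t * d) M * ff x M ^ t
    ≡⟨ *-assoc (ff (x ∸ d) M) _ _ ⟩
  ff (x ∸ d) M * (ff (x ∸ t * d) M * ff x M ^ t)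
    ≤⟨ *-monoʳ-≤ (ff (x ∸ d) M) (ff-power M x d t) ⟩
  ff (x ∸ d) M * (ff (x ∸ d) M ^ t * ff x M)
    ≡⟨ sym (*-assoc (ff (x ∸ d) M) _ _) ⟩
  ff (x ∸ d) M * ff (x ∸ d) M ^ t * ff x M ∎
  where open ≤-Reasoning

ff-pos : ∀ x M → M ≤ x → 1 ≤ ff x M
ff-pos x       zero    _         = ≤-refl
ff-pos (suc x) (suc M) (s≤s M≤x) = *-mono-≤ {1} {suc x} (s≤s z≤n) (ff-pos x M M≤x)

ff-zero : ∀ x M → x < M → ff x M ≡ 0
ff-zero zero    (suc M) _         = refl
ff-zero (suc x) (suc M) (s≤s x<M) = trans (cong (suc x *_) (ff-zero x M x<M)) (*-zeroʳ (suc x))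

-- Orderings that avoid a set, and orderings in which one set precedes another

avoids : (A → Bool) → ℕ → List A → Bool
avoids b zero    σ       = true
avoids b (suc M) []      = true
avoids b (suc M) (x ∷ σ) = not (b x) ∧ avoids b M σ

-- Drawing without replacement, with the denominator of the probability cleared; for `M > length xs`
-- both sides are 0.
count-avoids : ∀ (b : A → Bool) M xs →
  ∑ (permutations xs) (λ σ → 𝟙 (avoids b M σ)) * ff (length xs) M ≡ (length xs) ! * ff (length xs ∸ count b xs) M
count-avoids b zero xs = cong (_* 1) (length-permutations (length xs) xs refl)
count-avoids b (suc M) [] = refl
count-avoids b (suc M) (x ∷ xs) = begin
  ∑ (permutations L) (λ σ → 𝟙 (avoids b (suc M) σ)) * (suc U * f)
    ≡⟨ cong (_* (suc U * f)) (∑-permutations x xs _) ⟩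
  ∑ (sel L) (λ p → ∑ (permutations (proj₂ p)) (λ τ → 𝟙 (not (b (proj₁ p)) ∧ avoids b M τ))) * (suc U * f)
    ≡⟨ lem₁ (∑ (sel L) X) (suc U) f ⟩
  suc U * (∑ (sel L) (λ p → ∑ (permutations (proj₂ p)) (λ τ → 𝟙 (not (b (proj₁ p)) ∧ avoids b M τ))) * f)
    ≡⟨ cong (suc U *_) (sym (∑-*ʳ (sel L) f X)) ⟩
  suc U * ∑ (sel L) (λ p → ∑ (permutations (proj₂ p)) (λ τ → 𝟙 (not (b (proj₁ p)) ∧ avoids b M τ)) * f)
    ≡⟨ cong (suc U *_) (∑-cong (sel L) per) ⟩
  suc U * ∑ (sel L) (λ p → 𝟙 (not (b (proj₁ p))) * (U ! * ff (U ∸ count b L) M))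
    ≡⟨ cong (suc U *_) (trans (∑-*ʳ (sel L) (U ! * ff (U ∸ count b L) M) (λ p → 𝟙 (not (b (proj₁ p))))) (cong (_* (U ! * ff (U ∸ count b L) M)) (∑-sel₁ L (λ y → 𝟙 (not (b y)))))) ⟩
  suc U * (count (λ y → not (b y)) L * (U ! * ff (U ∸ count b L) M))
    ≡⟨ cong (λ z → suc U * (z * (U ! * ff (U ∸ count b L) M))) cnt ⟩
  suc U * ((suc U ∸ count b L) * (U ! * ff (U ∸ count b L) M))
    ≡⟨ lem₂ (suc U) (suc U ∸ count b L) (U !) (ff (U ∸ count b L) M) ⟩
  suc U * U ! * ((suc U ∸ count b L) * ff (U ∸ count b L) M)
    ≡⟨ cong (λ z → suc U * U ! * ((suc U ∸ count b L) * ff z M)) (sym (∸-swap (suc U) (count b L) 1)) ⟩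
  suc U * U ! * ((suc U ∸ count b L) * ff (suc U ∸ count b L ∸ 1) M) ∎
  where
  open ≡-Reasoning
  L = x ∷ xs
  U = length xs
  f = ff U M
  X : _ → ℕ
  X p = ∑ (permutations (proj₂ p)) (λ τ → 𝟙 (not (b (proj₁ p)) ∧ avoids b M τ))
  lem₁ : ∀ a u f → a * (u * f) ≡ u * (a * f)
  lem₁ = solve-∀
  lem₂ : ∀ a b c d → a * (b * (c * d)) ≡ a * c * (b * d)
  lem₂ = solve-∀
  cnt : count (λ y → not (b y)) L ≡ suc U ∸ count b L
  cnt = trans (sym (m+n∸m≡n (count b L) _)) (cong (_∸ count b L) (count-not b L))
  per : ∀ p → p ∈ sel L → ∑ (permutations (proj₂ p)) (λ τ → 𝟙 (not (b (proj₁ p)) ∧ avoids b M τ)) * f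
      ≡ 𝟙 (not (b (proj₁ p))) * (U ! * ff (U ∸ count b L) M)
  per (y , r) p∈ with b y | ∑-sel L (λ z → 𝟙 (b z)) p∈ | length-sel L p∈
  ... | true  | _ | _ = cong (_* f) (trans (∑-const (permutations r) 0) (*-zeroʳ (length (permutations r))))
  ... | false | c | l = trans (cong (λ u → ∑ (permutations r) (λ τ → 𝟙 (avoids b M τ)) * ff u M) (suc-injective l)) (trans (count-avoids b M r)
    (trans (cong₂ (λ u c → u ! * ff (u ∸ c) M) (sym (suc-injective l)) (sym c)) (sym (+-identityʳ (U ! * ff (U ∸ count b L) M)))))

-- σ has at least M elements, and at least s marked by t, before its first b-element (or its end).
before : (t b : A → Bool) → ℕ → ℕ → List A → Bool
before t b s M []      = (s ≡ᵇ 0) ∧ (M ≡ᵇ 0)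
before t b s M (x ∷ σ) = if b x then (s ≡ᵇ 0) ∧ (M ≡ᵇ 0) else before t b (s ∸ 𝟙 (t x)) (M ∸ 1) σ

module _ (t b : A → Bool) (β β′ : ℕ) (4β′≤3β : 4 * β′ ≤ 3 * β) where

  private
    γ : ℕ → ℕ
    γ s = s ! * 4 ^ s

    -- The share of a marked first element: it lowers s by one, so one factor β and the 4 by which
    -- everything is multiplied remain beside `γ (s ∸ 1)`. For s = 0 there is no marked element,
    -- whence the value 0.
    ψ : ℕ → ℕ
    ψ zero    = 0
    ψ (suc s) = 4 * γ s * β

    s*ψ : ∀ s → s * ψ s ≤ γ s * β
    s*ψ zero    = z≤n
    s*ψ (suc s) = ≤-reflexive (lem (suc s) (s !) (4 ^ s) β)
      where
      lem : ∀ a b c d → a * (4 * (b * c) * d) ≡ a * b * (4 * c) * d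
      lem = solve-∀

    -- The slack β/4 pays for the marked elements.
    slack : ∀ V → β ≤ V → β + (V ∸ β) * 4 ≤ 4 * (V ∸ β′)
    slack V β≤V = go (V ∸ β) (β ∸ β′) (sym (m+[n∸m]≡n β≤V)) (sym (m+[n∸m]≡n β′≤β))
      where
      β′≤β : β′ ≤ β
      β′≤β = *-cancelˡ-≤ 4 (≤-trans 4β′≤3β (*-monoˡ-≤ β (n≤1+n 3)))
      go : ∀ o e → V ≡ β + o → β ≡ β′ + e → β + o * 4 ≤ 4 * (V ∸ β′)
      go o e refl β≡ = begin
        β + o * 4            ≤⟨ +-monoˡ-≤ (o * 4) β≤4e ⟩
        e * 4 + o * 4        ≡⟨ lem e o ⟩
        4 * (e + o)          ≡⟨ cong (4 *_) (sym (m+n∸m≡n β′ (e + o))) ⟩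
        4 * (β′ + (e + o) ∸ β′) ≡⟨ cong (λ z → 4 * (z ∸ β′)) (trans (sym (+-assoc β′ e o)) (cong (_+ o) (sym β≡))) ⟩
        4 * (β + o ∸ β′) ∎
        where
        open ≤-Reasoning
        lem : ∀ e o → e * 4 + o * 4 ≡ 4 * (e + o)
        lem = solve-∀
        lem2 : ∀ a e → 3 * (a + e) ≡ 3 * e + 3 * a
        lem2 = solve-∀
        β′≤3e : β′ ≤ 3 * e
        β′≤3e = +-cancelʳ-≤ (3 * β′) β′ (3 * e) (≤-trans 4β′≤3β (≤-reflexive (trans (cong (3 *_) β≡) (lem2 β′ e))))
        lem3 : ∀ e → 3 * e + e ≡ e * 4
        lem3 = solve-∀
        β≤4e : β ≤ e * 4
        β≤4e = ≤-trans (≤-reflexive β≡) (≤-trans (+-monoˡ-≤ e β′≤3e) (≤-reflexive (lem3 e)))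

  -- The right-hand side is s! (4/β)^s times the probability of avoiding a set of size β′ for M steps:
  -- conditioning on the first element shows that this product is a supersolution.
  count-before : ∀ U xs s M → length xs ≡ U → count b xs ≡ β → count t xs ≤ s →
    ∑ (permutations xs) (λ σ → 𝟙 (before t b s M σ)) * (β ^ s * ff U M) ≤ U ! * (s ! * 4 ^ s * ff (U ∸ β′) M)
  count-before zero [] zero    zero    refl _ _ = ≤-refl
  count-before zero [] zero    (suc M) refl _ _ = z≤n
  count-before zero [] (suc s) M       refl _ _ = z≤n
  count-before (suc U) (x ∷ xs) s M l cb ct = finish s M l cb ct
    where
    L = x ∷ xs
    f = λ M → ff U (M ∸ 1)
    h = λ M → ff (U ∸ β′) (M ∸ 1)
    E : ℕ → ℕ → ℕ
    E s M = ∑ (permutations L) (λ σ → 𝟙 (before t b s M σ))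

    -- A first element in b contributes nothing, since s = M = 0 is excluded. One marked by t but
    -- not by b is charged both terms; this overcount lets the sums over t and over the complement
    -- of b be taken separately.
    per : ∀ s M → count t L ≤ s → (s ≡ᵇ 0) ∧ (M ≡ᵇ 0) ≡ false → length L ≡ suc U → count b L ≡ β → ∀ p → p ∈ sel L →
      4 * (∑ (permutations (proj₂ p)) (λ τ → 𝟙 (before t b s M (proj₁ p ∷ τ))) * (β ^ s * f M))
        ≤ U ! * h M * (𝟙 (t (proj₁ p)) * ψ s + 𝟙 (not (b (proj₁ p))) * (4 * γ s))
    per s M ct ne l cb (y , r) p∈ with b y | t y | ∑-sel L (λ z → 𝟙 (b z)) p∈ | ∑-sel L (λ z → 𝟙 (t z)) p∈ | suc-injective (trans (sym (length-sel L p∈)) l)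
    ... | true | _ | _ | _ | _ rewrite ne | ∑-const (permutations r) 0 | *-zeroʳ (length (permutations r)) = z≤n
    ... | false | true | c | c′ | l′ = go s ct
      where
      go : ∀ s → count t L ≤ s → 4 * (∑ (permutations r) (λ τ → 𝟙 (before t b (s ∸ 1) (M ∸ 1) τ)) * (β ^ s * f M))
        ≤ U ! * h M * (1 * ψ s + 1 * (4 * γ s))
      go zero    ct = contradiction (≤-trans (≤-reflexive (sym c′)) ct) λ ()
      go (suc s) ct = begin
        4 * (X * (β * β ^ s * f M))       ≡⟨ lem X β (β ^ s) (f M) ⟩
        4 * β * (X * (β ^ s * f M))       ≤⟨ *-monoʳ-≤ (4 * β) (count-before U r s (M ∸ 1) l′ (trans (sym c) cb) (≤-pred (≤-trans (≤-reflexive (sym c′)) ct))) ⟩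
        4 * β * (U ! * (γ s * h M))       ≡⟨ lem′ β (U !) (γ s) (h M) ⟩
        U ! * h M * (1 * ψ (suc s))       ≤⟨ *-monoʳ-≤ (U ! * h M) (m≤m+n _ _) ⟩
        U ! * h M * (1 * ψ (suc s) + 1 * (4 * γ (suc s))) ∎
        where
        open ≤-Reasoning
        X = ∑ (permutations r) (λ τ → 𝟙 (before t b s (M ∸ 1) τ))
        lem : ∀ X β p f → 4 * (X * (β * p * f)) ≡ 4 * β * (X * (p * f))
        lem = solve-∀
        lem′ : ∀ β u g h → 4 * β * (u * (g * h)) ≡ u * h * (1 * (4 * g * β))
        lem′ = solve-∀
    ... | false | false | c | c′ | l′ = begin
        4 * (X * (β ^ s * f M))           ≤⟨ *-monoʳ-≤ 4 (count-before U r s (M ∸ 1) l′ (trans (sym c) cb) (≤-trans (≤-reflexive (sym c′)) ct)) ⟩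
        4 * (U ! * (γ s * h M))           ≡⟨ lem (U !) (γ s) (h M) ⟩
        U ! * h M * (1 * (4 * γ s)) ∎
        where
        open ≤-Reasoning
        X = ∑ (permutations r) (λ τ → 𝟙 (before t b s (M ∸ 1) τ))
        lem : ∀ u g h → 4 * (u * (g * h)) ≡ u * h * (1 * (4 * g))
        lem = solve-∀

    main : ∀ s M → count t L ≤ s → (s ≡ᵇ 0) ∧ (M ≡ᵇ 0) ≡ false → length L ≡ suc U → count b L ≡ β →
      E s M * (β ^ s * f M) ≤ U ! * h M * (γ s * (suc U ∸ β′))
    main s M ct ne l cb = *-cancelˡ-≤ 4 (begin
      4 * (E s M * (β ^ s * f M))
        ≡⟨ cong (λ z → 4 * (z * (β ^ s * f M))) (∑-permutations x xs _) ⟩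
      4 * (∑ (sel L) (λ p → ∑ (permutations (proj₂ p)) (λ τ → 𝟙 (before t b s M (proj₁ p ∷ τ)))) * (β ^ s * f M))
        ≡⟨ trans (cong (4 *_) (sym (∑-*ʳ (sel L) (β ^ s * f M) X))) (sym (∑-*ˡ (sel L) 4 (λ p → X p * (β ^ s * f M)))) ⟩
      ∑ (sel L) (λ p → 4 * (∑ (permutations (proj₂ p)) (λ τ → 𝟙 (before t b s M (proj₁ p ∷ τ))) * (β ^ s * f M)))
        ≤⟨ ∑-mono (sel L) (per s M ct ne l cb) ⟩
      ∑ (sel L) (λ p → U ! * h M * (𝟙 (t (proj₁ p)) * ψ s + 𝟙 (not (b (proj₁ p))) * (4 * γ s)))
        ≡⟨ trans (∑-*ˡ (sel L) (U ! * h M) (λ p → 𝟙 (t (proj₁ p)) * ψ s + 𝟙 (not (b (proj₁ p))) * (4 * γ s)))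
             (cong (U ! * h M *_) (trans (∑-+ (sel L) (λ p → 𝟙 (t (proj₁ p)) * ψ s) (λ p → 𝟙 (not (b (proj₁ p))) * (4 * γ s)))
             (cong₂ _+_ (trans (∑-*ʳ (sel L) (ψ s) (λ p → 𝟙 (t (proj₁ p)))) (cong (_* ψ s) (∑-sel₁ L (λ y → 𝟙 (t y)))))
                        (trans (∑-*ʳ (sel L) (4 * γ s) (λ p → 𝟙 (not (b (proj₁ p))))) (cong (_* (4 * γ s)) (∑-sel₁ L (λ y → 𝟙 (not (b y))))))))) ⟩
      U ! * h M * (count t L * ψ s + count (λ y → not (b y)) L * (4 * γ s))
        ≤⟨ *-monoʳ-≤ (U ! * h M) (+-mono-≤ (≤-trans (*-monoˡ-≤ (ψ s) ct) (s*ψ s)) (≤-reflexive (cong (_* (4 * γ s)) cnt))) ⟩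
      U ! * h M * (γ s * β + (suc U ∸ β) * (4 * γ s))
        ≡⟨ cong (U ! * h M *_) (lem (γ s) β (suc U ∸ β)) ⟩
      U ! * h M * (γ s * (β + (suc U ∸ β) * 4))
        ≤⟨ *-monoʳ-≤ (U ! * h M) (*-monoʳ-≤ (γ s) (slack (suc U) β≤)) ⟩
      U ! * h M * (γ s * (4 * (suc U ∸ β′)))
        ≡⟨ lem′ (U ! * h M) (γ s) (suc U ∸ β′) ⟩
      4 * (U ! * h M * (γ s * (suc U ∸ β′))) ∎)
      where
      open ≤-Reasoning
      X : A × List A → ℕ
      X p = ∑ (permutations (proj₂ p)) (λ τ → 𝟙 (before t b s M (proj₁ p ∷ τ)))
      lem : ∀ g b v → g * b + v * (4 * g) ≡ g * (b + v * 4)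
      lem = solve-∀
      lem′ : ∀ a g v → a * (g * (4 * v)) ≡ 4 * (a * (g * v))
      lem′ = solve-∀
      tot : β + count (λ y → not (b y)) L ≡ suc U
      tot = trans (cong (_+ count (λ y → not (b y)) L) (sym cb)) (trans (count-not b L) l)
      β≤ : β ≤ suc U
      β≤ = ≤-trans (m≤m+n β _) (≤-reflexive tot)
      cnt : count (λ y → not (b y)) L ≡ suc U ∸ β
      cnt = trans (sym (m+n∸m≡n β _)) (cong (_∸ β) tot)

    finish : ∀ s M → length L ≡ suc U → count b L ≡ β → count t L ≤ s →
      E s M * (β ^ s * ff (suc U) M) ≤ (suc U) ! * (γ s * ff (suc U ∸ β′) M)
    finish zero zero l _ _ = *-mono-≤
      (≤-trans (∑-mono (permutations (x ∷ xs)) (λ σ _ → 𝟙≤1 _)) (≤-reflexive (length-permutations (suc U) (x ∷ xs) l))) ≤-refl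
    finish (suc s) zero l cb ct = ≤-trans (main (suc s) zero ct refl l cb) (≤-trans
      (*-monoʳ-≤ (U ! * 1) (*-monoʳ-≤ (γ (suc s)) (m∸n≤m (suc U) β′))) (≤-reflexive (lem (U !) (γ (suc s)) (suc U))))
      where
      lem : ∀ u g v → u * 1 * (g * v) ≡ v * u * (g * 1)
      lem = solve-∀
    finish s (suc M) l cb ct = begin
      E s (suc M) * (β ^ s * (suc U * ff U M))  ≡⟨ lem (E s (suc M)) (β ^ s) (suc U) (ff U M) ⟩
      suc U * (E s (suc M) * (β ^ s * ff U M))  ≤⟨ *-monoʳ-≤ (suc U) (main s (suc M) ct (nz s) l cb) ⟩
      suc U * (U ! * ff (U ∸ β′) M * (γ s * (suc U ∸ β′))) ≡⟨ lem′ (suc U) (U !) (ff (U ∸ β′) M) (γ s) (suc U ∸ β′) ⟩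
      (suc U) ! * (γ s * ((suc U ∸ β′) * ff (U ∸ β′) M))
        ≡⟨ cong (λ z → (suc U) ! * (γ s * ((suc U ∸ β′) * ff z M))) (∸-swap (suc U) 1 β′) ⟩
      (suc U) ! * (γ s * ((suc U ∸ β′) * ff (suc U ∸ β′ ∸ 1) M)) ∎
      where
      open ≤-Reasoning
      nz : ∀ s → (s ≡ᵇ 0) ∧ false ≡ false
      nz zero = refl
      nz (suc s) = refl
      lem : ∀ e p u f → e * (p * (u * f)) ≡ u * (e * (p * f))
      lem = solve-∀
      lem′ : ∀ u v f g w → u * (v * f * (g * w)) ≡ u * v * (g * (w * f))
      lem′ = solve-∀

-- Binomial coefficients, by the recursion which allSubsets follows

bin : ℕ → ℕ → ℕ
bin n       zero    = 1
bin zero    (suc k) = 0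
bin (suc n) (suc k) = bin n k + bin n (suc k)

bin-1 : ∀ n → bin n 1 ≡ n
bin-1 zero    = refl
bin-1 (suc n) = cong suc (bin-1 n)

bin-absorb : ∀ x i → suc i * bin (suc x) (suc i) ≡ suc x * bin x i
bin-absorb x zero = trans (+-identityʳ _) (trans (cong suc (bin-1 x)) (sym (*-identityʳ (suc x))))
bin-absorb zero (suc i) = *-zeroʳ i
bin-absorb (suc x) (suc i) = begin
  suc (suc i) * (P + (Q + R))          ≡⟨ lem₁ (suc i) P (Q + R) ⟩
  suc i * P + P + suc (suc i) * (Q + R) ≡⟨ cong₂ (λ a b → a + P + b) (bin-absorb x i) (bin-absorb x (suc i)) ⟩
  suc x * bin x i + P + suc x * Q      ≡⟨ lem₂ (suc x) (bin x i) P Q ⟩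
  P + suc x * (bin x i + Q)            ≡⟨⟩
  suc (suc x) * P ∎
  where
  open ≡-Reasoning
  P = bin (suc x) (suc i)
  Q = bin x (suc i)
  R = bin x (suc (suc i))
  lem₁ : ∀ s p q → suc s * (p + q) ≡ s * p + p + suc s * q
  lem₁ = solve-∀
  lem₂ : ∀ s a p q → s * a + p + s * q ≡ p + s * (a + q)
  lem₂ = solve-∀

bin-monoˡ-suc : ∀ n k → bin n k ≤ bin (suc n) k
bin-monoˡ-suc n zero    = ≤-refl
bin-monoˡ-suc n (suc k) = m≤n+m _ _

bin-monoˡ : ∀ {m n} k → m ≤ n → bin m k ≤ bin n k
bin-monoˡ {m} {n} k m≤n = go m n (n ∸ m) (sym (m+[n∸m]≡n m≤n))
  where
  go : ∀ m n d → n ≡ m + d → bin m k ≤ bin n k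
  go m _ zero    refl = ≤-reflexive (cong (λ z → bin z k) (sym (+-identityʳ m)))
  go m _ (suc d) refl = ≤-trans (go m (m + d) d refl) (≤-trans (bin-monoˡ-suc (m + d) k)
    (≤-reflexive (cong (λ z → bin z k) (sym (+-suc m d)))))

bin-diag-≤ : ∀ m j i → bin m i ≤ bin (j + m) (j + i)
bin-diag-≤ m zero    i = ≤-refl
bin-diag-≤ m (suc j) i = ≤-trans (bin-diag-≤ m j i) (m≤m+n _ _)

bin-≥1 : ∀ n k → k ≤ n → 1 ≤ bin n k
bin-≥1 n       zero    _         = ≤-refl
bin-≥1 (suc n) (suc k) (s≤s k≤n) = ≤-trans (bin-≥1 n k k≤n) (m≤m+n _ _)

-- Needed twice: for κ ≥ k ≥ 3, and for N ≥ n, through which all largeness conditions on N become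
-- conditions on n.
bin-≥n : ∀ n k → 1 ≤ k → k < n → n ≤ bin n k
bin-≥n (suc n) (suc zero)    _ _ = ≤-reflexive (sym (bin-1 (suc n)))
bin-≥n (suc n) (suc (suc k)) _ (s≤s k<n) with suc (suc k) ≟ n
... | yes refl = ≤-trans (≤-reflexive (+-comm 1 n)) (+-mono-≤ (bin-≥n n (suc k) (s≤s z≤n) ≤-refl) (bin-≥1 n n ≤-refl))
... | no  ≢    = ≤-trans (+-mono-≤ (bin-≥1 n (suc k) (<⇒≤ k<n)) (bin-≥n n (suc (suc k)) (s≤s z≤n) (≤∧≢⇒< k<n ≢))) ≤-refl

bin-≤^ : ∀ n k → bin n k ≤ n ^ k
bin-≤^ n       zero    = ≤-refl
bin-≤^ zero    (suc k) = z≤n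
bin-≤^ (suc n) (suc k) = begin
  bin n k + bin n (suc k) ≤⟨ +-mono-≤ (bin-≤^ n k) (bin-≤^ n (suc k)) ⟩
  suc n * n ^ k           ≤⟨ *-monoʳ-≤ (suc n) (^-monoˡ-≤ k (n≤1+n n)) ⟩
  suc n * suc n ^ k ∎
  where open ≤-Reasoning

-- The right side is (y+1)(y+2)...(y+i). It shows that N is at least a constant times n^j.
^≤!*bin : ∀ y i → y ^ i ≤ i ! * bin (i + y) i
^≤!*bin y zero    = ≤-refl
^≤!*bin y (suc i) = begin
  y * y ^ i                                ≤⟨ *-mono-≤ (m≤n+m y (suc i)) (^≤!*bin y i) ⟩
  suc (i + y) * (i ! * bin (i + y) i)      ≡⟨ lem (suc (i + y)) (i !) (bin (i + y) i) ⟩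
  i ! * (suc (i + y) * bin (i + y) i)      ≡⟨ cong (i ! *_) (sym (bin-absorb (i + y) i)) ⟩
  i ! * (suc i * bin (suc (i + y)) (suc i)) ≡⟨ lem′ (i !) (suc i) (bin (suc (i + y)) (suc i)) ⟩
  suc i * i ! * bin (suc (i + y)) (suc i) ∎
  where
  open ≤-Reasoning
  lem : ∀ a b c → a * (b * c) ≡ b * (a * c)
  lem = solve-∀
  lem′ : ∀ a b c → a * (b * c) ≡ b * a * c
  lem′ = solve-∀

-- cb c p t counts the t-sets of a set of size c + p which contain a given p-set.
cb : ℕ → ℕ → ℕ → ℕ
cb c zero    t       = bin c t
cb c (suc p) zero    = 0
cb c (suc p) (suc t) = cb c p t

cb-zero : ∀ c p → cb (suc c) p 0 ≡ cb c p 0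
cb-zero c zero    = refl
cb-zero c (suc p) = refl

cb-suc : ∀ c p t → cb (suc c) p (suc t) ≡ cb c p t + cb c p (suc t)
cb-suc c zero    t       = refl
cb-suc c (suc p) zero    = cb-zero c p
cb-suc c (suc p) (suc t) = cb-suc c p t

cb-bin : ∀ c p t → cb c p (p + t) ≡ bin c t
cb-bin c zero    t = refl
cb-bin c (suc p) t = cb-bin c p t

-- Subsets as bit vectors

infix 7 _⊑_ _==_

_⊑_ : Subset n → Subset n → Bool
[]          ⊑ []          = true
(true  ∷ p) ⊑ (b ∷ q)     = b ∧ p ⊑ q
(false ∷ p) ⊑ (_ ∷ q)     = p ⊑ q

_==_ : Subset n → Subset n → Bool
[]          == []          = true
(true  ∷ p) == (b ∷ q)     = b ∧ p == q
(false ∷ p) == (b ∷ q)     = not b ∧ p == q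

co : Subset n → ℕ
co []          = 0
co (true  ∷ p) = co p
co (false ∷ p) = suc (co p)

co+card : (p : Subset n) → co p + ∣ p ∣ ≡ n
co+card []          = refl
co+card (true  ∷ p) = trans (+-suc (co p) ∣ p ∣) (cong suc (co+card p))
co+card (false ∷ p) = cong suc (co+card p)

co≡ : (p : Subset n) → co p ≡ n ∸ ∣ p ∣
co≡ p = trans (sym (m+n∸n≡m (co p) ∣ p ∣)) (cong (_∸ ∣ p ∣) (co+card p))

==⇒≡ : (p q : Subset n) → p == q ≡ true → p ≡ q
==⇒≡ []          []          _ = refl
==⇒≡ (true  ∷ p) (true  ∷ q) h = cong (true ∷_) (==⇒≡ p q h)
==⇒≡ (false ∷ p) (false ∷ q) h = cong (false ∷_) (==⇒≡ p q h)

==-refl : (p : Subset n) → p == p ≡ true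
==-refl []          = refl
==-refl (true  ∷ p) = ==-refl p
==-refl (false ∷ p) = ==-refl p

⊑-refl : (p : Subset n) → p ⊑ p ≡ true
⊑-refl []          = refl
⊑-refl (true  ∷ p) = ⊑-refl p
⊑-refl (false ∷ p) = ⊑-refl p

⊑⇒⊆ : (p q : Subset n) → p ⊑ q ≡ true → p Data.Fin.Subset.⊆ q
⊑⇒⊆ (true  ∷ p) (true ∷ q) h Data.Vec.here       = Data.Vec.here
⊑⇒⊆ (true  ∷ p) (true ∷ q) h (Data.Vec.there x∈) = Data.Vec.there (⊑⇒⊆ p q h x∈)
⊑⇒⊆ (false ∷ p) (b ∷ q)    h (Data.Vec.there x∈) = Data.Vec.there (⊑⇒⊆ p q h x∈)

⊆⇒⊑ : (p q : Subset n) → p Data.Fin.Subset.⊆ q → p ⊑ q ≡ true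
⊆⇒⊑ []          []          h = refl
⊆⇒⊑ (true  ∷ p) (b     ∷ q) h with h Data.Vec.here
... | Data.Vec.here = ⊆⇒⊑ p q (λ x∈ → drop-there (h (Data.Vec.there x∈)))
⊆⇒⊑ (false ∷ p) (b     ∷ q) h = ⊆⇒⊑ p q (λ x∈ → drop-there (h (Data.Vec.there x∈)))

⊑-trans : (p q r : Subset n) → p ⊑ q ≡ true → q ⊑ r ≡ true → p ⊑ r ≡ true
⊑-trans p q r h h′ = ⊆⇒⊑ p r (λ x∈ → ⊑⇒⊆ q r h′ (⊑⇒⊆ p q h x∈))

∪-⊑ : (p q r : Subset n) → (p ∪ q) ⊑ r ≡ (p ⊑ r) ∧ (q ⊑ r)
∪-⊑ [] [] [] = refl
∪-⊑ (true  ∷ p) (true  ∷ q) (true  ∷ r) = ∪-⊑ p q r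
∪-⊑ (true  ∷ p) (true  ∷ q) (false ∷ r) = refl
∪-⊑ (true  ∷ p) (false ∷ q) (true  ∷ r) = ∪-⊑ p q r
∪-⊑ (true  ∷ p) (false ∷ q) (false ∷ r) = refl
∪-⊑ (false ∷ p) (true  ∷ q) (true  ∷ r) = ∪-⊑ p q r
∪-⊑ (false ∷ p) (true  ∷ q) (false ∷ r) with p ⊑ r
... | true  = refl
... | false = refl
∪-⊑ (false ∷ p) (false ∷ q) (_ ∷ r) = ∪-⊑ p q r

card-∪-≤ : (p q : Subset n) → ∣ p ∪ q ∣ ≤ ∣ p ∣ + ∣ q ∣
card-∪-≤ [] [] = z≤n
card-∪-≤ (true  ∷ p) (true  ∷ q) = s≤s (≤-trans (card-∪-≤ p q) (+-monoʳ-≤ ∣ p ∣ (n≤1+n _)))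
card-∪-≤ (true  ∷ p) (false ∷ q) = s≤s (card-∪-≤ p q)
card-∪-≤ (false ∷ p) (true  ∷ q) = ≤-trans (s≤s (card-∪-≤ p q)) (≤-reflexive (sym (+-suc ∣ p ∣ ∣ q ∣)))
card-∪-≤ (false ∷ p) (false ∷ q) = card-∪-≤ p q

p⊑p∪q : (p q : Subset n) → p ⊑ (p ∪ q) ≡ true
p⊑p∪q [] [] = refl
p⊑p∪q (true  ∷ p) (_ ∷ q) = p⊑p∪q p q
p⊑p∪q (false ∷ p) (_ ∷ q) = p⊑p∪q p q

q⊑p∪q : (p q : Subset n) → q ⊑ (p ∪ q) ≡ true
q⊑p∪q [] [] = refl
q⊑p∪q (true  ∷ p) (true  ∷ q) = q⊑p∪q p q
q⊑p∪q (true  ∷ p) (false ∷ q) = q⊑p∪q p q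
q⊑p∪q (false ∷ p) (true  ∷ q) = q⊑p∪q p q
q⊑p∪q (false ∷ p) (false ∷ q) = q⊑p∪q p q

p∩q⊑p : (p q : Subset n) → (p ∩ q) ⊑ p ≡ true
p∩q⊑p [] [] = refl
p∩q⊑p (true  ∷ p) (true  ∷ q) = p∩q⊑p p q
p∩q⊑p (true  ∷ p) (false ∷ q) = p∩q⊑p p q
p∩q⊑p (false ∷ p) (_     ∷ q) = p∩q⊑p p q

⊑⇒∩≡ : (p q : Subset n) → p ⊑ q ≡ true → p ∩ q ≡ p
⊑⇒∩≡ [] [] _ = refl
⊑⇒∩≡ (true  ∷ p) (true ∷ q) h = cong (true ∷_) (⊑⇒∩≡ p q h)
⊑⇒∩≡ (false ∷ p) (_    ∷ q) h = cong (false ∷_) (⊑⇒∩≡ p q h)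

-- Counting subsets

∑-allSubsets : ∀ n (f : Subset (suc n) → ℕ) →
  ∑ (allSubsets (suc n)) f ≡ ∑ (allSubsets n) (λ s → f (true ∷ s)) + ∑ (allSubsets n) (λ s → f (false ∷ s))
∑-allSubsets n f = trans (∑-++ (map (true ∷_) (allSubsets n)) _ f)
  (cong₂ _+_ (∑-map (true ∷_) (allSubsets n) f) (∑-map (false ∷_) (allSubsets n) f))

∑-zero : (xs : List A) {f : A → ℕ} → (∀ x → f x ≡ 0) → ∑ xs f ≡ 0
∑-zero xs h = trans (∑-cong xs (λ x _ → h x)) (trans (∑-const xs 0) (*-zeroʳ (length xs)))

∑-ext : (xs : List A) {f g : A → ℕ} → (∀ x → f x ≡ g x) → ∑ xs f ≡ ∑ xs g
∑-ext xs h = ∑-cong xs (λ x _ → h x)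

count-⊇ : ∀ (J : Subset n) t →
  ∑ (allSubsets n) (λ f → 𝟙 (∣ f ∣ ≡ᵇ t) * 𝟙 (J ⊑ f)) ≡ cb (co J) ∣ J ∣ t
count-⊇ {zero} [] zero    = refl
count-⊇ {zero} [] (suc t) = refl
count-⊇ {suc n} (true ∷ J) zero = trans (∑-allSubsets n _)
  (cong₂ _+_ (∑-zero (allSubsets n) (λ f → refl)) (∑-zero (allSubsets n) (λ f → *-zeroʳ (𝟙 (∣ f ∣ ≡ᵇ 0)))))
count-⊇ {suc n} (true ∷ J) (suc t) = trans (∑-allSubsets n _)
  (trans (cong₂ _+_ (count-⊇ J t) (∑-zero (allSubsets n) (λ f → *-zeroʳ (𝟙 (∣ f ∣ ≡ᵇ suc t))))) (+-identityʳ _))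
count-⊇ {suc n} (false ∷ J) zero = trans (∑-allSubsets n _)
  (trans (cong₂ _+_ (∑-zero (allSubsets n) (λ f → refl)) (count-⊇ J 0)) (sym (cb-zero (co J) ∣ J ∣)))
count-⊇ {suc n} (false ∷ J) (suc t) = trans (∑-allSubsets n _)
  (trans (cong₂ _+_ (count-⊇ J t) (count-⊇ J (suc t))) (sym (cb-suc (co J) ∣ J ∣ t)))

count-⊆ : ∀ (e : Subset n) j →
  ∑ (allSubsets n) (λ J → 𝟙 (∣ J ∣ ≡ᵇ j) * 𝟙 (J ⊑ e)) ≡ bin ∣ e ∣ j
count-⊆ {zero} [] zero    = refl
count-⊆ {zero} [] (suc j) = refl
count-⊆ {suc n} (true ∷ e) zero = trans (∑-allSubsets n _)
  (cong₂ _+_ (∑-zero (allSubsets n) (λ f → refl)) (count-⊆ e 0))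
count-⊆ {suc n} (true ∷ e) (suc j) = trans (∑-allSubsets n _) (cong₂ _+_ (count-⊆ e j) (count-⊆ e (suc j)))
count-⊆ {suc n} (false ∷ e) j = trans (∑-allSubsets n _)
  (cong₂ _+_ (∑-zero (allSubsets n) (λ J → *-zeroʳ (𝟙 (suc ∣ J ∣ ≡ᵇ j)))) (count-⊆ e j))

-- Such an f consists of J and of t - ∣ J ∣ elements outside V.
count-trace : ∀ (V J : Subset n) t → J ⊑ V ≡ true →
  ∑ (allSubsets n) (λ f → 𝟙 (∣ f ∣ ≡ᵇ t) * 𝟙 ((f ∩ V) == J)) ≡ cb (co V) ∣ J ∣ t
count-trace {zero} [] [] zero    _ = refl
count-trace {zero} [] [] (suc t) _ = refl
count-trace {suc n} (true ∷ V) (true ∷ J) zero h = trans (∑-allSubsets n _)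
  (cong₂ _+_ (∑-zero (allSubsets n) (λ f → refl)) (∑-zero (allSubsets n) (λ f → *-zeroʳ (𝟙 (∣ f ∣ ≡ᵇ 0)))))
count-trace {suc n} (true ∷ V) (true ∷ J) (suc t) h = trans (∑-allSubsets n _)
  (trans (cong₂ _+_ (count-trace V J t h) (∑-zero (allSubsets n) (λ f → *-zeroʳ (𝟙 (∣ f ∣ ≡ᵇ suc t))))) (+-identityʳ _))
count-trace {suc n} (true ∷ V) (false ∷ J) t h = trans (∑-allSubsets n _)
  (cong₂ _+_ (∑-zero (allSubsets n) (λ f → *-zeroʳ (𝟙 (suc ∣ f ∣ ≡ᵇ t)))) (count-trace V J t h))
count-trace {suc n} (false ∷ V) (false ∷ J) zero h = trans (∑-allSubsets n _)
  (trans (cong₂ _+_ (∑-zero (allSubsets n) (λ f → refl)) (count-trace V J 0 h)) (sym (cb-zero (co V) ∣ J ∣)))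
count-trace {suc n} (false ∷ V) (false ∷ J) (suc t) h = trans (∑-allSubsets n _)
  (trans (cong₂ _+_ (count-trace V J t h) (count-trace V J (suc t) h)) (sym (cb-suc (co V) ∣ J ∣ t)))

count-== : ∀ (c : Subset n) → count (c ==_) (allSubsets n) ≡ 1
count-== {zero}  []          = refl
count-== {suc n} (true  ∷ c) = trans (∑-allSubsets n _) (cong₂ _+_ (count-== c) (∑-zero (allSubsets n) (λ f → refl)))
count-== {suc n} (false ∷ c) = trans (∑-allSubsets n _) (cong₂ _+_ (∑-zero (allSubsets n) (λ f → refl)) (count-== c))

∑-ksets : ∀ n k (f : Subset n → ℕ) → ∑ (ksets n k) f ≡ ∑ (allSubsets n) (λ s → 𝟙 (∣ s ∣ ≡ᵇ k) * f s)
∑-ksets n k f = ∑-filter (λ s → ∣ s ∣ ≟ k) (allSubsets n) f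

∑-ksets-≤ : ∀ n k (f : Subset n → ℕ) → ∑ (ksets n k) f ≤ ∑ (allSubsets n) f
∑-ksets-≤ n k f = ≤-trans (≤-reflexive (∑-ksets n k f)) (∑-mono (allSubsets n) (λ s _ →
  ≤-trans (*-monoˡ-≤ (f s) (𝟙≤1 (∣ s ∣ ≡ᵇ k))) (≤-reflexive (+-identityʳ _))))

∈-allSubsets : (s : Subset n) → s ∈ allSubsets n
∈-allSubsets []                = here refl
∈-allSubsets {suc n} (true  ∷ s) = ∈-++⁺ˡ (∈-map⁺ (true ∷_) (∈-allSubsets s))
∈-allSubsets {suc n} (false ∷ s) = ∈-++⁺ʳ (map (true ∷_) (allSubsets n)) (∈-map⁺ (false ∷_) (∈-allSubsets s))

∈-ksets⁺ : ∀ k {s : Subset n} → ∣ s ∣ ≡ k → s ∈ ksets n k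
∈-ksets⁺ k {s} eq = ∈-filter⁺ (λ s → ∣ s ∣ ≟ k) (∈-allSubsets s) eq

∈-ksets⁻ : ∀ k {s : Subset n} → s ∈ ksets n k → ∣ s ∣ ≡ k
∈-ksets⁻ {n} k s∈ = proj₂ (∈-filter⁻ (λ s → ∣ s ∣ ≟ k) {xs = allSubsets n} s∈)

length-ksets : ∀ n k → length (ksets n k) ≡ bin n k
length-ksets n k = trans (sym (∑-one (ksets n k))) (trans (∑-ksets n k (λ _ → 1)) (go n k))
  where
  go : ∀ n k → ∑ (allSubsets n) (λ s → 𝟙 (∣ s ∣ ≡ᵇ k) * 1) ≡ bin n k
  go zero    zero    = refl
  go zero    (suc k) = refl
  go (suc n) zero    = trans (∑-allSubsets n _) (cong₂ _+_ (∑-zero (allSubsets n) (λ s → refl)) (go n 0))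
  go (suc n) (suc k) = trans (∑-allSubsets n _) (cong₂ _+_ (go n k) (go n (suc k)))

-- Small sets and exchange

pick : ∀ (f : Subset n) j → j ≤ ∣ f ∣ → ∃ λ J → J ⊑ f ≡ true × ∣ J ∣ ≡ j
pick []          zero    _ = [] , refl , refl
pick (false ∷ f) j       h with pick f j h
... | J , s , c = false ∷ J , s , c
pick (true  ∷ f) zero    h with pick f 0 z≤n
... | J , s , c = false ∷ J , s , c
pick (true  ∷ f) (suc j) (s≤s h) with pick f j h
... | J , s , c = true ∷ J , s , cong suc c

-- Any j-subset of f through an element outside V will do, and j ≥ 1 leaves room for that element.
-- It serves as the j-set by which a k-set leaves the vertices of an explored component.
escape : ∀ (f V : Subset n) j → f ⊑ V ≡ false → 1 ≤ j → j ≤ ∣ f ∣ → ∃ λ J → J ⊑ f ≡ true × ∣ J ∣ ≡ j × J ⊑ V ≡ false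
escape [] [] j () _ _
escape (false ∷ f) (b ∷ V) j h 1≤j j≤ with escape f V j h 1≤j j≤
... | J , s , c , e = false ∷ J , s , c , e
escape (true ∷ f) (false ∷ V) (suc j) h 1≤j (s≤s j≤) with pick f j j≤
... | J , s , c = true ∷ J , s , cong suc c , refl
escape (true ∷ f) (true ∷ V) j h 1≤j j≤ with j ≤? ∣ f ∣
... | no  j≰ = true ∷ f , ⊑-refl f , ≤-antisym (≰⇒> j≰) j≤ , h
... | yes j≤f with escape f V j h 1≤j j≤f
... | J , s , c , e = false ∷ J , s , c , e

-- The size of the set difference. Between sets of equal size it is the distance in the Johnson
-- graph, the number of single exchanges from one to the other.
dif : Subset n → Subset n → ℕ
dif []          []          = 0
dif (true  ∷ p) (true  ∷ q) = dif p q
dif (true  ∷ p) (false ∷ q) = suc (dif p q)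
dif (false ∷ p) (_     ∷ q) = dif p q

dif-balance : (p q : Subset n) → dif p q + ∣ q ∣ ≡ dif q p + ∣ p ∣
dif-balance [] [] = refl
dif-balance (true  ∷ p) (true  ∷ q) = trans (+-suc _ _) (trans (cong suc (dif-balance p q)) (sym (+-suc _ _)))
dif-balance (true  ∷ p) (false ∷ q) = trans (cong suc (dif-balance p q)) (sym (+-suc _ _))
dif-balance (false ∷ p) (true  ∷ q) = trans (+-suc _ _) (cong suc (dif-balance p q))
dif-balance (false ∷ p) (false ∷ q) = dif-balance p q

dif-zero : (p q : Subset n) → dif p q ≡ 0 → ∣ p ∣ ≡ ∣ q ∣ → p ≡ q
dif-zero p q h c = go p q h (trans (trans (sym (m+n∸n≡m (dif q p) ∣ p ∣)) (cong (_∸ ∣ p ∣) (sym (dif-balance p q))))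
    (trans (cong₂ (λ a b → a + b ∸ ∣ p ∣) h (sym c)) (n∸n≡0 ∣ p ∣)))
  where
  go : ∀ {n} (p q : Subset n) → dif p q ≡ 0 → dif q p ≡ 0 → p ≡ q
  go [] [] _ _ = refl
  go (true  ∷ p) (true  ∷ q) h h′ = cong (true ∷_) (go p q h h′)
  go (false ∷ p) (false ∷ q) h h′ = cong (false ∷_) (go p q h h′)

dif≤card : (p q : Subset n) → dif p q ≤ ∣ p ∣
dif≤card [] [] = z≤n
dif≤card (true  ∷ p) (true  ∷ q) = ≤-trans (dif≤card p q) (n≤1+n _)
dif≤card (true  ∷ p) (false ∷ q) = s≤s (dif≤card p q)
dif≤card (false ∷ p) (_     ∷ q) = dif≤card p q

remove : ∀ (p q : Subset n) d → dif p q ≡ suc d →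
  ∃ λ p′ → suc ∣ p′ ∣ ≡ ∣ p ∣ × p′ ⊑ p ≡ true × dif p′ q ≡ d
remove [] [] d ()
remove (true ∷ p) (true ∷ q) d h with remove p q d h
... | p′ , c , s , e = true ∷ p′ , cong suc c , s , e
remove (true ∷ p) (false ∷ q) d h = false ∷ p , refl , ⊑-refl p , suc-injective h
remove (false ∷ p) (_ ∷ q) d h with remove p q d h
... | p′ , c , s , e = false ∷ p′ , c , s , e

card-∪-⊑ : (p p′ : Subset n) → p′ ⊑ p ≡ true → ∣ p ∪ p′ ∣ ≡ ∣ p ∣
card-∪-⊑ [] [] _ = refl
card-∪-⊑ (true  ∷ p) (true  ∷ p′) s = cong suc (card-∪-⊑ p p′ s)
card-∪-⊑ (true  ∷ p) (false ∷ p′) s = cong suc (card-∪-⊑ p p′ s)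
card-∪-⊑ (false ∷ p) (false ∷ p′) s = card-∪-⊑ p p′ s

-- The new element is taken from q outside p and not merely outside p′. Thus p ∪ r gains exactly one
-- element over p, and the difference to q stays as it was.
insert : ∀ (p′ p q : Subset n) d → p′ ⊑ p ≡ true → dif q p ≡ suc d →
  ∃ λ r → ∣ r ∣ ≡ suc ∣ p′ ∣ × ∣ p ∪ r ∣ ≡ suc ∣ p ∣ × dif r q ≡ dif p′ q
insert [] [] [] d _ ()
insert (true ∷ p′) (true ∷ p) (true ∷ q) d s h with insert p′ p q d s h
... | r , c , u , e = true ∷ r , cong suc c , cong suc u , e
insert (true ∷ p′) (true ∷ p) (false ∷ q) d s h with insert p′ p q d s h
... | r , c , u , e = true ∷ r , cong suc c , cong suc u , cong suc e
insert (false ∷ p′) (true ∷ p) (true ∷ q) d s h with insert p′ p q d s h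
... | r , c , u , e = false ∷ r , c , cong suc u , e
insert (false ∷ p′) (true ∷ p) (false ∷ q) d s h with insert p′ p q d s h
... | r , c , u , e = false ∷ r , c , cong suc u , e
insert (false ∷ p′) (false ∷ p) (true ∷ q) d s h =
  true ∷ p′ , refl , cong suc (card-∪-⊑ p p′ s) , refl
insert (false ∷ p′) (false ∷ p) (false ∷ q) d s h with insert p′ p q d s h
... | r , c , u , e = false ∷ r , c , u , e

-- One step in the Johnson graph. When p is a j-set, the union has size j + 1, so exactly `D₁`
-- k-sets carry the step from p to r.
exchange : ∀ (p q : Subset n) d → ∣ p ∣ ≡ ∣ q ∣ → dif p q ≡ suc d →
  ∃ λ r → ∣ r ∣ ≡ ∣ p ∣ × ∣ p ∪ r ∣ ≡ suc ∣ p ∣ × dif r q ≡ d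
exchange p q d c h with remove p q d h
... | p′ , c′ , s , e with insert p′ p q d s (trans (sym sym-dif) h)
  where
  sym-dif : dif p q ≡ dif q p
  sym-dif = +-cancelʳ-≡ ∣ p ∣ (dif p q) (dif q p) (trans (cong (dif p q +_) c) (dif-balance p q))
... | r , c″ , u , e′ = r , trans c″ c′ , u , trans e′ e

-- Boolean search in lists, and powers

anyᵇ : (A → Bool) → List A → Bool
anyᵇ p []       = false
anyᵇ p (x ∷ xs) = p x ∨ anyᵇ p xs

anyᵇ-true : ∀ (p : A → Bool) xs → anyᵇ p xs ≡ true → ∃ λ x → x ∈ xs × p x ≡ true
anyᵇ-true p (x ∷ xs) h with p x in eq
... | true  = x , here refl , eq
... | false with anyᵇ-true p xs h
... | y , y∈ , py = y , there y∈ , py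

anyᵇ-intro : ∀ (p : A → Bool) {xs x} → x ∈ xs → p x ≡ true → anyᵇ p xs ≡ true
anyᵇ-intro p (here refl) h rewrite h = refl
anyᵇ-intro p {y ∷ xs} (there x∈) h with p y
... | true  = refl
... | false = anyᵇ-intro p x∈ h

anyᵇ-false : ∀ (p : A → Bool) xs → anyᵇ p xs ≡ false → ∀ x → x ∈ xs → p x ≡ false
anyᵇ-false p xs h x x∈ with p x in eq
... | false = refl
... | true  = trans (sym (anyᵇ-intro p x∈ eq)) h

anyᵇ-≤-count : ∀ (p : A → Bool) xs → 𝟙 (anyᵇ p xs) ≤ count p xs
anyᵇ-≤-count p [] = z≤n
anyᵇ-≤-count p (x ∷ xs) with p x
... | true  = s≤s z≤n
... | false = anyᵇ-≤-count p xs

∧-true : ∀ {a b} → a ∧ b ≡ true → a ≡ true × b ≡ true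
∧-true {true} h = refl , h

∧-intro : ∀ {a b} → a ≡ true → b ≡ true → a ∧ b ≡ true
∧-intro refl refl = refl

not-true : ∀ {a} → not a ≡ true → a ≡ false
not-true {false} _ = refl

^-pos : ∀ m e → 1 ≤ m → 1 ≤ m ^ e
^-pos m e 1≤m = m^n>0 m {{>-nonZero 1≤m}} e

*-cancel-pos-≤ : ∀ {a b} c → 1 ≤ c → c * a ≤ c * b → a ≤ b
*-cancel-pos-≤ c 1≤c h = *-cancelˡ-≤ c {{>-nonZero 1≤c}} h

^-distribʳ-* : ∀ e a b → (a * b) ^ e ≡ a ^ e * b ^ e
^-distribʳ-* zero    a b = refl
^-distribʳ-* (suc e) a b = trans (cong (a * b *_) (^-distribʳ-* e a b)) (lem a b (a ^ e) (b ^ e))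
  where
  lem : ∀ a b c d → a * b * (c * d) ≡ a * c * (b * d)
  lem = solve-∀

-- j-sets and k-sets of [n], where k = j + i + 1

module Sets (n j i : ℕ) (j<n : j < n) where

  k N D D₁ κ : ℕ
  k  = suc (j + i)
  N  = bin n j
  D  = bin (n ∸ j) (suc i)
  D₁ = bin (n ∸ suc j) i
  κ  = bin k j

  𝓙 𝓚 : List (Subset n)
  𝓙 = ksets n j
  𝓚 = ksets n k

  n∸j≡ : n ∸ j ≡ suc (n ∸ suc j)
  n∸j≡ = trans (sym (suc-pred (n ∸ j) {{>-nonZero (m<n⇒0<n∸m j<n)}})) (cong suc (pred[m∸n]≡m∸[1+n] n j))

  -- It makes D₁ / D of order 1/n, which is used from both sides: as a lower bound on the weight of
  -- a step of the walk, and as an upper bound on the overlap of two j-sets and on the k-sets lost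
  -- with a vertex.
  D-absorb : suc i * D ≡ (n ∸ j) * D₁
  D-absorb rewrite n∸j≡ = bin-absorb (n ∸ suc j) i

  D₁≤D : D₁ ≤ D
  D₁≤D rewrite n∸j≡ = m≤m+n _ _

  D≤nD₁ : D ≤ n * D₁
  D≤nD₁ = ≤-trans (m≤n*m D (suc i)) (≤-trans (≤-reflexive D-absorb) (*-monoˡ-≤ D₁ (m∸n≤m n j)))

  k≡ : k ≡ j + suc i
  k≡ = sym (+-suc j i)

  degree : ∀ J → ∣ J ∣ ≡ j → count (J ⊑_) 𝓚 ≡ D
  degree J c = trans (∑-ksets n k _) (trans (count-⊇ J k) (trans (cong (cb (co J) ∣ J ∣) k≡)
    (trans (cong₂ (λ a b → cb a b (j + suc i)) (trans (co≡ J) (cong (n ∸_) c)) c) (cb-bin (n ∸ j) j (suc i)))))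

  codegree : ∀ U → ∣ U ∣ ≡ suc j → count (U ⊑_) 𝓚 ≡ D₁
  codegree U c = trans (∑-ksets n k _) (trans (count-⊇ U k)
    (trans (cong₂ (λ a b → cb a b k) (trans (co≡ U) (cong (n ∸_) c)) c) (cb-bin (n ∸ suc j) (suc j) i)))

  subcount : ∀ e → ∣ e ∣ ≡ k → count (_⊑ e) 𝓙 ≡ κ
  subcount e c = trans (∑-ksets n j _) (trans (count-⊆ e j) (cong (λ z → bin z j) c))

  κ≥1 : 1 ≤ κ
  κ≥1 = bin-≥1 k j (≤-trans (m≤m+n j i) (n≤1+n _))

  N≥1 : 1 ≤ N
  N≥1 = bin-≥1 n j (<⇒≤ j<n)

  length-𝓙 : length 𝓙 ≡ N
  length-𝓙 = length-ksets n j

  crossing : (Subset n → Bool) → Subset n → Bool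
  crossing α f = anyᵇ (λ J → J ⊑ f ∧ α J) 𝓙 ∧ anyᵇ (λ J → J ⊑ f ∧ not (α J)) 𝓙

  -- The number of steps J → f → J′ of the walk which goes up to a k-set and back down.
  K : Subset n → Subset n → ℕ
  K J J′ = ∑ 𝓚 (λ f → 𝟙 (J ⊑ f) * 𝟙 (J′ ⊑ f))

  K-sym : ∀ J J′ → K J J′ ≡ K J′ J
  K-sym J J′ = ∑-ext 𝓚 (λ f → *-comm (𝟙 (J ⊑ f)) (𝟙 (J′ ⊑ f)))

  K-∪ : ∀ J J′ → K J J′ ≡ count ((J ∪ J′) ⊑_) 𝓚
  K-∪ J J′ = ∑-ext 𝓚 (λ f → trans (sym (𝟙-∧ (J ⊑ f) (J′ ⊑ f))) (cong 𝟙 (sym (∪-⊑ J J′ f))))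

  K-diag : ∀ J → ∣ J ∣ ≡ j → K J J ≡ D
  K-diag J c = trans (∑-ext 𝓚 (λ f → idem (J ⊑ f))) (degree J c)
    where
    idem : ∀ b → 𝟙 b * 𝟙 b ≡ 𝟙 b
    idem true  = refl
    idem false = refl

  -- The common row sum of the symmetric kernel `K`; dividing by it would give a random walk that
  -- preserves the uniform distribution on j-sets.
  R : ℕ
  R = D * κ

  K-row : ∀ J → ∣ J ∣ ≡ j → ∑ 𝓙 (K J) ≡ R
  K-row J c = trans (∑-swap 𝓙 𝓚 (λ J′ f → 𝟙 (J ⊑ f) * 𝟙 (J′ ⊑ f)))
    (trans (∑-cong 𝓚 (λ f f∈ → trans (∑-*ˡ 𝓙 (𝟙 (J ⊑ f)) (λ J′ → 𝟙 (J′ ⊑ f))) (cong (𝟙 (J ⊑ f) *_) (subcount f (∈-ksets⁻ k f∈)))))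
    (trans (∑-*ʳ 𝓚 κ (λ f → 𝟙 (J ⊑ f))) (cong (_* κ) (degree J c))))

  Kⁿ : ℕ → Subset n → Subset n → ℕ
  Kⁿ zero    J J′ = 𝟙 (J == J′)
  Kⁿ (suc ℓ) J J′ = ∑ 𝓙 (λ J″ → K J J″ * Kⁿ ℓ J″ J′)

  Kⁿ-row : ∀ ℓ J → ∣ J ∣ ≡ j → ∑ 𝓙 (Kⁿ ℓ J) ≤ R ^ ℓ
  Kⁿ-row zero J c = ≤-trans (∑-ksets-≤ n j (λ J′ → 𝟙 (J == J′))) (≤-reflexive (count-== J))
  Kⁿ-row (suc ℓ) J c = begin
    ∑ 𝓙 (λ J′ → ∑ 𝓙 (λ J″ → K J J″ * Kⁿ ℓ J″ J′)) ≡⟨ ∑-swap 𝓙 𝓙 (λ J′ J″ → K J J″ * Kⁿ ℓ J″ J′) ⟩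
    ∑ 𝓙 (λ J″ → ∑ 𝓙 (λ J′ → K J J″ * Kⁿ ℓ J″ J′)) ≡⟨ ∑-ext 𝓙 (λ J″ → ∑-*ˡ 𝓙 (K J J″) (Kⁿ ℓ J″)) ⟩
    ∑ 𝓙 (λ J″ → K J J″ * ∑ 𝓙 (Kⁿ ℓ J″))           ≤⟨ ∑-mono 𝓙 (λ J″ J∈ → *-monoʳ-≤ (K J J″) (Kⁿ-row ℓ J″ (∈-ksets⁻ j J∈))) ⟩
    ∑ 𝓙 (λ J″ → K J J″ * R ^ ℓ)                    ≡⟨ ∑-*ʳ 𝓙 (R ^ ℓ) (K J) ⟩
    ∑ 𝓙 (K J) * R ^ ℓ                              ≡⟨ cong (_* R ^ ℓ) (K-row J c) ⟩
    R * R ^ ℓ ∎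
    where open ≤-Reasoning

  -- One exchange per step reaches any j-set within j steps.
  Kⁿ-lower : ∀ ℓ J J′ → ∣ J ∣ ≡ j → ∣ J′ ∣ ≡ j → dif J J′ ≤ ℓ → D₁ ^ ℓ ≤ Kⁿ ℓ J J′
  Kⁿ-lower zero J J′ c c′ d with dif-zero J J′ (n≤0⇒n≡0 d) (trans c (sym c′))
  ... | refl = ≤-reflexive (cong 𝟙 (sym (==-refl J)))
  Kⁿ-lower (suc ℓ) J J′ c c′ d with dif J J′ in eq
  -- The target is reached early: wait there, since the loop at J has weight D ≥ D₁.
  ... | zero = ≤-trans (*-mono-≤ (≤-trans D₁≤D (≤-reflexive (sym (K-diag J c)))) (Kⁿ-lower ℓ J J′ c c′ (≤-trans (≤-reflexive eq) z≤n)))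
                       (∑-∈ (λ J″ → K J J″ * Kⁿ ℓ J″ J′) (∈-ksets⁺ j c))
  ... | suc e with exchange J J′ e (trans c (sym c′)) eq
  ... | r , rc , u , e′ = ≤-trans
    (*-mono-≤ (≤-reflexive (sym (trans (K-∪ J r) (codegree (J ∪ r) (trans u (cong suc c))))))
              (Kⁿ-lower ℓ r J′ (trans rc c) c′ (≤-trans (≤-reflexive e′) (≤-pred d))))
    (∑-∈ (λ J″ → K J J″ * Kⁿ ℓ J″ J′) (∈-ksets⁺ j (trans rc c)))

  -- The factor `2 ^ j * j !` comes from n^j ≤ 2^j j! N, the 2 from N ≤ 2ā, `j * κ ^ j` from j steps
  -- with row sum R = D κ, and `κ * κ` from the pairs of j-sets inside one crossing k-set.
  c₁ : ℕ
  c₁ = 2 ^ j * j ! * 2 * (j * κ ^ j * (κ * κ))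

  module Isoperimetry (α : Subset n → Bool) where

    a ā β : ℕ
    a = count α 𝓙
    ā = count (λ J → not (α J)) 𝓙
    β = count (crossing α) 𝓚

    a+ā : a + ā ≡ N
    a+ā = trans (count-not α 𝓙) length-𝓙

    W₁ : ℕ
    W₁ = ∑ 𝓙 (λ J → ∑ 𝓙 (λ J′ → 𝟙 (α J) * 𝟙 (not (α J′)) * K J J′))

    -- The unnormalised flow from α to its complement in ℓ steps of the walk; `W₁` is the flow in
    -- one step.
    W : ℕ → ℕ
    W ℓ = ∑ 𝓙 (λ J → ∑ 𝓙 (λ J′ → 𝟙 (α J) * 𝟙 (not (α J′)) * Kⁿ ℓ J J′))

    W-zero : W 0 ≡ 0
    W-zero = ∑-zero 𝓙 (λ J → ∑-zero 𝓙 (λ J′ → go J J′))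
      where
      go : ∀ J J′ → 𝟙 (α J) * 𝟙 (not (α J′)) * 𝟙 (J == J′) ≡ 0
      go J J′ with J == J′ in eq
      ... | false = *-zeroʳ (𝟙 (α J) * 𝟙 (not (α J′)))
      ... | true rewrite ==⇒≡ J J′ eq with α J′
      ... | true = refl
      ... | false = refl

    -- Look at the place J″ after the first step. If it lies outside α, the first step has crossed;
    -- if inside, the other ℓ steps have to cross. Row sums bound the free part of each case, and
    -- for the second case the symmetry of `K` turns column sums into row sums.
    W-suc : ∀ ℓ → W (suc ℓ) ≤ W₁ * R ^ ℓ + R * W ℓ
    W-suc ℓ = begin
      ∑ 𝓙 (λ J → ∑ 𝓙 (λ J′ → w J J′ * ∑ 𝓙 (λ J″ → K J J″ * Kⁿ ℓ J″ J′)))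
        ≤⟨ ∑-mono 𝓙 (λ J _ → ∑-mono 𝓙 (λ J′ _ → ≤-trans (≤-reflexive (sym (∑-*ˡ 𝓙 (w J J′) (λ J″ → K J J″ * Kⁿ ℓ J″ J′))))
             (∑-mono 𝓙 (λ J″ _ → split J J′ J″)))) ⟩
      ∑ 𝓙 (λ J → ∑ 𝓙 (λ J′ → ∑ 𝓙 (λ J″ → P J J″ * Kⁿ ℓ J″ J′ + Q J″ J′ * K J″ J)))
        ≡⟨ trans (∑-ext 𝓙 (λ J → trans (∑-ext 𝓙 (λ J′ → ∑-+ 𝓙 (λ J″ → P J J″ * Kⁿ ℓ J″ J′) (λ J″ → Q J″ J′ * K J″ J)))
               (∑-+ 𝓙 (λ J′ → ∑ 𝓙 (λ J″ → P J J″ * Kⁿ ℓ J″ J′)) (λ J′ → ∑ 𝓙 (λ J″ → Q J″ J′ * K J″ J)))))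
             (∑-+ 𝓙 (λ J → ∑ 𝓙 (λ J′ → ∑ 𝓙 (λ J″ → P J J″ * Kⁿ ℓ J″ J′))) (λ J → ∑ 𝓙 (λ J′ → ∑ 𝓙 (λ J″ → Q J″ J′ * K J″ J)))) ⟩
      ∑ 𝓙 (λ J → ∑ 𝓙 (λ J′ → ∑ 𝓙 (λ J″ → P J J″ * Kⁿ ℓ J″ J′))) + ∑ 𝓙 (λ J → ∑ 𝓙 (λ J′ → ∑ 𝓙 (λ J″ → Q J″ J′ * K J″ J)))
        ≤⟨ +-mono-≤ first second ⟩
      W₁ * R ^ ℓ + R * W ℓ ∎
      where
      open ≤-Reasoning
      w : Subset n → Subset n → ℕ
      w J J′ = 𝟙 (α J) * 𝟙 (not (α J′))
      P Q : Subset n → Subset n → ℕ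
      P J J″ = w J J″ * K J J″
      Q J″ J′ = w J″ J′ * Kⁿ ℓ J″ J′
      bool : ∀ a b c → 𝟙 a * 𝟙 (not b) ≤ 𝟙 a * 𝟙 (not c) + 𝟙 c * 𝟙 (not b)
      bool false b     c     = z≤n
      bool true  true  c     = z≤n
      bool true  false true  = s≤s z≤n
      bool true  false false = s≤s z≤n
      split : ∀ J J′ J″ → w J J′ * (K J J″ * Kⁿ ℓ J″ J′) ≤ P J J″ * Kⁿ ℓ J″ J′ + Q J″ J′ * K J″ J
      split J J′ J″ rewrite K-sym J″ J = ≤-trans (*-monoˡ-≤ (K J J″ * Kⁿ ℓ J″ J′) (bool (α J) (α J′) (α J″)))
        (≤-reflexive (lem (w J J″) (w J″ J′) (K J J″) (Kⁿ ℓ J″ J′)))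
        where
        lem : ∀ a b c d → (a + b) * (c * d) ≡ a * c * d + b * d * c
        lem = solve-∀
      first : ∑ 𝓙 (λ J → ∑ 𝓙 (λ J′ → ∑ 𝓙 (λ J″ → P J J″ * Kⁿ ℓ J″ J′))) ≤ W₁ * R ^ ℓ
      first = ≤-trans (∑-mono 𝓙 (λ J _ → ≤-trans (≤-reflexive (∑-swap 𝓙 𝓙 (λ J′ J″ → P J J″ * Kⁿ ℓ J″ J′)))
        (≤-trans (∑-mono 𝓙 (λ J″ J∈ → ≤-trans (≤-reflexive (∑-*ˡ 𝓙 (P J J″) (Kⁿ ℓ J″)))
          (*-monoʳ-≤ (P J J″) (Kⁿ-row ℓ J″ (∈-ksets⁻ j J∈))))) (≤-reflexive (∑-*ʳ 𝓙 (R ^ ℓ) (P J))))))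
        (≤-reflexive (∑-*ʳ 𝓙 (R ^ ℓ) (λ J → ∑ 𝓙 (P J))))
      second : ∑ 𝓙 (λ J → ∑ 𝓙 (λ J′ → ∑ 𝓙 (λ J″ → Q J″ J′ * K J″ J))) ≤ R * W ℓ
      second = begin
        ∑ 𝓙 (λ J → ∑ 𝓙 (λ J′ → ∑ 𝓙 (λ J″ → Q J″ J′ * K J″ J)))
          ≡⟨ ∑-ext 𝓙 (λ J → ∑-swap 𝓙 𝓙 (λ J′ J″ → Q J″ J′ * K J″ J)) ⟩
        ∑ 𝓙 (λ J → ∑ 𝓙 (λ J″ → ∑ 𝓙 (λ J′ → Q J″ J′ * K J″ J)))
          ≡⟨ ∑-ext 𝓙 (λ J → ∑-ext 𝓙 (λ J″ → ∑-*ʳ 𝓙 (K J″ J) (Q J″))) ⟩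
        ∑ 𝓙 (λ J → ∑ 𝓙 (λ J″ → ∑ 𝓙 (Q J″) * K J″ J))
          ≡⟨ ∑-swap 𝓙 𝓙 (λ J J″ → ∑ 𝓙 (Q J″) * K J″ J) ⟩
        ∑ 𝓙 (λ J″ → ∑ 𝓙 (λ J → ∑ 𝓙 (Q J″) * K J″ J))
          ≡⟨ ∑-cong 𝓙 (λ J″ J∈ → trans (∑-*ˡ 𝓙 (∑ 𝓙 (Q J″)) (K J″)) (trans (cong (∑ 𝓙 (Q J″) *_) (K-row J″ (∈-ksets⁻ j J∈))) (*-comm (∑ 𝓙 (Q J″)) R))) ⟩
        ∑ 𝓙 (λ J″ → R * ∑ 𝓙 (Q J″))
          ≡⟨ ∑-*ˡ 𝓙 R (λ J″ → ∑ 𝓙 (Q J″)) ⟩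
        R * W ℓ ∎

    -- Iterating `W-suc`, each of the ℓ steps contributes one copy of `W₁`; the factor R on the left
    -- spares the exponent ℓ - 1.
    W-bound : ∀ ℓ → W ℓ * R ≤ ℓ * R ^ ℓ * W₁
    W-bound zero    = ≤-reflexive (cong (_* R) W-zero)
    W-bound (suc ℓ) = begin
      W (suc ℓ) * R                        ≤⟨ *-monoˡ-≤ R (W-suc ℓ) ⟩
      (W₁ * R ^ ℓ + R * W ℓ) * R           ≡⟨ lem W₁ (R ^ ℓ) R (W ℓ) ⟩
      W₁ * (R * R ^ ℓ) + R * (W ℓ * R)     ≤⟨ +-monoʳ-≤ (W₁ * (R * R ^ ℓ)) (*-monoʳ-≤ R (W-bound ℓ)) ⟩
      W₁ * (R * R ^ ℓ) + R * (ℓ * R ^ ℓ * W₁) ≡⟨ lem′ W₁ R (R ^ ℓ) ℓ ⟩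
      suc ℓ * (R * R ^ ℓ) * W₁ ∎
      where
      open ≤-Reasoning
      lem : ∀ w p r v → (w * p + r * v) * r ≡ w * (r * p) + r * (v * r)
      lem = solve-∀
      lem′ : ∀ w r p l → w * (r * p) + r * (l * p * w) ≡ suc l * (r * p) * w
      lem′ = solve-∀

    -- Sort the crossing steps by the k-set f they pass through. Only a crossing f has any, and it
    -- has at most κ choices for each end.
    W₁-bound : W₁ ≤ β * (κ * κ)
    W₁-bound = begin
      ∑ 𝓙 (λ J → ∑ 𝓙 (λ J′ → 𝟙 (α J) * 𝟙 (not (α J′)) * K J J′))
        ≡⟨ ∑-ext 𝓙 (λ J → trans (∑-ext 𝓙 (λ J′ → sym (∑-*ˡ 𝓚 (𝟙 (α J) * 𝟙 (not (α J′))) (λ f → 𝟙 (J ⊑ f) * 𝟙 (J′ ⊑ f)))))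
             (∑-swap 𝓙 𝓚 (λ J′ f → 𝟙 (α J) * 𝟙 (not (α J′)) * (𝟙 (J ⊑ f) * 𝟙 (J′ ⊑ f))))) ⟩
      ∑ 𝓙 (λ J → ∑ 𝓚 (λ f → ∑ 𝓙 (λ J′ → 𝟙 (α J) * 𝟙 (not (α J′)) * (𝟙 (J ⊑ f) * 𝟙 (J′ ⊑ f)))))
        ≡⟨ ∑-swap 𝓙 𝓚 (λ J f → ∑ 𝓙 (λ J′ → 𝟙 (α J) * 𝟙 (not (α J′)) * (𝟙 (J ⊑ f) * 𝟙 (J′ ⊑ f)))) ⟩
      ∑ 𝓚 (λ f → ∑ 𝓙 (λ J → ∑ 𝓙 (λ J′ → 𝟙 (α J) * 𝟙 (not (α J′)) * (𝟙 (J ⊑ f) * 𝟙 (J′ ⊑ f)))))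
        ≡⟨ ∑-ext 𝓚 (λ f → trans (∑-ext 𝓙 (λ J → trans (∑-ext 𝓙 (λ J′ → factor f J J′)) (∑-*ˡ 𝓙 (𝟙 (J ⊑ f ∧ α J)) (λ J′ → 𝟙 (J′ ⊑ f ∧ not (α J′))))))
              (∑-*ʳ 𝓙 (y f) (λ J → 𝟙 (J ⊑ f ∧ α J)))) ⟩
      ∑ 𝓚 (λ f → x f * y f)
        ≤⟨ ∑-mono 𝓚 per ⟩
      ∑ 𝓚 (λ f → 𝟙 (crossing α f) * (κ * κ))
        ≡⟨ ∑-*ʳ 𝓚 (κ * κ) (λ f → 𝟙 (crossing α f)) ⟩
      β * (κ * κ) ∎
      where
      open ≤-Reasoning
      x y : Subset n → ℕ
      x f = count (λ J → J ⊑ f ∧ α J) 𝓙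
      y f = count (λ J → J ⊑ f ∧ not (α J)) 𝓙
      factor : ∀ f J J′ → 𝟙 (α J) * 𝟙 (not (α J′)) * (𝟙 (J ⊑ f) * 𝟙 (J′ ⊑ f)) ≡ 𝟙 (J ⊑ f ∧ α J) * 𝟙 (J′ ⊑ f ∧ not (α J′))
      factor f J J′ = trans (lem (𝟙 (α J)) (𝟙 (not (α J′))) (𝟙 (J ⊑ f)) (𝟙 (J′ ⊑ f)))
        (cong₂ _*_ (sym (𝟙-∧ (J ⊑ f) (α J))) (sym (𝟙-∧ (J′ ⊑ f) (not (α J′)))))
        where
        lem : ∀ a b c d → a * b * (c * d) ≡ (c * a) * (d * b)
        lem = solve-∀
      cnt≤ : ∀ (p : Subset n → Bool) f → f ∈ 𝓚 → count (λ J → J ⊑ f ∧ p J) 𝓙 ≤ κ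
      cnt≤ p f f∈ = ≤-trans (∑-mono 𝓙 (λ J _ → 𝟙-∧-≤ (J ⊑ f) (p J))) (≤-reflexive (subcount f (∈-ksets⁻ k f∈)))
      none : ∀ (p : Subset n → Bool) → anyᵇ p 𝓙 ≡ false → count p 𝓙 ≡ 0
      none p h = trans (∑-cong 𝓙 (λ J J∈ → cong 𝟙 (anyᵇ-false p 𝓙 h J J∈))) (∑-zero 𝓙 (λ _ → refl))
      per : ∀ f → f ∈ 𝓚 → x f * y f ≤ 𝟙 (crossing α f) * (κ * κ)
      per f f∈ with anyᵇ (λ J → J ⊑ f ∧ α J) 𝓙 in e₁ | anyᵇ (λ J → J ⊑ f ∧ not (α J)) 𝓙 in e₂
      ... | false | _     = ≤-reflexive (cong (_* y f) (none _ e₁))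
      ... | true  | false = ≤-reflexive (trans (cong (x f *_) (none _ e₂)) (*-zeroʳ (x f)))
      ... | true  | true  = ≤-trans (*-mono-≤ (cnt≤ α f f∈) (cnt≤ (λ J → not (α J)) f f∈)) (≤-reflexive (sym (+-identityʳ (κ * κ))))

    W-lower : a * ā * D₁ ^ j ≤ W j
    W-lower = begin
      a * ā * D₁ ^ j
        ≡⟨ cong (_* D₁ ^ j) (trans (sym (∑-*ʳ 𝓙 ā (λ J → 𝟙 (α J)))) (∑-ext 𝓙 (λ J → sym (∑-*ˡ 𝓙 (𝟙 (α J)) (λ J′ → 𝟙 (not (α J′))))))) ⟩
      ∑ 𝓙 (λ J → ∑ 𝓙 (λ J′ → 𝟙 (α J) * 𝟙 (not (α J′)))) * D₁ ^ j
        ≡⟨ trans (sym (∑-*ʳ 𝓙 (D₁ ^ j) (λ J → ∑ 𝓙 (λ J′ → 𝟙 (α J) * 𝟙 (not (α J′))))))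
             (∑-ext 𝓙 (λ J → sym (∑-*ʳ 𝓙 (D₁ ^ j) (λ J′ → 𝟙 (α J) * 𝟙 (not (α J′)))))) ⟩
      ∑ 𝓙 (λ J → ∑ 𝓙 (λ J′ → 𝟙 (α J) * 𝟙 (not (α J′)) * D₁ ^ j))
        ≤⟨ ∑-mono 𝓙 (λ J J∈ → ∑-mono 𝓙 (λ J′ J∈′ → *-monoʳ-≤ (𝟙 (α J) * 𝟙 (not (α J′)))
             (Kⁿ-lower j J J′ (∈-ksets⁻ j J∈) (∈-ksets⁻ j J∈′) (≤-trans (dif≤card J J′) (≤-reflexive (∈-ksets⁻ j J∈)))))) ⟩
      W j ∎
      where open ≤-Reasoning

    -- Compare the two bounds on `W j`: every pair of j-sets has weight at least D₁^j, while the
    -- flow is at most j times the one-step flow. Replacing D₁ by D / n loses n^j, which ā ≥ N/2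
    -- repays up to a constant.
    isoperimetry : 2 * j ≤ n → 1 ≤ D → 2 * a ≤ N → a * D ≤ c₁ * β
    isoperimetry 2j≤n 1≤D 2a≤N = *-cancel-pos-≤ (ā * D ^ j) (*-mono-≤ ā≥1 (^-pos D j 1≤D)) (begin
      ā * D ^ j * (a * D)                     ≤⟨ *-monoʳ-≤ (ā * D ^ j) (*-monoʳ-≤ a (m≤m*n D κ {{>-nonZero κ≥1}})) ⟩
      ā * D ^ j * (a * R)                     ≤⟨ *-monoˡ-≤ (a * R) (*-monoʳ-≤ ā Dj) ⟩
      ā * (n ^ j * D₁ ^ j) * (a * R)          ≡⟨ lem₁ ā (n ^ j) (D₁ ^ j) a R ⟩
      n ^ j * (a * ā * D₁ ^ j * R)            ≤⟨ *-mono-≤ nj (*-monoˡ-≤ R W-lower) ⟩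
      2 ^ j * j ! * 2 * ā * (W j * R)         ≤⟨ *-monoʳ-≤ (2 ^ j * j ! * 2 * ā) (W-bound j) ⟩
      2 ^ j * j ! * 2 * ā * (j * R ^ j * W₁)  ≤⟨ *-monoʳ-≤ (2 ^ j * j ! * 2 * ā) (*-monoʳ-≤ (j * R ^ j) W₁-bound) ⟩
      2 ^ j * j ! * 2 * ā * (j * R ^ j * (β * (κ * κ)))
        ≡⟨ cong (λ z → 2 ^ j * j ! * 2 * ā * (j * z * (β * (κ * κ)))) (^-distribʳ-* j D κ) ⟩
      2 ^ j * j ! * 2 * ā * (j * (D ^ j * κ ^ j) * (β * (κ * κ)))
        ≡⟨ lem₂ (2 ^ j * j ! * 2) ā j (D ^ j) (κ ^ j) β (κ * κ) ⟩
      ā * D ^ j * (c₁ * β) ∎)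
      where
      open ≤-Reasoning
      lem₁ : ∀ ā p q a r → ā * (p * q) * (a * r) ≡ p * (a * ā * q * r)
      lem₁ = solve-∀
      lem₂ : ∀ c ā j d e β κ → c * ā * (j * (d * e) * (β * κ)) ≡ ā * d * (c * (j * e * κ) * β)
      lem₂ = solve-∀
      N≤2ā : N ≤ 2 * ā
      N≤2ā = +-cancelˡ-≤ N N (2 * ā) (begin
        N + N         ≡⟨ trans (cong₂ _+_ (sym a+ā) (sym a+ā)) (lem a ā) ⟩
        2 * a + 2 * ā ≤⟨ +-monoˡ-≤ (2 * ā) 2a≤N ⟩
        N + 2 * ā ∎)
        where
        lem : ∀ a b → (a + b) + (a + b) ≡ 2 * a + 2 * b
        lem = solve-∀
      ā≥1 : 1 ≤ ā
      ā≥1 with ā | N≤2ā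
      ... | zero  | h = contradiction (≤-trans N≥1 h) λ ()
      ... | suc _ | _ = s≤s z≤n
      Dj : D ^ j ≤ n ^ j * D₁ ^ j
      Dj = ≤-trans (^-monoˡ-≤ j D≤nD₁) (≤-reflexive (^-distribʳ-* j n D₁))
      y = n ∸ j
      n≡ : j + y ≡ n
      n≡ = m+[n∸m]≡n (<⇒≤ j<n)
      j≤y : j ≤ y
      j≤y = +-cancelˡ-≤ j j y (≤-trans (≤-reflexive (cong (j +_) (sym (+-identityʳ j)))) (≤-trans 2j≤n (≤-reflexive (sym n≡))))
      n≤2y : n ≤ 2 * y
      n≤2y = ≤-trans (≤-reflexive (sym n≡)) (≤-trans (+-monoˡ-≤ y j≤y) (≤-reflexive (cong (y +_) (sym (+-identityʳ y)))))
      nj : n ^ j ≤ 2 ^ j * j ! * 2 * ā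
      nj = begin
        n ^ j                          ≤⟨ ^-monoˡ-≤ j n≤2y ⟩
        (2 * y) ^ j                    ≡⟨ ^-distribʳ-* j 2 y ⟩
        2 ^ j * y ^ j                  ≤⟨ *-monoʳ-≤ (2 ^ j) (^≤!*bin y j) ⟩
        2 ^ j * (j ! * bin (j + y) j)  ≡⟨ cong (λ z → 2 ^ j * (j ! * bin z j)) n≡ ⟩
        2 ^ j * (j ! * N)              ≤⟨ *-monoʳ-≤ (2 ^ j) (*-monoʳ-≤ (j !) N≤2ā) ⟩
        2 ^ j * (j ! * (2 * ā))        ≡⟨ lem (2 ^ j) (j !) ā ⟩
        2 ^ j * j ! * 2 * ā ∎
        where
        lem : ∀ a b c → a * (b * (2 * c)) ≡ a * b * 2 * c
        lem = solve-∀

-- Pascal's rule telescopes, and each of the d increments is at most `bin y i`. It bounds the k-sets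
-- through a j-set that are lost when d vertices are forbidden.
bin-shift : ∀ d x y i → d + x ≤ suc y → bin (d + x) (suc i) ≤ bin x (suc i) + d * bin y i
bin-shift zero    x y i _ = m≤m+n _ _
bin-shift (suc d) x y i (s≤s h) = begin
  bin (d + x) i + bin (d + x) (suc i)           ≤⟨ +-mono-≤ (bin-monoˡ i h) (bin-shift d x y i (≤-trans h (n≤1+n y))) ⟩
  bin y i + (bin x (suc i) + d * bin y i)       ≡⟨ lem (bin y i) (bin x (suc i)) (d * bin y i) ⟩
  bin x (suc i) + suc d * bin y i ∎
  where
  open ≤-Reasoning
  lem : ∀ a b c → a + (b + c) ≡ b + (a + c)
  lem = solve-∀

∨-introʳ : ∀ a {b} → b ≡ true → a ∨ b ≡ true
∨-introʳ true  _ = refl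
∨-introʳ false h = h

∨-elim : ∀ a {b} → a ∨ b ≡ true → a ≡ true ⊎ b ≡ true
∨-elim true  _ = inj₁ refl
∨-elim false h = inj₂ h

∈-filterᵇ⁻ : ∀ (p : A → Bool) xs {x} → x ∈ filterᵇ p xs → x ∈ xs × p x ≡ true
∈-filterᵇ⁻ p (y ∷ xs) x∈ with p y in eq
∈-filterᵇ⁻ p (y ∷ xs) (here refl) | true = here refl , eq
∈-filterᵇ⁻ p (y ∷ xs) (there x∈)  | true with ∈-filterᵇ⁻ p xs x∈
... | x∈′ , px = there x∈′ , px
∈-filterᵇ⁻ p (y ∷ xs) x∈ | false with ∈-filterᵇ⁻ p xs x∈
... | x∈′ , px = there x∈′ , px

∈-filterᵇ⁺ : ∀ (p : A → Bool) xs {x} → x ∈ xs → p x ≡ true → x ∈ filterᵇ p xs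
∈-filterᵇ⁺ p (y ∷ xs) x∈ px with p y in eq
∈-filterᵇ⁺ p (y ∷ xs) (here refl) px | true  = here refl
∈-filterᵇ⁺ p (y ∷ xs) (there x∈)  px | true  = there (∈-filterᵇ⁺ p xs x∈ px)
∈-filterᵇ⁺ p (y ∷ xs) (here refl) px | false = contradiction (trans (sym px) eq) λ ()
∈-filterᵇ⁺ p (y ∷ xs) (there x∈)  px | false = ∈-filterᵇ⁺ p xs x∈ px

-- Exploring the component of a j-set

module Exploration (n j i : ℕ) (j<n : j < n) where
  open Sets n j i j<n

  -- A component is stored by its edges alone; the j-sets of the component are those inside some
  -- edge of C.
  inA : List (Subset n) → Subset n → Bool
  inA C J = anyᵇ (J ⊑_) C

  memᵇ : List (Subset n) → Subset n → Bool
  memᵇ C x = anyᵇ (_== x) C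

  isNew : List (Subset n) → Subset n → Subset n → Bool
  isNew C e J = J ⊑ e ∧ not (inA C J)

  hasNew : List (Subset n) → Subset n → Bool
  hasNew C e = anyᵇ (isNew C e) 𝓙

  new : List (Subset n) → Subset n → List (Subset n)
  new C e = filterᵇ (isNew C e) 𝓙

  -- All edge sets C which an exploration can discover: process the pending j-sets Q in order, and for
  -- the first one either declare it saturated or use an edge through it which contains a new j-set.
  leaves : ℕ → List (Subset n) → List (Subset n) → List (List (Subset n))
  leaves zero    Q       C = []
  leaves (suc F) []      C = C ∷ []
  leaves (suc F) (J ∷ Q) C = leaves F Q C ++
    concatMap (λ e → leaves F (new C e ++ J ∷ Q) (e ∷ C)) (filterᵇ (λ e → J ⊑ e ∧ hasNew C e) 𝓚)

  -- Every edge covers a j-set that the earlier ones do not. So the edges are distinct, and they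
  -- cover at least as many j-sets as there are edges, which is how s enters the isoperimetric
  -- inequality.
  data Explored : List (Subset n) → Set where
    []  : Explored []
    _∷_ : ∀ {e C} → ∣ e ∣ ≡ k × hasNew C e ≡ true → Explored C → Explored (e ∷ C)

  length-new : ∀ C e → ∣ e ∣ ≡ k → length (new C e) ≤ κ
  length-new C e c = ≤-trans (≤-reflexive (length-filterᵇ (isNew C e) 𝓙))
    (≤-trans (∑-mono 𝓙 (λ J _ → 𝟙-∧-≤ (J ⊑ e) (not (inA C J)))) (≤-reflexive (subcount e c)))

  G : ℕ
  G = 2 ^ suc κ * D

  module _ (1≤D : 1 ≤ D) (Λ Ω : ℕ) (wt : List (Subset n) → ℕ)
           (bound : ∀ C → Explored C → Λ * G ^ length C * wt C ≤ Ω) where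

    -- Each pending j-set contributes a factor 2 = 1 + 1: at most 1 for declaring it saturated, and at most
    -- D · 2^(κ+1) / G = 1 for the at most D edges through it, each of which adds at most κ pending j-sets.
    ∑-leaves : ∀ F Q C → (∀ J → J ∈ Q → ∣ J ∣ ≡ j) → Explored C →
      Λ * G ^ length C * ∑ (leaves F Q C) wt ≤ 2 ^ length Q * Ω
    ∑-leaves zero    Q       C Qj ex = ≤-trans (≤-reflexive (*-zeroʳ (Λ * G ^ length C))) z≤n
    ∑-leaves (suc F) []      C Qj ex = ≤-trans (≤-reflexive (cong (Λ * G ^ length C *_) (+-identityʳ (wt C))))
      (≤-trans (bound C ex) (≤-reflexive (sym (+-identityʳ Ω))))
    ∑-leaves (suc F) (J ∷ Q) C Qj ex = begin
      P * ∑ (leaves F Q C ++ concatMap next es) wt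
        ≡⟨ cong (P *_) (trans (∑-++ (leaves F Q C) (concatMap next es) wt) (cong (∑ (leaves F Q C) wt +_) (∑-concatMap next es wt))) ⟩
      P * (∑ (leaves F Q C) wt + S)
        ≡⟨ *-distribˡ-+ P (∑ (leaves F Q C) wt) S ⟩
      P * ∑ (leaves F Q C) wt + P * S
        ≤⟨ +-mono-≤ (∑-leaves F Q C (λ J′ J∈ → Qj J′ (there J∈)) ex) (*-cancel-pos-≤ G G≥1 GPS) ⟩
      2 ^ length Q * Ω + 2 ^ length Q * Ω
        ≡⟨ lem (2 ^ length Q) Ω ⟩
      2 * 2 ^ length Q * Ω ∎
      where
      open ≤-Reasoning
      P = Λ * G ^ length C
      next : Subset n → List (List (Subset n))
      next e = leaves F (new C e ++ J ∷ Q) (e ∷ C)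
      es = filterᵇ (λ e → J ⊑ e ∧ hasNew C e) 𝓚
      S = ∑ es (λ e → ∑ (next e) wt)
      lem : ∀ a b → a * b + a * b ≡ 2 * a * b
      lem = solve-∀
      G≥1 : 1 ≤ G
      G≥1 = *-mono-≤ (m^n>0 2 (suc κ)) 1≤D
      lem₁ : ∀ G L p S → G * (L * p * S) ≡ L * (G * p) * S
      lem₁ = solve-∀
      les : length es ≤ D
      les = ≤-trans (≤-reflexive (length-filterᵇ (λ e → J ⊑ e ∧ hasNew C e) 𝓚))
        (≤-trans (∑-mono 𝓚 (λ e _ → 𝟙-∧-≤ (J ⊑ e) (hasNew C e))) (≤-reflexive (degree J (Qj J (here refl)))))
      per : ∀ e → e ∈ es → Λ * G ^ suc (length C) * ∑ (next e) wt ≤ 2 ^ suc κ * (2 ^ length Q * Ω)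
      per e e∈ with ∈-filterᵇ⁻ (λ e → J ⊑ e ∧ hasNew C e) 𝓚 e∈
      ... | e∈𝓚 , h = ≤-trans (∑-leaves F (new C e ++ J ∷ Q) (e ∷ C) Qj′ ((∈-ksets⁻ k e∈𝓚 , proj₂ (∧-true {J ⊑ e} h)) ∷ ex)) (begin
        2 ^ length (new C e ++ J ∷ Q) * Ω   ≤⟨ *-monoˡ-≤ Ω (^-monoʳ-≤ 2 len) ⟩
        2 ^ (suc κ + length Q) * Ω          ≡⟨ cong (_* Ω) (^-distribˡ-+-* 2 (suc κ) (length Q)) ⟩
        2 ^ suc κ * 2 ^ length Q * Ω        ≡⟨ *-assoc (2 ^ suc κ) (2 ^ length Q) Ω ⟩
        2 ^ suc κ * (2 ^ length Q * Ω) ∎)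
        where
        -- J stays pending when an edge through it is used, hence `suc κ` instead of κ over
        -- `length Q`.
        len : length (new C e ++ J ∷ Q) ≤ suc κ + length Q
        len = ≤-trans (≤-reflexive (trans (length-++ (new C e)) (+-suc (length (new C e)) (length Q))))
          (s≤s (+-monoˡ-≤ (length Q) (length-new C e (∈-ksets⁻ k e∈𝓚))))
        Qj′ : ∀ J′ → J′ ∈ new C e ++ J ∷ Q → ∣ J′ ∣ ≡ j
        Qj′ J′ J∈ with ∈-++⁻ (new C e) J∈
        ... | inj₁ J∈new = ∈-ksets⁻ j (proj₁ (∈-filterᵇ⁻ (isNew C e) 𝓙 J∈new))
        ... | inj₂ J∈Q   = Qj J′ J∈Q
      GPS : G * (P * S) ≤ G * (2 ^ length Q * Ω)
      GPS = begin
        G * (Λ * G ^ length C * S)                                     ≡⟨ lem₁ G Λ (G ^ length C) S ⟩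
        Λ * G ^ suc (length C) * S                                     ≡⟨ sym (∑-*ˡ es (Λ * G ^ suc (length C)) (λ e → ∑ (next e) wt)) ⟩
        ∑ es (λ e → Λ * G ^ suc (length C) * ∑ (next e) wt)            ≤⟨ ∑-bound es (2 ^ suc κ * (2 ^ length Q * Ω)) per ⟩
        length es * (2 ^ suc κ * (2 ^ length Q * Ω))                   ≤⟨ *-monoˡ-≤ (2 ^ suc κ * (2 ^ length Q * Ω)) les ⟩
        D * (2 ^ suc κ * (2 ^ length Q * Ω))                           ≡⟨ lem₂ D (2 ^ suc κ) (2 ^ length Q * Ω) ⟩
        G * (2 ^ length Q * Ω) ∎
        where
        lem₂ : ∀ a b c → a * (b * c) ≡ b * a * c
        lem₂ = solve-∀

  inA-weaken : ∀ e C J → inA C J ≡ true → inA (e ∷ C) J ≡ true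
  inA-weaken e C J h = ∨-introʳ (J ⊑ e) h

  explored-size : ∀ {C} → Explored C → length C ≤ count (inA C) 𝓙
  explored-size [] = z≤n
  explored-size {e ∷ C} ((c , h) ∷ ex) with anyᵇ-true (isNew C e) 𝓙 h
  ... | J , J∈ , nw with ∧-true {J ⊑ e} nw
  ... | J⊑e , nin = ≤-trans (s≤s (explored-size ex)) (∑-strict J∈ mono strict)
    where
    mono : ∀ J → 𝟙 (inA C J) ≤ 𝟙 (inA (e ∷ C) J)
    mono J with J ⊑ e
    ... | true  = 𝟙≤1 (inA C J)
    ... | false = ≤-refl
    strict : 𝟙 (inA C J) < 𝟙 (inA (e ∷ C) J)
    strict rewrite not-true {inA C J} nin | J⊑e = s≤s z≤n

  explored-∉ : ∀ {e C} → hasNew C e ≡ true → memᵇ C e ≡ false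
  explored-∉ {e} {C} h with memᵇ C e in eq
  ... | false = refl
  ... | true with anyᵇ-true (_== e) C eq | anyᵇ-true (isNew C e) 𝓙 h
  ... | e′ , e′∈ , e′≡e | J , _ , nw with ==⇒≡ e′ e e′≡e | ∧-true {J ⊑ e} nw
  ... | refl | J⊑e , nin = trans (sym (anyᵇ-intro (J ⊑_) e′∈ J⊑e)) (not-true {inA C J} nin)

  count-mem-≥ : ∀ H {C} → Explored C → (∀ e → e ∈ C → e ∈ H) → length C ≤ count (memᵇ C) H
  count-mem-≥ H [] sub = z≤n
  count-mem-≥ H {e ∷ C} ((c , h) ∷ ex) sub = begin
    suc (length C)                                 ≤⟨ +-mono-≤ (≤-trans (≤-reflexive (sym (cong 𝟙 (==-refl e)))) (∑-∈ (λ x → 𝟙 (e == x)) (sub e (here refl))))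
                                                                (count-mem-≥ H ex (λ e′ e∈ → sub e′ (there e∈))) ⟩
    count (e ==_) H + count (memᵇ C) H             ≡⟨ sym (∑-+ H (λ x → 𝟙 (e == x)) (λ x → 𝟙 (memᵇ C x))) ⟩
    ∑ H (λ x → 𝟙 (e == x) + 𝟙 (memᵇ C x))          ≤⟨ ∑-mono H (λ x _ → disj x) ⟩
    count (memᵇ (e ∷ C)) H ∎
    where
    open ≤-Reasoning
    disj : ∀ x → 𝟙 (e == x) + 𝟙 (memᵇ C x) ≤ 𝟙 (e == x ∨ memᵇ C x)
    disj x with e == x in eq
    ... | false = ≤-refl
    ... | true rewrite sym (==⇒≡ e x eq) | explored-∉ {e} {C} h = ≤-refl

  count-mem-≤ : ∀ C → count (memᵇ C) 𝓚 ≤ length C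
  count-mem-≤ []      = ≤-reflexive (∑-zero 𝓚 (λ _ → refl))
  count-mem-≤ (e ∷ C) = begin
    count (memᵇ (e ∷ C)) 𝓚                         ≤⟨ ∑-mono 𝓚 (λ x _ → 𝟙-∨-≤ (e == x) (memᵇ C x)) ⟩
    ∑ 𝓚 (λ x → 𝟙 (e == x) + 𝟙 (memᵇ C x))          ≡⟨ ∑-+ 𝓚 (λ x → 𝟙 (e == x)) (λ x → 𝟙 (memᵇ C x)) ⟩
    count (e ==_) 𝓚 + count (memᵇ C) 𝓚             ≤⟨ +-mono-≤ (≤-trans (∑-ksets-≤ n k (λ x → 𝟙 (e == x))) (≤-reflexive (count-== e))) (count-mem-≤ C) ⟩
    suc (length C) ∎
    where
    open ≤-Reasoning

  verts : List (Subset n) → Subset n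
  verts []      = Data.Fin.Subset.⊥
  verts (e ∷ C) = e ∪ verts C

  inA⇒⊑verts : ∀ C J → inA C J ≡ true → J ⊑ verts C ≡ true
  inA⇒⊑verts (e ∷ C) J h with ∨-elim (J ⊑ e) h
  ... | inj₁ J⊑e = ⊑-trans J e (e ∪ verts C) J⊑e (p⊑p∪q e (verts C))
  ... | inj₂ h′  = ⊑-trans J (verts C) (e ∪ verts C) (inA⇒⊑verts C J h′) (q⊑p∪q e (verts C))

  card-verts : ∀ {C} → Explored C → ∣ verts C ∣ ≤ length C * k
  card-verts [] = ≤-reflexive (card-⊥ n)
    where
    card-⊥ : ∀ m → ∣ Data.Fin.Subset.⊥ {m} ∣ ≡ 0
    card-⊥ zero    = refl
    card-⊥ (suc m) = card-⊥ m
  card-verts {e ∷ C} ((c , _) ∷ ex) = ≤-trans (card-∪-≤ e (verts C)) (+-mono-≤ (≤-reflexive c) (card-verts ex))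

  boundary : List (Subset n) → ℕ
  boundary C = count (crossing (inA C)) 𝓚

  -- A k-set meeting the vertices of C exactly in a j-subset of an edge of C is crossing.
  boundary-small : 1 ≤ j → ∀ {C} → Explored C → 1 ≤ length C → κ * bin (n ∸ length C * k) (suc i) ≤ boundary C
  boundary-small 1≤j {e ∷ C} ex@((c , _) ∷ _) _ = begin
    κ * bin (n ∸ length (e ∷ C) * k) (suc i)
      ≤⟨ *-monoʳ-≤ κ (bin-monoˡ (suc i) (≤-trans (∸-monoʳ-≤ n (card-verts ex)) (≤-reflexive (sym (co≡ V))))) ⟩
    κ * bin (co V) (suc i)
      ≡⟨ cong (_* bin (co V) (suc i)) (sym (subcount e c)) ⟩
    count (_⊑ e) 𝓙 * bin (co V) (suc i)
      ≡⟨ sym (∑-*ʳ 𝓙 (bin (co V) (suc i)) (λ J → 𝟙 (J ⊑ e))) ⟩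
    ∑ 𝓙 (λ J → 𝟙 (J ⊑ e) * bin (co V) (suc i))
      ≡⟨ ∑-cong 𝓙 (λ J J∈ → trace J (∈-ksets⁻ j J∈)) ⟩
    ∑ 𝓙 (λ J → ∑ 𝓚 (λ f → 𝟙 (J ⊑ e) * 𝟙 ((f ∩ V) == J)))
      ≡⟨ ∑-swap 𝓙 𝓚 (λ J f → 𝟙 (J ⊑ e) * 𝟙 ((f ∩ V) == J)) ⟩
    ∑ 𝓚 (λ f → ∑ 𝓙 (λ J → 𝟙 (J ⊑ e) * 𝟙 ((f ∩ V) == J)))
      ≤⟨ ∑-mono 𝓚 per ⟩
    boundary (e ∷ C) ∎
    where
    open ≤-Reasoning
    V = verts (e ∷ C)
    trace : ∀ J → ∣ J ∣ ≡ j → 𝟙 (J ⊑ e) * bin (co V) (suc i) ≡ ∑ 𝓚 (λ f → 𝟙 (J ⊑ e) * 𝟙 ((f ∩ V) == J))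
    trace J cJ with J ⊑ e in eq
    ... | false = sym (∑-zero 𝓚 (λ _ → refl))
    ... | true  = trans (+-identityʳ _) (sym (trans (∑-ext 𝓚 (λ f → +-identityʳ (𝟙 ((f ∩ V) == J)))) (trans (∑-ksets n k (λ f → 𝟙 ((f ∩ V) == J)))
      (trans (count-trace V J k (⊑-trans J e V eq (p⊑p∪q e (verts C))))
      (trans (cong₂ (cb (co V)) cJ k≡) (cb-bin (co V) j (suc i)))))))
    cross : ∀ f → f ∈ 𝓚 → ∀ J → J ∈ 𝓙 → J ⊑ e ≡ true → (f ∩ V) == J ≡ true → crossing (inA (e ∷ C)) f ≡ true
    cross f f∈ J J∈ J⊑e eq with ==⇒≡ (f ∩ V) J eq
    ... | refl = ∧-intro (anyᵇ-intro (λ J → J ⊑ f ∧ inA (e ∷ C) J) J∈ (∧-intro (p∩q⊑p f V) (anyᵇ-intro ((f ∩ V) ⊑_) {e ∷ C} (here refl) J⊑e))) out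
      where
      cf : ∣ f ∣ ≡ k
      cf = ∈-ksets⁻ k f∈
      f⋢V : f ⊑ V ≡ false
      f⋢V with f ⊑ V in eq′
      ... | false = refl
      ... | true = contradiction (≤-trans (≤-reflexive (trans (sym cf) (trans (cong ∣_∣ (sym (⊑⇒∩≡ f V eq′))) (∈-ksets⁻ j J∈)))) (m≤m+n j i)) (n≮n (j + i))
      out : anyᵇ (λ J → J ⊑ f ∧ not (inA (e ∷ C) J)) 𝓙 ≡ true
      out with escape f V j f⋢V 1≤j (≤-trans (≤-trans (m≤m+n j i) (n≤1+n _)) (≤-reflexive (sym cf)))
      ... | J′ , J′⊑f , cJ′ , J′⋢V = anyᵇ-intro (λ J → J ⊑ f ∧ not (inA (e ∷ C) J)) {x = J′} (∈-ksets⁺ j cJ′) (∧-intro J′⊑f notin)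
        where
        notin : not (inA (e ∷ C) J′) ≡ true
        notin with inA (e ∷ C) J′ in eq′
        ... | false = refl
        ... | true  = trans (sym J′⋢V) (inA⇒⊑verts (e ∷ C) J′ eq′)
    -- A k-set has only one trace on V, so it is counted for at most one J.
    per : ∀ f → f ∈ 𝓚 → ∑ 𝓙 (λ J → 𝟙 (J ⊑ e) * 𝟙 ((f ∩ V) == J)) ≤ 𝟙 (crossing (inA (e ∷ C)) f)
    per f f∈ with crossing (inA (e ∷ C)) f in eq
    ... | true = ≤-trans (∑-mono 𝓙 (λ J _ → ≤-trans (*-monoˡ-≤ (𝟙 ((f ∩ V) == J)) (𝟙≤1 (J ⊑ e))) (≤-reflexive (+-identityʳ _))))
                 (≤-trans (∑-ksets-≤ n j (λ J → 𝟙 ((f ∩ V) == J))) (≤-reflexive (count-== (f ∩ V))))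
    ... | false = ≤-reflexive (trans (∑-cong 𝓙 none) (∑-zero 𝓙 (λ _ → refl)))
      where
      none : ∀ J → J ∈ 𝓙 → 𝟙 (J ⊑ e) * 𝟙 ((f ∩ V) == J) ≡ 0
      none J J∈ with J ⊑ e in e₁ | (f ∩ V) == J in e₂
      ... | false | _     = refl
      ... | true  | false = refl
      ... | true  | true  = contradiction (trans (sym (cross f f∈ J J∈ e₁ e₂)) eq) λ ()

  -- Forbidding v - j further vertices loses at most (v - j) D₁ ≤ D/9 of the D k-sets. The fraction
  -- 8/9 is chosen because κ ≥ 3 turns it into 8/3, three quarters of which is 2.
  D-stable : ∀ v → j ≤ v → v ≤ n → 9 * v * suc i ≤ n ∸ j → 8 * D ≤ 9 * bin (n ∸ v) (suc i)
  D-stable v j≤v v≤n big = +-cancelˡ-≤ D (8 * D) (9 * B₀) (begin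
    9 * D                       ≤⟨ *-monoʳ-≤ 9 D≤ ⟩
    9 * (B₀ + d * D₁)           ≡⟨ lem B₀ (d * D₁) ⟩
    9 * (d * D₁) + 9 * B₀       ≤⟨ +-monoˡ-≤ (9 * B₀) vD₁ ⟩
    D + 9 * B₀ ∎)
    where
    open ≤-Reasoning
    d = v ∸ j
    B₀ = bin (n ∸ v) (suc i)
    lem : ∀ a b → 9 * (a + b) ≡ 9 * b + 9 * a
    lem = solve-∀
    eq : d + (n ∸ v) ≡ n ∸ j
    eq = trans (sym (+-∸-comm (n ∸ v) j≤v)) (cong (_∸ j) (m+[n∸m]≡n v≤n))
    D≤ : D ≤ B₀ + d * D₁
    D≤ = ≤-trans (≤-reflexive (cong (λ z → bin z (suc i)) (sym eq))) (bin-shift d (n ∸ v) (n ∸ suc j) i (≤-reflexive (trans eq n∸j≡)))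
    vD₁ : 9 * (d * D₁) ≤ D
    vD₁ = *-cancelˡ-≤ (suc i) (begin
      suc i * (9 * (d * D₁))    ≡⟨ lem′ (suc i) d D₁ ⟩
      9 * d * suc i * D₁        ≤⟨ *-monoˡ-≤ D₁ (≤-trans (*-monoˡ-≤ (suc i) (*-monoʳ-≤ 9 (m∸n≤m v j))) big) ⟩
      (n ∸ j) * D₁              ≡⟨ sym D-absorb ⟩
      suc i * D ∎)
      where
      lem′ : ∀ a b c → a * (9 * (b * c)) ≡ 9 * b * a * c
      lem′ = solve-∀

-- Ratios of falling factorials

ff-snoc : ∀ M y → ff y (suc M) ≡ ff y M * (y ∸ M)
ff-snoc zero    y = trans (*-identityʳ y) (sym (+-identityʳ y))
ff-snoc (suc M) y = trans (cong (y *_) (ff-snoc M (y ∸ 1)))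
  (trans (sym (*-assoc y (ff (y ∸ 1) M) (y ∸ 1 ∸ M))) (cong (y * ff (y ∸ 1) M *_) (∸-+-assoc y 1 M)))

-- The ratio of consecutive values is 1 - M/(y+1), hence at most 1 - M/T.
ff-step-≤ : ∀ T M y → y < T → T * ff y M ≤ (T ∸ M) * ff (suc y) M
ff-step-≤ T M y y<T = *-cancelˡ-≤ (suc y) (begin
  suc y * (T * ff y M)                ≡⟨ lem (suc y) T (ff y M) ⟩
  T * (suc y * ff y M)                ≡⟨ cong (T *_) (ff-snoc M (suc y)) ⟩
  T * (ff (suc y) M * (suc y ∸ M))    ≡⟨ lem₁ T (ff (suc y) M) (suc y ∸ M) ⟩
  ff (suc y) M * (T * (suc y ∸ M))    ≤⟨ *-monoʳ-≤ (ff (suc y) M) cross ⟩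
  ff (suc y) M * (suc y * (T ∸ M))    ≡⟨ lem₂ (ff (suc y) M) (suc y) (T ∸ M) ⟩
  suc y * ((T ∸ M) * ff (suc y) M) ∎)
  where
  open ≤-Reasoning
  lem : ∀ a b c → a * (b * c) ≡ b * (a * c)
  lem = solve-∀
  lem₁ : ∀ a b c → a * (b * c) ≡ b * (a * c)
  lem₁ = solve-∀
  lem₂ : ∀ a b c → a * (b * c) ≡ b * (c * a)
  lem₂ = solve-∀
  cross : T * (suc y ∸ M) ≤ suc y * (T ∸ M)
  cross rewrite *-distribˡ-∸ T (suc y) M | *-distribˡ-∸ (suc y) T M | *-comm T (suc y) =
    ∸-monoʳ-≤ (suc y * T) (*-monoˡ-≤ M y<T)

ff-geometric : ∀ T M d → d ≤ T → T ^ d * ff (T ∸ d) M ≤ (T ∸ M) ^ d * ff T M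
ff-geometric T M zero    _   = ≤-refl
ff-geometric T M (suc d) d<T = begin
  T * T ^ d * ff (T ∸ suc d) M            ≡⟨ lem T (T ^ d) (ff (T ∸ suc d) M) ⟩
  T ^ d * (T * ff (T ∸ suc d) M)          ≤⟨ *-monoʳ-≤ (T ^ d) (ff-step-≤ T M (T ∸ suc d) (≤-trans (≤-reflexive eq) (m∸n≤m T d))) ⟩
  T ^ d * ((T ∸ M) * ff (suc (T ∸ suc d)) M) ≡⟨ cong (λ z → T ^ d * ((T ∸ M) * ff z M)) eq ⟩
  T ^ d * ((T ∸ M) * ff (T ∸ d) M)        ≡⟨ lem′ (T ^ d) (T ∸ M) (ff (T ∸ d) M) ⟩
  (T ∸ M) * (T ^ d * ff (T ∸ d) M)        ≤⟨ *-monoʳ-≤ (T ∸ M) (ff-geometric T M d (<⇒≤ d<T)) ⟩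
  (T ∸ M) * ((T ∸ M) ^ d * ff T M)        ≡⟨ sym (*-assoc (T ∸ M) ((T ∸ M) ^ d) (ff T M)) ⟩
  (T ∸ M) * (T ∸ M) ^ d * ff T M ∎
  where
  open ≤-Reasoning
  eq : suc (T ∸ suc d) ≡ T ∸ d
  eq = trans (cong suc (sym (pred[m∸n]≡m∸[1+n] T d))) (suc-pred (T ∸ d) {{>-nonZero (m<n⇒0<n∸m d<T)}})
  lem : ∀ a b c → a * b * c ≡ b * (a * c)
  lem = solve-∀
  lem′ : ∀ a b c → a * (b * c) ≡ b * (a * c)
  lem′ = solve-∀

-- (1 + M/z) ≤ (1 + M/R)² as soon as R ≤ 2z.
ff-step-≥ : ∀ R M z → R ≤ 2 * suc z → ff (suc z + M) M * (R * R) ≤ ff (z + M) M * ((R + M) * (R + M))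
ff-step-≥ R M z R≤2z = *-cancelˡ-≤ (suc z) (begin
  suc z * (ff (suc z + M) M * (R * R))     ≡⟨ lem (suc z) (ff (suc z + M) M) (R * R) ⟩
  (ff (suc z + M) M * suc z) * (R * R)     ≡⟨ cong (λ x → (ff (suc z + M) M * x) * (R * R)) (sym (m+n∸n≡m (suc z) M)) ⟩
  (ff (suc z + M) M * (suc z + M ∸ M)) * (R * R) ≡⟨ cong (_* (R * R)) (sym (ff-snoc M (suc z + M))) ⟩
  (suc z + M) * ff (z + M) M * (R * R)     ≡⟨ lem′ (suc z + M) (ff (z + M) M) (R * R) ⟩
  ff (z + M) M * ((suc z + M) * (R * R))   ≤⟨ *-monoʳ-≤ (ff (z + M) M) poly ⟩
  ff (z + M) M * (suc z * ((R + M) * (R + M))) ≡⟨ lem″ (ff (z + M) M) (suc z) ((R + M) * (R + M)) ⟩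
  suc z * (ff (z + M) M * ((R + M) * (R + M))) ∎)
  where
  open ≤-Reasoning
  lem : ∀ a b c → a * (b * c) ≡ (b * a) * c
  lem = solve-∀
  lem′ : ∀ a b c → a * b * c ≡ b * (a * c)
  lem′ = solve-∀
  lem″ : ∀ a b c → a * (b * c) ≡ b * (a * c)
  lem″ = solve-∀
  expand : ∀ z M R → (z + M) * (R * R) ≡ z * (R * R) + M * R * R
  expand = solve-∀
  expand′ : ∀ z M R → z * ((R + M) * (R + M)) ≡ z * (R * R) + M * R * (2 * z) + z * (M * M)
  expand′ = solve-∀
  poly : (suc z + M) * (R * R) ≤ suc z * ((R + M) * (R + M))
  poly = begin
    (suc z + M) * (R * R)                                            ≡⟨ expand (suc z) M R ⟩
    suc z * (R * R) + M * R * R                                      ≤⟨ +-monoʳ-≤ (suc z * (R * R)) (*-monoʳ-≤ (M * R) R≤2z) ⟩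
    suc z * (R * R) + M * R * (2 * suc z)                            ≤⟨ m≤m+n _ (suc z * (M * M)) ⟩
    suc z * (R * R) + M * R * (2 * suc z) + suc z * (M * M)          ≡⟨ sym (expand′ (suc z) M R) ⟩
    suc z * ((R + M) * (R + M)) ∎

-- Used with R + M = T: avoiding o elements fewer gains at most a factor (T/R)^(2o).
ff-geometric-≥ : ∀ R M z o → R ≤ 2 * suc z → ff (o + z + M) M * (R * R) ^ o ≤ ff (z + M) M * ((R + M) * (R + M)) ^ o
ff-geometric-≥ R M z zero    h = ≤-refl
ff-geometric-≥ R M z (suc o) h = begin
  ff (suc (o + z) + M) M * (R * R * (R * R) ^ o)                ≡⟨ sym (*-assoc (ff (suc (o + z) + M) M) (R * R) ((R * R) ^ o)) ⟩
  ff (suc (o + z) + M) M * (R * R) * (R * R) ^ o                ≤⟨ *-monoˡ-≤ ((R * R) ^ o) (ff-step-≥ R M (o + z) (≤-trans h (*-monoʳ-≤ 2 (s≤s (m≤n+m z o))))) ⟩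
  ff (o + z + M) M * Q * (R * R) ^ o                            ≡⟨ lem (ff (o + z + M) M) Q ((R * R) ^ o) ⟩
  Q * (ff (o + z + M) M * (R * R) ^ o)                          ≤⟨ *-monoʳ-≤ Q (ff-geometric-≥ R M z o h) ⟩
  Q * (ff (z + M) M * Q ^ o)                                    ≡⟨ lem′ Q (ff (z + M) M) (Q ^ o) ⟩
  ff (z + M) M * (Q * Q ^ o) ∎
  where
  open ≤-Reasoning
  Q = (R + M) * (R + M)
  lem : ∀ a b c → a * b * c ≡ b * (a * c)
  lem = solve-∀
  lem′ : ∀ a b c → a * (b * c) ≡ b * (a * c)
  lem′ = solve-∀

factor-pos : ∀ {a} w b → 1 ≤ a → a ≤ w * b → 1 ≤ b
factor-pos w zero    1≤a h = contradiction (≤-trans 1≤a (≤-trans h (≤-reflexive (*-zeroʳ w)))) λ ()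
factor-pos w (suc b) 1≤a h = s≤s z≤n

-- Avoiding D elements has probability at least 1/w, which forces (T/R)^D ≤ w with R = T - M. An
-- overlap of o elements only costs (T/R)^(2o). As 2 o g ≤ D, this is at most the g-th root of w,
-- which `expo` puts below 1 + 1/u.
module Ratio (T M D o g u w : ℕ) (M≤T : M ≤ T) (1≤D : 1 ≤ D) (o≤D : o ≤ D) (8D≤T : 8 * D ≤ T)
  (F≤wF : ff T M ≤ w * ff (T ∸ D) M) (2og≤D : 2 * (o * g) ≤ D) (g≤D : g ≤ D) (1≤u : 1 ≤ u)
  (expo : w * u ^ g < suc u ^ g) where

  private
    R : ℕ
    R = T ∸ M

    T≡ : R + M ≡ T
    T≡ = m∸n+n≡m M≤T

    D≤T : D ≤ T
    D≤T = ≤-trans (m≤n*m D 8) 8D≤T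

  ff-D-pos : 1 ≤ ff (T ∸ D) M
  ff-D-pos = factor-pos w (ff (T ∸ D) M) (ff-pos T M M≤T) F≤wF

  private
    M≤T∸D : M ≤ T ∸ D
    M≤T∸D = ≮⇒≥ (λ lt → contradiction (≤-trans ff-D-pos (≤-reflexive (ff-zero (T ∸ D) M lt))) λ ())

    R≥1 : 1 ≤ R
    R≥1 = ≤-trans 1≤D (m+n≤o⇒m≤o∸n D (≤-trans (+-monoʳ-≤ D M≤T∸D) (≤-reflexive (m+[n∸m]≡n D≤T))))

    TD : T ^ D ≤ w * R ^ D
    TD = *-cancel-pos-≤ (ff T M) (ff-pos T M M≤T) (begin
      ff T M * T ^ D                     ≤⟨ *-monoˡ-≤ (T ^ D) F≤wF ⟩
      w * ff (T ∸ D) M * T ^ D           ≡⟨ lem w (ff (T ∸ D) M) (T ^ D) ⟩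
      w * (T ^ D * ff (T ∸ D) M)         ≤⟨ *-monoʳ-≤ w (ff-geometric T M D D≤T) ⟩
      w * (R ^ D * ff T M)               ≡⟨ lem′ w (R ^ D) (ff T M) ⟩
      ff T M * (w * R ^ D) ∎)
      where
      open ≤-Reasoning
      lem : ∀ a b c → a * b * c ≡ a * (c * b)
      lem = solve-∀
      lem′ : ∀ a b c → a * (b * c) ≡ c * (a * b)
      lem′ = solve-∀

    w<2^D : w < 2 ^ D
    w<2^D = *-cancelʳ-< (u ^ g) w (2 ^ D) (begin-strict
      w * u ^ g         <⟨ expo ⟩
      suc u ^ g         ≤⟨ ^-monoˡ-≤ g (+-mono-≤ 1≤u (≤-reflexive (sym (+-identityʳ u)))) ⟩
      (u + (u + 0)) ^ g ≡⟨ ^-distribʳ-* g 2 u ⟩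
      2 ^ g * u ^ g     ≤⟨ *-monoˡ-≤ (u ^ g) (^-monoʳ-≤ 2 g≤D) ⟩
      2 ^ D * u ^ g ∎)
      where open ≤-Reasoning

    -- Otherwise T ≥ 2R, and 2^D > w contradicts T^D ≤ w R^D. It ensures that R - 2D is at least
    -- R/2, as `ff-step-≥` asks.
    R≥4D : 4 * D ≤ R
    R≥4D = ≮⇒≥ (λ R<4D → <⇒≱ w<2^D (*-cancel-pos-≤ (R ^ D) (^-pos R D R≥1) (begin
      R ^ D * 2 ^ D     ≡⟨ *-comm (R ^ D) (2 ^ D) ⟩
      2 ^ D * R ^ D     ≡⟨ sym (^-distribʳ-* D 2 R) ⟩
      (2 * R) ^ D       ≤⟨ ^-monoˡ-≤ D (≤-trans (*-monoʳ-≤ 2 (<⇒≤ R<4D)) (≤-trans (≤-reflexive (lem D)) 8D≤T)) ⟩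
      T ^ D             ≤⟨ TD ⟩
      w * R ^ D         ≡⟨ *-comm w (R ^ D) ⟩
      R ^ D * w ∎)))
      where
      open ≤-Reasoning
      lem : ∀ D → 2 * (4 * D) ≡ 8 * D
      lem = solve-∀

    short : ∀ e → e ≤ D → T ^ e ≤ w * R ^ e
    short e e≤D = *-cancel-pos-≤ (T ^ (D ∸ e)) (^-pos T (D ∸ e) (≤-trans R≥1 (m∸n≤m T M))) (begin
      T ^ (D ∸ e) * T ^ e            ≡⟨ sym (^-distribˡ-+-* T (D ∸ e) e) ⟩
      T ^ (D ∸ e + e)                ≡⟨ cong (T ^_) (m∸n+n≡m e≤D) ⟩
      T ^ D                          ≤⟨ TD ⟩
      w * R ^ D                      ≡⟨ cong (λ z → w * R ^ z) (sym (m∸n+n≡m e≤D)) ⟩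
      w * R ^ (D ∸ e + e)            ≡⟨ cong (w *_) (^-distribˡ-+-* R (D ∸ e) e) ⟩
      w * (R ^ (D ∸ e) * R ^ e)      ≤⟨ *-monoʳ-≤ w (*-monoˡ-≤ (R ^ e) (^-monoˡ-≤ (D ∸ e) (m∸n≤m T M))) ⟩
      w * (T ^ (D ∸ e) * R ^ e)      ≡⟨ lem w (T ^ (D ∸ e)) (R ^ e) ⟩
      T ^ (D ∸ e) * (w * R ^ e) ∎)
      where
      open ≤-Reasoning
      lem : ∀ a b c → a * (b * c) ≡ b * (a * c)
      lem = solve-∀

    power-eq : ∀ x → ((x * x) ^ o) ^ g ≡ x ^ (2 * (o * g))
    power-eq x = trans (cong (λ z → (z ^ o) ^ g) (cong (x *_) (sym (*-identityʳ x))))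
      (trans (cong (_^ g) (^-*-assoc x 2 o)) (trans (^-*-assoc x (2 * o) g) (cong (x ^_) (*-assoc 2 o g))))

    -- Otherwise the g-th power would contradict T^D ≤ w R^D.
    root : u * (T * T) ^ o ≤ suc u * (R * R) ^ o
    root = ≮⇒≥ (λ lt → <⇒≱ smaller (begin
      suc u ^ g * R ^ e                 ≡⟨ cong (suc u ^ g *_) (sym (power-eq R)) ⟩
      suc u ^ g * ((R * R) ^ o) ^ g     ≡⟨ sym (^-distribʳ-* g (suc u) ((R * R) ^ o)) ⟩
      (suc u * (R * R) ^ o) ^ g         ≤⟨ ^-monoˡ-≤ g (<⇒≤ lt) ⟩
      (u * (T * T) ^ o) ^ g             ≡⟨ ^-distribʳ-* g u ((T * T) ^ o) ⟩
      u ^ g * ((T * T) ^ o) ^ g         ≡⟨ cong (u ^ g *_) (power-eq T) ⟩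
      u ^ g * T ^ e ∎))
      where
      open ≤-Reasoning
      e = 2 * (o * g)
      smaller : u ^ g * T ^ e < suc u ^ g * R ^ e
      smaller = begin-strict
        u ^ g * T ^ e          ≤⟨ *-monoʳ-≤ (u ^ g) (short e 2og≤D) ⟩
        u ^ g * (w * R ^ e)    ≡⟨ lem (u ^ g) w (R ^ e) ⟩
        w * u ^ g * R ^ e      <⟨ *-monoˡ-< (R ^ e) {{>-nonZero (^-pos R e R≥1)}} expo ⟩
        suc u ^ g * R ^ e ∎
        where
        lem : ∀ a b c → a * (b * c) ≡ b * a * c
        lem = solve-∀

    z : ℕ
    z = R ∸ 2 * D

    z≡ : z + 2 * D ≡ R
    z≡ = m∸n+n≡m (≤-trans (*-monoˡ-≤ D (s≤s (s≤s (z≤n {2})))) R≥4D)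

    T∸2D : T ∸ 2 * D ≡ z + M
    T∸2D = trans (cong (_∸ 2 * D) (trans (sym T≡) (trans (cong (_+ M) (sym z≡)) (lem z (2 * D) M)))) (m+n∸n≡m (z + M) (2 * D))
      where
      lem : ∀ a b c → a + b + c ≡ a + c + b
      lem = solve-∀

    T∸2D+o : T ∸ (2 * D ∸ o) ≡ o + z + M
    T∸2D+o = trans (cong (_∸ (2 * D ∸ o)) eq) (m+n∸n≡m (o + z + M) (2 * D ∸ o))
      where
      o≤2D : o ≤ 2 * D
      o≤2D = ≤-trans o≤D (m≤n*m D 2)
      lem : ∀ z a o M → z + (a + o) + M ≡ o + z + M + a
      lem = solve-∀
      eq : T ≡ o + z + M + (2 * D ∸ o)
      eq = trans (sym T≡) (trans (cong (_+ M) (trans (sym z≡) (cong (z +_) (sym (m∸n+n≡m o≤2D))))) (lem z (2 * D ∸ o) o M))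

    R≤2z : R ≤ 2 * suc z
    R≤2z = +-cancelʳ-≤ (4 * D) R (2 * suc z) (begin
      R + 4 * D               ≤⟨ +-monoʳ-≤ R R≥4D ⟩
      R + R                   ≡⟨ cong₂ _+_ (sym z≡) (sym z≡) ⟩
      z + 2 * D + (z + 2 * D) ≡⟨ lem z D ⟩
      2 * z + 4 * D           ≤⟨ +-monoˡ-≤ (4 * D) (*-monoʳ-≤ 2 (n≤1+n z)) ⟩
      2 * suc z + 4 * D ∎)
      where
      open ≤-Reasoning
      lem : ∀ z D → z + 2 * D + (z + 2 * D) ≡ 2 * z + 4 * D
      lem = solve-∀

    overlap-bound : u * ff (T ∸ (2 * D ∸ o)) M ≤ suc u * ff (T ∸ 2 * D) M
    overlap-bound = *-cancel-pos-≤ ((R * R) ^ o) (^-pos (R * R) o (*-mono-≤ R≥1 R≥1)) (begin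
      (R * R) ^ o * (u * ff (T ∸ (2 * D ∸ o)) M)    ≡⟨ cong (λ y → (R * R) ^ o * (u * ff y M)) T∸2D+o ⟩
      (R * R) ^ o * (u * ff (o + z + M) M)          ≡⟨ lem ((R * R) ^ o) u (ff (o + z + M) M) ⟩
      u * (ff (o + z + M) M * (R * R) ^ o)          ≤⟨ *-monoʳ-≤ u (ff-geometric-≥ R M z o R≤2z) ⟩
      u * (ff (z + M) M * ((R + M) * (R + M)) ^ o)  ≡⟨ cong₂ (λ x y → u * (ff x M * (y * y) ^ o)) (sym T∸2D) T≡ ⟩
      u * (ff (T ∸ 2 * D) M * (T * T) ^ o)          ≡⟨ lem′ u (ff (T ∸ 2 * D) M) ((T * T) ^ o) ⟩
      ff (T ∸ 2 * D) M * (u * (T * T) ^ o)          ≤⟨ *-monoʳ-≤ (ff (T ∸ 2 * D) M) root ⟩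
      ff (T ∸ 2 * D) M * (suc u * (R * R) ^ o)      ≡⟨ lem″ (ff (T ∸ 2 * D) M) (suc u) ((R * R) ^ o) ⟩
      (R * R) ^ o * (suc u * ff (T ∸ 2 * D) M) ∎)
      where
      open ≤-Reasoning
      lem : ∀ a b c → a * (b * c) ≡ b * (c * a)
      lem = solve-∀
      lem′ : ∀ a b c → a * (b * c) ≡ b * (a * c)
      lem′ = solve-∀
      lem″ : ∀ a b c → a * (b * c) ≡ c * (b * a)
      lem″ = solve-∀

  -- Log-concavity treats the two sets of size D as if they were disjoint, and `overlap-bound` pays
  -- for the o elements they share.
  pair-ratio : u * (ff (T ∸ (2 * D ∸ o)) M * ff T M) ≤ suc u * (ff (T ∸ D) M * ff (T ∸ D) M)
  pair-ratio = begin
    u * (ff (T ∸ (2 * D ∸ o)) M * ff T M)     ≡⟨ sym (*-assoc u (ff (T ∸ (2 * D ∸ o)) M) (ff T M)) ⟩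
    u * ff (T ∸ (2 * D ∸ o)) M * ff T M       ≤⟨ *-monoˡ-≤ (ff T M) overlap-bound ⟩
    suc u * ff (T ∸ 2 * D) M * ff T M         ≡⟨ *-assoc (suc u) (ff (T ∸ 2 * D) M) (ff T M) ⟩
    suc u * (ff (T ∸ 2 * D) M * ff T M)       ≡⟨ cong (λ y → suc u * (ff y M * ff T M)) eq ⟩
    suc u * (ff (T ∸ D ∸ D) M * ff T M)       ≤⟨ *-monoʳ-≤ (suc u) (ff-logconcave M T D D) ⟩
    suc u * (ff (T ∸ D) M * ff (T ∸ D) M) ∎
    where
    open ≤-Reasoning
    eq : T ∸ 2 * D ≡ T ∸ D ∸ D
    eq = trans (cong (T ∸_) (cong (D +_) (+-identityʳ D))) (sym (∸-+-assoc T D D))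

-- Chebyshev's inequality for the number of isolated j-sets

card-∪ : (p q : Subset n) → ∣ p ∪ q ∣ ≡ ∣ p ∣ + dif q p
card-∪ [] [] = refl
card-∪ (true  ∷ p) (true  ∷ q) = cong suc (card-∪ p q)
card-∪ (true  ∷ p) (false ∷ q) = cong suc (card-∪ p q)
card-∪ (false ∷ p) (true  ∷ q) = trans (cong suc (card-∪ p q)) (sym (+-suc ∣ p ∣ (dif q p)))
card-∪ (false ∷ p) (false ∷ q) = card-∪ p q

avoids-∧ : ∀ (b c : A → Bool) M σ → 𝟙 (avoids b M σ) * 𝟙 (avoids c M σ) ≡ 𝟙 (avoids (λ x → b x ∨ c x) M σ)
avoids-∧ b c zero    σ       = refl
avoids-∧ b c (suc M) []      = refl
avoids-∧ b c (suc M) (x ∷ σ) with b x | c x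
... | true  | _     = refl
... | false | true  = *-zeroʳ (𝟙 (avoids b M σ))
... | false | false = avoids-∧ b c M σ

am-gm : ∀ a b → 2 * (a * b) ≤ a * a + b * b
am-gm a b with ≤-total a b
... | inj₁ a≤b rewrite sym (m+[n∸m]≡n a≤b) = ≤-trans (m≤m+n _ ((b ∸ a) * (b ∸ a))) (≤-reflexive (lem a (b ∸ a)))
  where
  lem : ∀ a d → 2 * (a * (a + d)) + d * d ≡ a * a + (a + d) * (a + d)
  lem = solve-∀
... | inj₂ b≤a rewrite sym (m+[n∸m]≡n b≤a) = ≤-trans (m≤m+n _ ((a ∸ b) * (a ∸ b))) (≤-reflexive (lem b (a ∸ b)))
  where
  lem : ∀ b d → 2 * ((b + d) * b) + d * d ≡ (b + d) * (b + d) + b * b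
  lem = solve-∀

-- The inequality (p - rX)² ≥ p² on X = 0, and ≥ 0 elsewhere, rearranged to avoid subtraction. Here
-- p / r will be the mean of X.
chebyshev-point : ∀ p r X → 𝟙 (X ≡ᵇ 0) * (p * p) + 2 * (p * r * X) ≤ r * r * (X * X) + p * p
chebyshev-point p r zero = ≤-reflexive (lem p r)
  where
  lem : ∀ p r → 1 * (p * p) + 2 * (p * r * 0) ≡ r * r * (0 * 0) + p * p
  lem = solve-∀
chebyshev-point p r X@(suc _) = ≤-trans (≤-reflexive (cong (2 *_) (*-assoc p r X)))
  (≤-trans (am-gm p (r * X)) (≤-reflexive (lem′ p r X)))
  where
  lem′ : ∀ p r X → p * p + (r * X) * (r * X) ≡ r * r * (X * X) + p * p
  lem′ = solve-∀

module SecondMoment (n j i : ℕ) (j<n : j < n) (M g u w : ℕ) where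
  open Sets n j i j<n

  T Ω F₀ F F₂ : ℕ
  T  = length 𝓚
  Ω  = T !
  F₀ = ff T M
  F  = ff (T ∸ D) M
  F₂ = ff (T ∸ (2 * D ∸ D₁)) M

  isolated : Subset n → List (Subset n) → Bool
  isolated J σ = avoids (J ⊑_) M σ

  X : List (Subset n) → ℕ
  X σ = count (λ J → isolated J σ) 𝓙

  orders : List (List (Subset n))
  orders = permutations 𝓚

  -- Two different j-sets have at least j + 1 elements together, and a k-set over their union lies
  -- over any (j+1)-subset of it.
  K-≤ : ∀ J J′ → ∣ J ∣ ≡ j → ∣ J′ ∣ ≡ j → J == J′ ≡ false → K J J′ ≤ D₁
  K-≤ J J′ c c′ ne with pick (J ∪ J′) (suc j) big
    where
    big : suc j ≤ ∣ J ∪ J′ ∣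
    big with dif J′ J in eq
    ... | zero = contradiction (trans (sym (==-refl J)) (trans (cong (J ==_) (sym (dif-zero J′ J eq (trans c′ (sym c))))) ne)) λ ()
    ... | suc d = ≤-trans (≤-trans (s≤s (m≤m+n j d)) (≤-reflexive (sym (+-suc j d))))
                  (≤-reflexive (sym (trans (card-∪ J J′) (cong₂ _+_ c eq))))
  ... | U , U⊑ , cU = ≤-trans (≤-reflexive (K-∪ J J′)) (≤-trans (∑-mono 𝓚 (λ f _ → le f)) (≤-reflexive (codegree U cU)))
    where
    le : ∀ f → 𝟙 ((J ∪ J′) ⊑ f) ≤ 𝟙 (U ⊑ f)
    le f with (J ∪ J′) ⊑ f in eq
    ... | false = z≤n
    ... | true rewrite ⊑-trans U (J ∪ J′) f U⊑ eq = ≤-refl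

  first-moment : F₀ * ∑ orders X ≡ Ω * (N * F)
  first-moment = begin
    F₀ * ∑ orders X                                                ≡⟨ cong (F₀ *_) (∑-swap orders 𝓙 (λ σ J → 𝟙 (isolated J σ))) ⟩
    F₀ * ∑ 𝓙 (λ J → count (isolated J) orders)                     ≡⟨ sym (∑-*ˡ 𝓙 F₀ (λ J → count (isolated J) orders)) ⟩
    ∑ 𝓙 (λ J → F₀ * count (isolated J) orders)                     ≡⟨ ∑-cong 𝓙 (λ J J∈ → trans (*-comm F₀ (count (isolated J) orders))
                                                                        (trans (count-avoids (J ⊑_) M 𝓚) (cong (λ d → Ω * ff (T ∸ d) M) (degree J (∈-ksets⁻ j J∈))))) ⟩
    ∑ 𝓙 (λ _ → Ω * F)                                              ≡⟨ trans (∑-const 𝓙 (Ω * F)) (cong (_* (Ω * F)) length-𝓙) ⟩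
    N * (Ω * F)                                                    ≡⟨ lem N Ω F ⟩
    Ω * (N * F) ∎
    where
    open ≡-Reasoning
    lem : ∀ a b c → a * (b * c) ≡ b * (a * c)
    lem = solve-∀

  pair : ∀ J J′ → J ∈ 𝓙 → J′ ∈ 𝓙 → F₀ * ∑ orders (λ σ → 𝟙 (isolated J σ) * 𝟙 (isolated J′ σ)) ≤ Ω * (𝟙 (J == J′) * F + F₂)
  pair J J′ J∈ J∈′ with J == J′ in eq
  ... | true rewrite ==⇒≡ J J′ eq = begin
    F₀ * ∑ orders (λ σ → 𝟙 (isolated J′ σ) * 𝟙 (isolated J′ σ)) ≤⟨ *-monoʳ-≤ F₀ (∑-mono orders (λ σ _ → idem (isolated J′ σ))) ⟩
    F₀ * count (isolated J′) orders                ≡⟨ *-comm F₀ (count (isolated J′) orders) ⟩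
    count (isolated J′) orders * F₀                ≡⟨ count-avoids (J′ ⊑_) M 𝓚 ⟩
    Ω * ff (T ∸ count (J′ ⊑_) 𝓚) M                 ≡⟨ cong (λ d → Ω * ff (T ∸ d) M) (degree J′ (∈-ksets⁻ j J∈′)) ⟩
    Ω * F                                          ≤⟨ *-monoʳ-≤ Ω (≤-trans (≤-reflexive (sym (+-identityʳ F))) (m≤m+n (1 * F) F₂)) ⟩
    Ω * (1 * F + F₂) ∎
    where
    open ≤-Reasoning
    idem : ∀ b → 𝟙 b * 𝟙 b ≤ 𝟙 b
    idem true  = ≤-refl
    idem false = ≤-refl
  ... | false = begin
    F₀ * ∑ orders (λ σ → 𝟙 (isolated J σ) * 𝟙 (isolated J′ σ)) ≡⟨ cong (F₀ *_) (∑-ext orders (avoids-∧ (J ⊑_) (J′ ⊑_) M)) ⟩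
    F₀ * ∑ orders (λ σ → 𝟙 (avoids b M σ))         ≡⟨ *-comm F₀ (∑ orders (λ σ → 𝟙 (avoids b M σ))) ⟩
    ∑ orders (λ σ → 𝟙 (avoids b M σ)) * F₀         ≡⟨ count-avoids b M 𝓚 ⟩
    Ω * ff (T ∸ count b 𝓚) M                       ≤⟨ *-monoʳ-≤ Ω (ff-mono M (∸-monoʳ-≤ T big)) ⟩
    Ω * (0 * F + F₂) ∎
    where
    open ≤-Reasoning
    b : Subset n → Bool
    b x = J ⊑ x ∨ J′ ⊑ x
    incl-excl : count b 𝓚 + K J J′ ≡ 2 * D
    incl-excl = trans (sym (∑-+ 𝓚 (λ x → 𝟙 (b x)) (λ x → 𝟙 (J ⊑ x) * 𝟙 (J′ ⊑ x))))
      (trans (∑-ext 𝓚 (λ x → ie (J ⊑ x) (J′ ⊑ x))) (trans (∑-+ 𝓚 (λ x → 𝟙 (J ⊑ x)) (λ x → 𝟙 (J′ ⊑ x)))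
      (cong₂ _+_ (degree J (∈-ksets⁻ j J∈)) (trans (degree J′ (∈-ksets⁻ j J∈′)) (sym (+-identityʳ D))))))
      where
      ie : ∀ a b → 𝟙 (a ∨ b) + 𝟙 a * 𝟙 b ≡ 𝟙 a + 𝟙 b
      ie true  true  = refl
      ie true  false = refl
      ie false true  = refl
      ie false false = refl
    big : 2 * D ∸ D₁ ≤ count b 𝓚
    big = m≤n+o⇒m∸n≤o (2 * D) D₁ (≤-trans (≤-reflexive (sym incl-excl)) (≤-trans (+-monoʳ-≤ (count b 𝓚) (K-≤ J J′ (∈-ksets⁻ j J∈) (∈-ksets⁻ j J∈′) eq))
      (≤-reflexive (+-comm (count b 𝓚) D₁))))

  second-moment : F₀ * ∑ orders (λ σ → X σ * X σ) ≤ Ω * (N * F + N * N * F₂)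
  second-moment = begin
    F₀ * ∑ orders (λ σ → X σ * X σ)
      ≡⟨ cong (F₀ *_) (∑-ext orders (λ σ → trans (sym (∑-*ʳ 𝓙 (X σ) (λ J → 𝟙 (isolated J σ)))) (∑-ext 𝓙 (λ J → sym (∑-*ˡ 𝓙 (𝟙 (isolated J σ)) (λ J′ → 𝟙 (isolated J′ σ))))))) ⟩
    F₀ * ∑ orders (λ σ → ∑ 𝓙 (λ J → ∑ 𝓙 (λ J′ → 𝟙 (isolated J σ) * 𝟙 (isolated J′ σ))))
      ≡⟨ cong (F₀ *_) (trans (∑-swap orders 𝓙 (λ σ J → ∑ 𝓙 (λ J′ → 𝟙 (isolated J σ) * 𝟙 (isolated J′ σ))))
           (∑-ext 𝓙 (λ J → ∑-swap orders 𝓙 (λ σ J′ → 𝟙 (isolated J σ) * 𝟙 (isolated J′ σ))))) ⟩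
    F₀ * ∑ 𝓙 (λ J → ∑ 𝓙 (λ J′ → ∑ orders (λ σ → 𝟙 (isolated J σ) * 𝟙 (isolated J′ σ))))
      ≡⟨ trans (sym (∑-*ˡ 𝓙 F₀ (λ J → ∑ 𝓙 (λ J′ → ∑ orders (λ σ → 𝟙 (isolated J σ) * 𝟙 (isolated J′ σ))))))
           (∑-ext 𝓙 (λ J → sym (∑-*ˡ 𝓙 F₀ (λ J′ → ∑ orders (λ σ → 𝟙 (isolated J σ) * 𝟙 (isolated J′ σ)))))) ⟩
    ∑ 𝓙 (λ J → ∑ 𝓙 (λ J′ → F₀ * ∑ orders (λ σ → 𝟙 (isolated J σ) * 𝟙 (isolated J′ σ))))
      ≤⟨ ∑-mono 𝓙 (λ J J∈ → ≤-trans (∑-mono 𝓙 (λ J′ J∈′ → pair J J′ J∈ J∈′)) (row J)) ⟩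
    ∑ 𝓙 (λ J → Ω * (F + N * F₂))
      ≡⟨ trans (∑-const 𝓙 (Ω * (F + N * F₂))) (cong (_* (Ω * (F + N * F₂))) length-𝓙) ⟩
    N * (Ω * (F + N * F₂))
      ≡⟨ lem N Ω F F₂ ⟩
    Ω * (N * F + N * N * F₂) ∎
    where
    open ≤-Reasoning
    lem : ∀ N Ω F F₂ → N * (Ω * (F + N * F₂)) ≡ Ω * (N * F + N * N * F₂)
    lem = solve-∀
    row : ∀ J → ∑ 𝓙 (λ J′ → Ω * (𝟙 (J == J′) * F + F₂)) ≤ Ω * (F + N * F₂)
    row J = ≤-trans (≤-reflexive (trans (∑-*ˡ 𝓙 Ω (λ J′ → 𝟙 (J == J′) * F + F₂)) (cong (Ω *_)
        (trans (∑-+ 𝓙 (λ J′ → 𝟙 (J == J′) * F) (λ _ → F₂)) (cong₂ _+_ (∑-*ʳ 𝓙 F (λ J′ → 𝟙 (J == J′))) (trans (∑-const 𝓙 F₂) (cong (_* F₂) length-𝓙)))))))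
      (*-monoʳ-≤ Ω (+-monoˡ-≤ (N * F₂) (≤-trans (*-monoˡ-≤ F (≤-trans (∑-ksets-≤ n j (λ J′ → 𝟙 (J == J′))) (≤-reflexive (count-== J)))) (≤-reflexive (+-identityʳ F)))))

  Z : ℕ
  Z = count (λ σ → X σ ≡ᵇ 0) orders

  -- Relative to the squared mean, the diagonal pairs cost at most 1/u because the mean N F / F₀ is
  -- at least u, and the excess correlation of the other pairs costs at most 1/u by `pair-ratio`.
  few-without-isolated : M ≤ T → 1 ≤ D → 8 * D ≤ T → F₀ ≤ w * F → 2 * (D₁ * g) ≤ D → g ≤ D → 1 ≤ u →
    w * u ^ g < suc u ^ g → u * w ≤ N → u * Z ≤ 2 * Ω
  few-without-isolated M≤T 1≤D 8D≤T F₀≤wF 2og≤D g≤D 1≤u expo uw≤N =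
    *-cancel-pos-≤ (p * p) (*-mono-≤ p≥1 p≥1) (+-cancelʳ-≤ (u * (Ω * (p * p))) (p * p * (u * Z)) (p * p * (2 * Ω)) (begin
      p * p * (u * Z) + u * (Ω * (p * p))               ≡⟨ lem₁ p u Z Ω ⟩
      u * (Z * (p * p) + Ω * (p * p))                   ≤⟨ *-monoʳ-≤ u cheb ⟩
      u * (F₀ * (Ω * (p + N * N * F₂)))                 ≡⟨ lem₂ u F₀ Ω p N F₂ ⟩
      Ω * (u * F₀ * p + N * N * (u * (F₂ * F₀)))        ≤⟨ *-monoʳ-≤ Ω (+-mono-≤ (*-monoˡ-≤ p uF₀≤p) (*-monoʳ-≤ (N * N) (Ratio.pair-ratio T M D D₁ g u w M≤T 1≤D D₁≤D 8D≤T F₀≤wF 2og≤D g≤D 1≤u expo))) ⟩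
      Ω * (p * p + N * N * (suc u * (F * F)))           ≡⟨ lem₃ Ω N F u ⟩
      p * p * (2 * Ω) + u * (Ω * (p * p)) ∎))
    where
    open ≤-Reasoning
    p = N * F
    p≥1 : 1 ≤ p
    p≥1 = *-mono-≤ N≥1 (Ratio.ff-D-pos T M D D₁ g u w M≤T 1≤D D₁≤D 8D≤T F₀≤wF 2og≤D g≤D 1≤u expo)
    uF₀≤p : u * F₀ ≤ p
    uF₀≤p = ≤-trans (*-monoʳ-≤ u F₀≤wF) (≤-trans (≤-reflexive (sym (*-assoc u w F))) (*-monoˡ-≤ F uw≤N))
    lem₁ : ∀ p u Z Ω → p * p * (u * Z) + u * (Ω * (p * p)) ≡ u * (Z * (p * p) + Ω * (p * p))
    lem₁ = solve-∀
    lem₂ : ∀ u F₀ Ω p N F₂ → u * (F₀ * (Ω * (p + N * N * F₂))) ≡ Ω * (u * F₀ * p + N * N * (u * (F₂ * F₀)))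
    lem₂ = solve-∀
    lem₃ : ∀ Ω N F u → Ω * (N * F * (N * F) + N * N * (suc u * (F * F))) ≡ N * F * (N * F) * (2 * Ω) + u * (Ω * (N * F * (N * F)))
    lem₃ = solve-∀
    length-orders : length orders ≡ Ω
    length-orders = trans (sym (∑-one orders)) (length-permutations T 𝓚 refl)
    cheb : Z * (p * p) + Ω * (p * p) ≤ F₀ * (Ω * (p + N * N * F₂))
    cheb = +-cancelʳ-≤ (Ω * (p * p)) _ _ (begin
      Z * (p * p) + Ω * (p * p) + Ω * (p * p)
        ≡⟨ lem₄ (Z * (p * p)) Ω p ⟩
      Z * (p * p) + 2 * (p * (Ω * p))
        ≡⟨ cong (λ x → Z * (p * p) + 2 * (p * x)) (sym first-moment) ⟩
      Z * (p * p) + 2 * (p * (F₀ * ∑ orders X))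
        ≡⟨ cong₂ _+_ (sym (∑-*ʳ orders (p * p) (λ σ → 𝟙 (X σ ≡ᵇ 0))))
             (trans (cong (2 *_) (trans (sym (*-assoc p F₀ (∑ orders X))) (sym (∑-*ˡ orders (p * F₀) X)))) (sym (∑-*ˡ orders 2 (λ σ → p * F₀ * X σ)))) ⟩
      ∑ orders (λ σ → 𝟙 (X σ ≡ᵇ 0) * (p * p)) + ∑ orders (λ σ → 2 * (p * F₀ * X σ))
        ≡⟨ sym (∑-+ orders (λ σ → 𝟙 (X σ ≡ᵇ 0) * (p * p)) (λ σ → 2 * (p * F₀ * X σ))) ⟩
      ∑ orders (λ σ → 𝟙 (X σ ≡ᵇ 0) * (p * p) + 2 * (p * F₀ * X σ))
        ≤⟨ ∑-mono orders (λ σ _ → chebyshev-point p F₀ (X σ)) ⟩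
      ∑ orders (λ σ → F₀ * F₀ * (X σ * X σ) + p * p)
        ≡⟨ trans (∑-+ orders (λ σ → F₀ * F₀ * (X σ * X σ)) (λ _ → p * p))
             (cong₂ _+_ (∑-*ˡ orders (F₀ * F₀) (λ σ → X σ * X σ)) (trans (∑-const orders (p * p)) (cong (_* (p * p)) length-orders))) ⟩
      F₀ * F₀ * ∑ orders (λ σ → X σ * X σ) + Ω * (p * p)
        ≡⟨ cong (_+ Ω * (p * p)) (*-assoc F₀ F₀ (∑ orders (λ σ → X σ * X σ))) ⟩
      F₀ * (F₀ * ∑ orders (λ σ → X σ * X σ)) + Ω * (p * p)
        ≤⟨ +-monoˡ-≤ (Ω * (p * p)) (*-monoʳ-≤ F₀ second-moment) ⟩
      F₀ * (Ω * (p + N * N * F₂)) + Ω * (p * p) ∎)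
      where
      lem₄ : ∀ z Ω p → z + Ω * (p * p) + Ω * (p * p) ≡ z + 2 * (p * (Ω * p))
      lem₄ = solve-∀

-- Orderings as lists: membership, initial segments and first times

≤ᵇ-true : ∀ {a b} → a ≤ b → (a ≤ᵇ b) ≡ true
≤ᵇ-true {a} {b} h with a ≤ᵇ b | ≤⇒≤ᵇ h
... | true | _ = refl

insertions-∈ : ∀ (x : A) τ {ρ} → ρ ∈ insertions x τ → ∀ {e} → (e ∈ x ∷ τ → e ∈ ρ) × (e ∈ ρ → e ∈ x ∷ τ)
insertions-∈ x []      (here refl) = id , id
insertions-∈ x (y ∷ τ) (here refl) = id , id
insertions-∈ x (y ∷ τ) (there ρ∈) with ∈-map⁻ (y ∷_) ρ∈
... | ρ′ , ρ∈′ , refl = to , from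
  where
  to : ∀ {e} → e ∈ x ∷ y ∷ τ → e ∈ y ∷ ρ′
  to (here refl)         = there (proj₁ (insertions-∈ x τ ρ∈′) (here refl))
  to (there (here refl)) = here refl
  to (there (there e∈))  = there (proj₁ (insertions-∈ x τ ρ∈′) (there e∈))
  from : ∀ {e} → e ∈ y ∷ ρ′ → e ∈ x ∷ y ∷ τ
  from (here refl) = there (here refl)
  from (there e∈) with proj₂ (insertions-∈ x τ ρ∈′) e∈
  ... | here refl = here refl
  ... | there e∈τ = there (there e∈τ)

permutations-∈ : ∀ (xs : List A) {σ} → σ ∈ permutations xs → ∀ {e} → (e ∈ xs → e ∈ σ) × (e ∈ σ → e ∈ xs)
permutations-∈ []       (here refl) = id , id
permutations-∈ (x ∷ xs) σ∈ with find (∈-concatMap⁻ (insertions x) {xs = permutations xs} σ∈)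
... | τ , τ∈ , σ∈′ = to , from
  where
  to : ∀ {e} → e ∈ x ∷ xs → e ∈ _
  to (here refl) = proj₁ (insertions-∈ x τ σ∈′) (here refl)
  to (there e∈)  = proj₁ (insertions-∈ x τ σ∈′) (there (proj₁ (permutations-∈ xs τ∈) e∈))
  from : ∀ {e} → e ∈ _ → e ∈ x ∷ xs
  from e∈ with proj₂ (insertions-∈ x τ σ∈′) e∈
  ... | here refl = here refl
  ... | there e∈τ = there (proj₂ (permutations-∈ xs τ∈) e∈τ)

∈-take : ∀ M (σ : List A) {e} → e ∈ take M σ → e ∈ σ
∈-take (suc M) (x ∷ σ) (here refl) = here refl
∈-take (suc M) (x ∷ σ) (there e∈)  = there (∈-take M σ e∈)

∈-take-mono : ∀ {M M′} (σ : List A) {e} → M ≤ M′ → e ∈ take M σ → e ∈ take M′ σ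
∈-take-mono (x ∷ σ) (s≤s h) (here refl) = here refl
∈-take-mono (x ∷ σ) (s≤s h) (there e∈)  = there (∈-take-mono σ h e∈)

avoids-true : ∀ (b : A → Bool) M σ {e} → avoids b M σ ≡ true → e ∈ take M σ → b e ≡ false
avoids-true b (suc M) (x ∷ σ) h (here refl) = not-true (proj₁ (∧-true {not (b x)} h))
avoids-true b (suc M) (x ∷ σ) h (there e∈)  = avoids-true b M σ (proj₂ (∧-true {not (b x)} h)) e∈

avoids-false : ∀ (b : A → Bool) M σ → avoids b M σ ≡ false → ∃ λ e → e ∈ take M σ × b e ≡ true
avoids-false b (suc M) (x ∷ σ) h with b x in eq
... | true  = x , here refl , eq
... | false with avoids-false b M σ h
... | e , e∈ , be = e , there e∈ , be

before-done : ∀ (t b : A → Bool) σ → before t b 0 0 σ ≡ true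
before-done t b []      = refl
before-done t b (x ∷ σ) with b x
... | true  = refl
... | false rewrite 0∸n≡0 (𝟙 (t x)) = before-done t b σ

-- Any τ ≥ M serves as witness, so the conclusion no longer mentions the random hitting time.
before-intro : ∀ (t b : A → Bool) s M τ σ → τ ≤ length σ → M ≤ τ → s ≤ count t (take τ σ) →
  (∀ e → e ∈ take τ σ → b e ≡ false) → before t b s M σ ≡ true
before-intro t b zero zero zero σ _ _ _ _ = before-done t b σ
before-intro t b s M (suc τ) (x ∷ σ) (s≤s l) M≤ s≤ nb rewrite nb x (here refl) =
  before-intro t b (s ∸ 𝟙 (t x)) (M ∸ 1) τ σ l (∸-monoˡ-≤ 1 M≤) (m≤n+o⇒m∸n≤o s (𝟙 (t x)) s≤) (λ e e∈ → nb e (there e∈))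

least : ∀ (P : ℕ → Bool) L → P L ≡ true → ∃ λ M → M ≤ L × P M ≡ true × (∀ M′ → M′ < M → P M′ ≡ false)
least P L h with P 0 in eq
... | true = 0 , z≤n , eq , λ _ ()
least P zero    h | false = contradiction (trans (sym h) eq) λ ()
least P (suc L) h | false with least (P ∘ suc) L h
... | M , M≤L , PM , min = suc M , s≤s M≤L , PM , min′
  where
  min′ : ∀ M′ → M′ < suc M → P M′ ≡ false
  min′ zero     _        = eq
  min′ (suc M′) (s≤s lt) = min M′ lt

-- Pigeonhole. It will make two components meet that each contain more than half of the j-sets.
common-element : ∀ (p q : A → Bool) xs → length xs < count p xs + count q xs → ∃ λ x → x ∈ xs × p x ≡ true × q x ≡ true
common-element p q xs h with anyᵇ (λ x → p x ∧ q x) xs in eq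
... | true with anyᵇ-true (λ x → p x ∧ q x) xs eq
... | x , x∈ , pq = x , x∈ , ∧-true {p x} pq
common-element p q xs h | false = contradiction (≤-trans h (begin
  count p xs + count q xs                   ≡⟨ sym (∑-+ xs (λ x → 𝟙 (p x)) (λ x → 𝟙 (q x))) ⟩
  ∑ xs (λ x → 𝟙 (p x) + 𝟙 (q x))            ≤⟨ ∑-mono xs (λ x x∈ → le (p x) (q x) (anyᵇ-false (λ x → p x ∧ q x) xs eq x x∈)) ⟩
  ∑ xs (λ _ → 1)                            ≡⟨ ∑-one xs ⟩
  length xs ∎)) (n≮n (length xs))
  where
  open ≤-Reasoning
  le : ∀ a b → a ∧ b ≡ false → 𝟙 a + 𝟙 b ≤ 1
  le true  false _ = ≤-refl
  le false b     _ = 𝟙≤1 b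

-- Chains

module _ {H : Hypergraph n} {j : ℕ} where

  chain-head : ∀ {e e′} → Chain H j e e′ → e ∈ H
  chain-head (single e∈)   = e∈
  chain-head (step e∈ _ _) = e∈

  chain-join : ∀ {a b c d} → Chain H j a b → j ≤ ∣ b ∩ c ∣ → Chain H j c d → Chain H j a d
  chain-join (single b∈)   le c = step b∈ le c
  chain-join (step a∈ l p) le c = step a∈ l (chain-join p le c)

  chain-reverse : ∀ {a b} → Chain H j a b → Chain H j b a
  chain-reverse (single a∈) = single a∈
  chain-reverse (step {e} {e′} a∈ l p) =
    chain-join (chain-reverse p) (≤-trans l (≤-reflexive (cong ∣_∣ (∩-comm e e′)))) (single a∈)

⊑-∩-card : ∀ {j} (J e e′ : Subset n) → ∣ J ∣ ≡ j → J ⊑ e ≡ true → J ⊑ e′ ≡ true → j ≤ ∣ e ∩ e′ ∣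
⊑-∩-card J e e′ c h h′ = ≤-trans (≤-reflexive (sym c)) (p⊆q⇒∣p∣≤∣q∣ (λ x∈ → x∈p∩q⁺ (⊑⇒⊆ J e h x∈ , ⊑⇒⊆ J e′ h′ x∈)))

-- Orderings without small components

module Deterministic (n j i : ℕ) (j<n : j < n) where
  open Sets n j i j<n
  open Exploration n j i j<n

  unseen : List (Subset n) → ℕ
  unseen C = count (λ J → not (inA C J)) 𝓙

  unseen-new : ∀ C e → unseen (e ∷ C) + length (new C e) ≡ unseen C
  unseen-new C e = trans (cong (unseen (e ∷ C) +_) (length-filterᵇ (isNew C e) 𝓙))
    (trans (sym (∑-+ 𝓙 (λ J → 𝟙 (not (inA (e ∷ C) J))) (λ J → 𝟙 (isNew C e J)))) (∑-ext 𝓙 (λ J → bool (J ⊑ e) (inA C J))))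
    where
    bool : ∀ a b → 𝟙 (not (a ∨ b)) + 𝟙 (a ∧ not b) ≡ 𝟙 (not b)
    bool true  b = refl
    bool false b = +-identityʳ _

  module _ (H : Hypergraph n) (H⊆𝓚 : ∀ e → e ∈ H → e ∈ 𝓚) (J₀ : Subset n) where

    Saturated : List (Subset n) → Subset n → Set
    Saturated C J = ∀ e → e ∈ H → J ⊑ e ≡ true → ∀ J′ → J′ ∈ 𝓙 → J′ ⊑ e ≡ true → inA C J′ ≡ true

    Reached : Subset n → Set
    Reached e = ∃ λ e₀ → J₀ ⊑ e₀ ≡ true × Chain H j e₀ e

    record Component (C : List (Subset n)) : Set where
      field
        explored : Explored C
        edges    : ∀ e → e ∈ C → e ∈ H
        reached  : ∀ e → e ∈ C → Reached e

    open Component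

    record Found (F : ℕ) (Q C : List (Subset n)) : Set where
      field
        C*        : List (Subset n)
        leaf      : C* ∈ leaves F Q C
        component : Component C*
        grows     : ∀ J → inA C J ≡ true → inA C* J ≡ true
        closed    : ∀ J → J ∈ 𝓙 → inA C* J ≡ true → Saturated C* J
        pending   : ∀ J → J ∈ Q → Saturated C* J

    saturated-mono : ∀ C C′ J → (∀ J → inA C J ≡ true → inA C′ J ≡ true) → Saturated C J → Saturated C′ J
    saturated-mono C C′ J h s e e∈ J⊑e J′ J∈ J′⊑e = h J′ (s e e∈ J⊑e J′ J∈ J′⊑e)

    -- The edges of H decide which branch of `leaves` is followed. The measure
    -- `2 * unseen C + length Q` falls each time: saturating J shortens Q, and an edge moves at
    -- least one j-set from unseen, where it weighs 2, to pending, where it weighs 1. The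
    -- alternative `J ≡ J₀` allows for the start, when J₀ is pending but not yet covered.
    explore : ∀ F Q C → Component C → (∀ J → J ∈ Q → ∣ J ∣ ≡ j × (J ≡ J₀ ⊎ inA C J ≡ true)) →
      (∀ J → J ∈ 𝓙 → inA C J ≡ true → J ∈ Q ⊎ Saturated C J) → 2 * unseen C + length Q < F → Found F Q C
    explore (suc F) [] C comp Qok pend _ = record
      { C* = C ; leaf = here refl ; component = comp ; grows = λ _ h → h
      ; closed = λ J J∈ h → resolve (pend J J∈ h) ; pending = λ _ () }
      where
      resolve : ∀ {J} → J ∈ [] ⊎ Saturated C J → Saturated C J
      resolve (inj₂ s) = s
    explore (suc F) (J ∷ Q) C comp Qok pend μ with anyᵇ (λ e → J ⊑ e ∧ hasNew C e) H in eq
    ... | false = record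
      { C* = C* ; leaf = ∈-++⁺ˡ leaf ; component = component ; grows = grows ; closed = closed
      ; pending = λ { J′ (here refl) → saturated-mono C C* J grows sat ; J′ (there J∈) → pending J′ J∈ } }
      where
      sat : Saturated C J
      sat e e∈ J⊑e J′ J∈′ J′⊑e with inA C J′ in eq′
      ... | true  = refl
      ... | false = contradiction (trans (sym (∧-intro J⊑e (anyᵇ-intro (isNew C e) J∈′ (∧-intro J′⊑e (cong not eq′)))))
                      (anyᵇ-false (λ e → J ⊑ e ∧ hasNew C e) H eq e e∈)) λ ()
      pend′ : ∀ J′ → J′ ∈ 𝓙 → inA C J′ ≡ true → J′ ∈ Q ⊎ Saturated C J′
      pend′ J′ J∈ h with pend J′ J∈ h
      ... | inj₁ (here refl) = inj₂ sat
      ... | inj₁ (there J∈Q) = inj₁ J∈Q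
      ... | inj₂ s           = inj₂ s
      open Found (explore F Q C comp (λ J′ J∈ → Qok J′ (there J∈)) pend′
        (≤-trans (≤-reflexive (sym (+-suc (2 * unseen C) (length Q)))) (≤-pred μ)))
    ... | true with anyᵇ-true (λ e → J ⊑ e ∧ hasNew C e) H eq
    ... | e , e∈ , h with ∧-true {J ⊑ e} h
    ... | J⊑e , hn = record
      { C* = C*
      ; leaf = ∈-++⁺ʳ (leaves F Q C) (∈-concatMap⁺ (λ e → leaves F (new C e ++ J ∷ Q) (e ∷ C)) (lose (∈-filterᵇ⁺ (λ e → J ⊑ e ∧ hasNew C e) 𝓚 (H⊆𝓚 e e∈) h) leaf))
      ; component = component
      ; grows = λ J′ h′ → grows J′ (inA-weaken e C J′ h′)
      ; closed = closed
      ; pending = λ J′ J∈ → pending J′ (∈-++⁺ʳ (new C e) J∈) }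
      where
      reach : Reached e
      reach with Qok J (here refl)
      ... | c , inj₁ refl = e , J⊑e , single e∈
      ... | c , inj₂ inC with anyᵇ-true (J ⊑_) C inC
      ... | e′ , e∈′ , J⊑e′ with reached comp e′ e∈′
      ... | e₀ , J₀⊑ , ch = e₀ , J₀⊑ , chain-join ch (⊑-∩-card J e′ e c J⊑e′ J⊑e) (single e∈)
      comp′ : Component (e ∷ C)
      comp′ = record
        { explored = (∈-ksets⁻ k (H⊆𝓚 e e∈) , hn) ∷ explored comp
        ; edges    = λ { e′ (here refl) → e∈ ; e′ (there h′) → edges comp e′ h′ }
        ; reached  = λ { e′ (here refl) → reach ; e′ (there h′) → reached comp e′ h′ } }
      Qok′ : ∀ J′ → J′ ∈ new C e ++ J ∷ Q → ∣ J′ ∣ ≡ j × (J′ ≡ J₀ ⊎ inA (e ∷ C) J′ ≡ true)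
      Qok′ J′ J∈ with ∈-++⁻ (new C e) J∈
      ... | inj₁ J∈new with ∈-filterᵇ⁻ (isNew C e) 𝓙 J∈new
      ... | J∈𝓙 , nw = ∈-ksets⁻ j J∈𝓙 , inj₂ (anyᵇ-intro (J′ ⊑_) {e ∷ C} (here refl) (proj₁ (∧-true {J′ ⊑ e} nw)))
      Qok′ J′ J∈ | inj₂ J∈Q with Qok J′ J∈Q
      ... | c , inj₁ eq′ = c , inj₁ eq′
      ... | c , inj₂ inC = c , inj₂ (inA-weaken e C J′ inC)
      pend′ : ∀ J′ → J′ ∈ 𝓙 → inA (e ∷ C) J′ ≡ true → J′ ∈ new C e ++ J ∷ Q ⊎ Saturated (e ∷ C) J′
      pend′ J′ J∈ inC with inA C J′ in eq′
      ... | false = inj₁ (∈-++⁺ˡ (∈-filterᵇ⁺ (isNew C e) 𝓙 J∈ (∧-intro (lem inC) (cong not eq′))))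
        where
        lem : J′ ⊑ e ∨ false ≡ true → J′ ⊑ e ≡ true
        lem h with J′ ⊑ e
        ... | true = refl
      ... | true with pend J′ J∈ eq′
      ... | inj₁ J∈Q = inj₁ (∈-++⁺ʳ (new C e) J∈Q)
      ... | inj₂ s   = inj₂ (saturated-mono C (e ∷ C) J′ (λ J″ → inA-weaken e C J″) s)
      new≥1 : 1 ≤ length (new C e)
      new≥1 = ≤-trans (≤-trans (≤-reflexive (cong 𝟙 (sym hn))) (anyᵇ-≤-count (isNew C e) 𝓙)) (≤-reflexive (sym (length-filterᵇ (isNew C e) 𝓙)))
      μ′ : 2 * unseen (e ∷ C) + length (new C e ++ J ∷ Q) < F
      μ′ = ≤-trans (begin
        suc (2 * unseen (e ∷ C) + length (new C e ++ J ∷ Q))   ≡⟨ cong (λ x → suc (2 * unseen (e ∷ C) + x)) (length-++ (new C e)) ⟩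
        suc (2 * unseen (e ∷ C) + (length (new C e) + suc (length Q)))
          ≤⟨ +-monoˡ-≤ (2 * unseen (e ∷ C) + (length (new C e) + suc (length Q))) new≥1 ⟩
        length (new C e) + (2 * unseen (e ∷ C) + (length (new C e) + suc (length Q)))
          ≡⟨ lem′ (unseen (e ∷ C)) (length (new C e)) (suc (length Q)) ⟩
        2 * (unseen (e ∷ C) + length (new C e)) + suc (length Q) ≡⟨ cong (λ x → 2 * x + suc (length Q)) (unseen-new C e) ⟩
        2 * unseen C + suc (length Q) ∎) (≤-pred μ)
        where
        open ≤-Reasoning
        lem′ : ∀ a b c → b + (2 * a + (b + c)) ≡ 2 * (a + b) + c
        lem′ = solve-∀
      open Found (explore F (new C e ++ J ∷ Q) (e ∷ C) comp′ Qok′ pend′ μ′)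

  -- One more than the initial measure 2N + 1 of `explore`. If `leaves` ran dry it would merely drop
  -- explorations, so the upper bound on their sum holds for any fuel; this amount reaches every
  -- actual component.
  fuel : ℕ
  fuel = suc (2 * N + 1)

  -- A necessary condition for C to be the edge set of a small component at some time ≥ M, which is
  -- weak enough to be counted: nothing but the order of C and of its boundary enters.
  smallComponent : ℕ → List (Subset n) → List (Subset n) → Bool
  smallComponent M C σ = (1 ≤ᵇ length C) ∧ ((2 * count (inA C) 𝓙 ≤ᵇ N) ∧
    before (memᵇ C) (crossing (inA C)) (length C) M σ)

  someSmallComponent : ℕ → List (Subset n) → Bool
  someSmallComponent M σ = anyᵇ (λ J → anyᵇ (λ C → smallComponent M C σ) (leaves fuel (J ∷ []) [])) 𝓙

  module _ (M₀ : ℕ) (σ : List (Subset n)) (σ∈ : σ ∈ orderings n k) (1≤D : 1 ≤ D)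
    (hasIsolated : (count (λ J → avoids (J ⊑_) M₀ σ) 𝓙 ≡ᵇ 0) ≡ false)
    (noSmall : someSmallComponent (suc M₀) σ ≡ false) where

    covered : ℕ → Bool
    covered M = not (anyᵇ (λ J → avoids (J ⊑_) M σ) 𝓙)

    σ-∈𝓚 : ∀ M e → e ∈ take M σ → e ∈ 𝓚
    σ-∈𝓚 M e e∈ = proj₂ (permutations-∈ 𝓚 σ∈) (∈-take M σ e∈)

    covered-true : ∀ M → covered M ≡ true → ∀ J → ∣ J ∣ ≡ j → ∃ λ e → e ∈ take M σ × J ⊑ e ≡ true
    covered-true M h J c = avoids-false (J ⊑_) M σ (anyᵇ-false (λ J → avoids (J ⊑_) M σ) 𝓙 (not-true h) J (∈-ksets⁺ j c))

    covered-false : ∀ M → covered M ≡ false → ∃ λ J → ∣ J ∣ ≡ j × Isolated (take M σ) J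
    covered-false M h with anyᵇ (λ J → avoids (J ⊑_) M σ) 𝓙 in eq
    ... | true with anyᵇ-true (λ J → avoids (J ⊑_) M σ) 𝓙 eq
    ... | J , J∈ , av = J , ∈-ksets⁻ j J∈ , λ { (e , e∈ , J⊆e) →
            contradiction (trans (sym (⊆⇒⊑ J e J⊆e)) (avoids-true (J ⊑_) M σ av e∈)) λ () }

    covered-end : covered (length σ) ≡ true
    covered-end with anyᵇ (λ J → avoids (J ⊑_) (length σ) σ) 𝓙 in eq
    ... | false = refl
    ... | true with anyᵇ-true (λ J → avoids (J ⊑_) (length σ) σ) 𝓙 eq
    ... | J , J∈ , av with anyᵇ (J ⊑_) 𝓚 in eq′
    ... | true with anyᵇ-true (J ⊑_) 𝓚 eq′
    ... | e , e∈ , J⊑e = trans (sym (avoids-true (J ⊑_) (length σ) σ av (subst (e ∈_) (sym (take-all (length σ) σ ≤-refl)) (proj₁ (permutations-∈ 𝓚 σ∈) e∈)))) J⊑e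
    covered-end | true | J , J∈ , av | false = contradiction (≤-trans 1≤D (≤-reflexive
      (trans (sym (degree J (∈-ksets⁻ j J∈))) (trans (∑-cong 𝓚 (λ e e∈ → cong 𝟙 (anyᵇ-false (J ⊑_) 𝓚 eq′ e e∈))) (∑-zero 𝓚 (λ _ → refl)))))) λ ()

    private
      τ-data = least covered (length σ) covered-end
      τ : ℕ
      τ = proj₁ τ-data
      H : Hypergraph n
      H = take τ σ

      τ-covered : covered τ ≡ true
      τ-covered = proj₁ (proj₂ (proj₂ τ-data))

      -- Edges only accumulate: a j-set isolated at time M₀ was isolated at all earlier times.
      M₀<τ : M₀ < τ
      M₀<τ = ≰⇒> (λ τ≤M₀ → absurd τ≤M₀ (anyᵇ (λ J → avoids (J ⊑_) M₀ σ) 𝓙) refl)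
        where
        absurd : τ ≤ M₀ → ∀ b → anyᵇ (λ J → avoids (J ⊑_) M₀ σ) 𝓙 ≡ b → ⊥
        absurd τ≤M₀ true eq with anyᵇ-true (λ J → avoids (J ⊑_) M₀ σ) 𝓙 eq
        ... | J , J∈ , av with covered-true τ τ-covered J (∈-ksets⁻ j J∈)
        ... | e , e∈ , J⊑e = contradiction (trans (sym J⊑e) (avoids-true (J ⊑_) M₀ σ av (∈-take-mono σ τ≤M₀ e∈))) λ ()
        absurd τ≤M₀ false eq = contradiction (trans (sym hasIsolated) (cong (_≡ᵇ 0)
          (trans (∑-cong 𝓙 (λ J J∈ → cong 𝟙 (anyᵇ-false (λ J → avoids (J ⊑_) M₀ σ) 𝓙 eq J J∈))) (∑-zero 𝓙 (λ _ → refl))))) λ ()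

      component-of : ∀ J → ∣ J ∣ ≡ j → Found H (σ-∈𝓚 τ) J fuel (J ∷ []) []
      component-of J c = explore H (σ-∈𝓚 τ) J fuel (J ∷ []) []
        (record { explored = [] ; edges = λ _ () ; reached = λ _ () })
        (λ { J′ (here refl) → c , inj₁ refl }) (λ _ _ ())
        (s≤s (+-monoˡ-≤ 1 (*-monoʳ-≤ 2 (≤-reflexive (trans (∑-one 𝓙) length-𝓙)))))

      -- Otherwise the explored edges witness `someSmallComponent`. There is at least one of them
      -- because J is covered at time τ, and being closed they leave no edge of H crossing.
      large : ∀ J (c : ∣ J ∣ ≡ j) → N < 2 * count (inA (Found.C* (component-of J c))) 𝓙
      large J c = ≰⇒> (λ 2a≤N → contradiction (trans (sym (bad 2a≤N)) noSmall) λ ())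
        where
        open Found (component-of J c)
        open Component component
        1≤ : 1 ≤ length C*
        1≤ with covered-true τ τ-covered J c
        ... | e , e∈ , J⊑e with pending J (here refl) e e∈ J⊑e J (∈-ksets⁺ j c) J⊑e
        ... | inC with C*
        ... | _ ∷ _ = s≤s z≤n
        uncrossed : ∀ e → e ∈ H → crossing (inA C*) e ≡ false
        uncrossed e e∈ with crossing (inA C*) e in eq
        ... | false = refl
        ... | true with ∧-true {anyᵇ (λ J → J ⊑ e ∧ inA C* J) 𝓙} eq
        ... | h₁ , h₂ with anyᵇ-true (λ J → J ⊑ e ∧ inA C* J) 𝓙 h₁ | anyᵇ-true (λ J → J ⊑ e ∧ not (inA C* J)) 𝓙 h₂
        ... | J₁ , J∈₁ , g₁ | J₂ , J∈₂ , g₂ with ∧-true {J₁ ⊑ e} g₁ | ∧-true {J₂ ⊑ e} g₂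
        ... | s₁ , i₁ | s₂ , i₂ = trans (sym (closed J₁ J∈₁ i₁ e e∈ s₁ J₂ J∈₂ s₂)) (not-true i₂)
        bad : 2 * count (inA C*) 𝓙 ≤ N → someSmallComponent (suc M₀) σ ≡ true
        bad 2a≤N = anyᵇ-intro (λ J → anyᵇ (λ C → smallComponent (suc M₀) C σ) (leaves fuel (J ∷ []) [])) {x = J} (∈-ksets⁺ j c)
          (anyᵇ-intro (λ C → smallComponent (suc M₀) C σ) leaf (∧-intro (≤ᵇ-true 1≤) (∧-intro (≤ᵇ-true 2a≤N)
            (before-intro (memᵇ C*) (crossing (inA C*)) (length C*) (suc M₀) τ σ (proj₁ (proj₂ τ-data)) M₀<τ
              (count-mem-≥ H explored edges) uncrossed))))

      connected : JConnectedHG j H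
      connected J₁ J₂ c₁ c₂ with common-element (inA (Found.C* F₁)) (inA (Found.C* F₂)) 𝓙 many
        where
        F₁ = component-of J₁ c₁
        F₂ = component-of J₂ c₂
        a₁ = count (inA (Found.C* F₁)) 𝓙
        a₂ = count (inA (Found.C* F₂)) 𝓙
        many : length 𝓙 < a₁ + a₂
        many = *-cancelˡ-< 2 (length 𝓙) (a₁ + a₂) (≤-trans (s≤s (≤-reflexive (trans (cong (2 *_) length-𝓙) (cong (N +_) (+-identityʳ N)))))
          (≤-trans (+-mono-<-≤ (large J₁ c₁) (<⇒≤ (large J₂ c₂))) (≤-reflexive (sym (*-distribˡ-+ 2 a₁ a₂)))))
      ... | J , J∈ , i₁ , i₂ with anyᵇ-true (J ⊑_) (Found.C* (component-of J₁ c₁)) i₁ | anyᵇ-true (J ⊑_) (Found.C* (component-of J₂ c₂)) i₂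
      ... | e₁ , e∈₁ , s₁ | e₂ , e∈₂ , s₂
        with Component.reached (Found.component (component-of J₁ c₁)) e₁ e∈₁ | Component.reached (Found.component (component-of J₂ c₂)) e₂ e∈₂
      ... | f₁ , t₁ , ch₁ | f₂ , t₂ , ch₂ = f₁ , f₂ , ⊑⇒⊆ J₁ f₁ t₁ , ⊑⇒⊆ J₂ f₂ t₂ ,
        chain-join ch₁ (⊑-∩-card J e₁ e₂ (∈-ksets⁻ j J∈) s₁ s₂) (chain-reverse ch₂)

      -- Connecting J even to itself takes an edge containing J. This is the easy half, τ_C ≥ τ_I.
      connected⇒covered : ∀ {H′ : Hypergraph n} → JConnectedHG j H′ → NoIsolated j H′
      connected⇒covered con J c iso with con J J c c
      ... | e , e′ , J⊆e , _ , ch = iso (e , chain-head ch , J⊆e)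

    τC≡τI : TauCEqTauI j σ
    τC≡τI = τ , (connected , λ M′ lt con → isolated M′ lt (connected⇒covered con)) , (connected⇒covered connected , isolated)
      where
      isolated : ∀ M′ → M′ < τ → ¬ NoIsolated j (take M′ σ)
      isolated M′ lt none with covered-false M′ (proj₂ (proj₂ (proj₂ τ-data)) M′ lt)
      ... | J , c , iso = none J c iso

-- Elementary estimates

!-mono : ∀ {s t} → s ≤ t → s ! ≤ t !
!-mono {s} {t} s≤t = go (t ∸ s) (sym (m+[n∸m]≡n s≤t))
  where
  go : ∀ d {t} → t ≡ s + d → s ! ≤ t !
  go zero    refl = ≤-reflexive (cong _! (sym (+-identityʳ s)))
  go (suc d) refl = ≤-trans (go d refl) (≤-trans (m≤n*m _ (suc (s + d))) (≤-reflexive (cong _! (sym (+-suc s d)))))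

!≤^ : ∀ s → s ! ≤ s ^ s
!≤^ zero    = ≤-refl
!≤^ (suc s) = *-monoʳ-≤ (suc s) (≤-trans (!≤^ s) (^-monoˡ-≤ s (n≤1+n s)))

bernoulli : ∀ u h → u ^ h * (u + h) ≤ u * suc u ^ h
bernoulli u zero    = ≤-reflexive (trans (+-identityʳ (u + 0)) (trans (+-identityʳ u) (sym (*-identityʳ u))))
bernoulli u (suc h) = begin
  u * u ^ h * (u + suc h)                     ≤⟨ m≤m+n _ (u ^ h * h) ⟩
  u * u ^ h * (u + suc h) + u ^ h * h         ≡⟨ lem u (u ^ h) h ⟩
  suc u * (u ^ h * (u + h))                   ≤⟨ *-monoʳ-≤ (suc u) (bernoulli u h) ⟩
  suc u * (u * suc u ^ h)                     ≡⟨ lem′ (suc u) u (suc u ^ h) ⟩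
  u * (suc u * suc u ^ h) ∎
  where
  open ≤-Reasoning
  lem : ∀ u p h → u * p * (u + suc h) + p * h ≡ suc u * (p * (u + h))
  lem = solve-∀
  lem′ : ∀ a b c → a * (b * c) ≡ b * (a * c)
  lem′ = solve-∀

filterᵇ-All : ∀ (p : A → Bool) (P : A → Set) xs → (∀ x → x ∈ xs → p x ≡ true → P x) → All P (filterᵇ p xs)
filterᵇ-All p P []       h = []
filterᵇ-All p P (x ∷ xs) h with p x in eq
... | true  = h x (here refl) eq ∷ filterᵇ-All p P xs (λ y y∈ → h y (there y∈))
... | false = filterᵇ-All p P xs (λ y y∈ → h y (there y∈))

≤ᵇ-false : ∀ {a b} → ¬ a ≤ b → (a ≤ᵇ b) ≡ false
≤ᵇ-false {a} {b} h with a ≤ᵇ b in eq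
... | false = refl
... | true  = contradiction (≤ᵇ⇒≤ a b (subst Data.Bool.T (sym eq) tt)) h

∧-falseˡ : ∀ {a b} → a ≡ false → a ∧ b ≡ false
∧-falseˡ refl = refl

∧-falseʳ : ∀ a {b} → b ≡ false → a ∧ b ≡ false
∧-falseʳ true  h = h
∧-falseʳ false h = refl

-- Small components are unlikely after time M

module Unlikely (n j i : ℕ) (j<n : j < n) (1≤j : 1 ≤ j) (M u w : ℕ) where
  open Sets n j i j<n
  open Exploration n j i j<n
  open Deterministic n j i j<n

  -- Per edge, exploring costs `2 ^ suc κ` beside D, and `count-before` costs 4. `c₂` adds the c₁ of
  -- the isoperimetric inequality, while `Eₖ` is the total cost, with its factorial, of up to 8 c₁
  -- edges. `Λ` combines the N starting points with the error 1/u.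
  T Ω Λ c₂ Eₖ : ℕ
  T  = length 𝓚
  Ω  = T !
  Λ  = u * N
  c₂ = 2 ^ suc κ * (4 * c₁)
  Eₖ = (2 ^ suc κ * 4) ^ (8 * c₁) * (8 * c₁) !

  orders : List (List (Subset n))
  orders = permutations 𝓚

  weight : List (Subset n) → ℕ
  weight C = count (smallComponent M C) orders

  module _ (1≤D : 1 ≤ D) (wF<F₀ : w * ff (T ∸ D) M < ff T M) where

    private
      F₀ = ff T M
      F  = ff (T ∸ D) M

      F₀≥1 : 1 ≤ F₀
      F₀≥1 = ≤-trans (s≤s z≤n) wF<F₀

    avoid-power : ∀ t → w ^ t * ff (T ∸ t * D) M ≤ F₀
    avoid-power t = *-cancel-pos-≤ (F₀ ^ t) (^-pos F₀ t F₀≥1) (begin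
      F₀ ^ t * (w ^ t * ff (T ∸ t * D) M)     ≡⟨ lem (F₀ ^ t) (w ^ t) (ff (T ∸ t * D) M) ⟩
      w ^ t * (ff (T ∸ t * D) M * F₀ ^ t)     ≤⟨ *-monoʳ-≤ (w ^ t) (ff-power M T D t) ⟩
      w ^ t * (F ^ t * F₀)                    ≡⟨ sym (*-assoc (w ^ t) (F ^ t) F₀) ⟩
      w ^ t * F ^ t * F₀                      ≡⟨ cong (_* F₀) (sym (^-distribʳ-* t w F)) ⟩
      (w * F) ^ t * F₀                        ≤⟨ *-monoˡ-≤ F₀ (^-monoˡ-≤ t (<⇒≤ wF<F₀)) ⟩
      F₀ ^ t * F₀ ∎)
      where
      open ≤-Reasoning
      lem : ∀ a b c → a * (b * c) ≡ b * (c * a)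
      lem = solve-∀

    weight-bound : ∀ C t → 4 * (t * D) ≤ 3 * boundary C →
      weight C * (boundary C ^ length C * w ^ t) ≤ Ω * ((length C) ! * 4 ^ length C)
    weight-bound C t h = *-cancel-pos-≤ F₀ F₀≥1 (begin
      F₀ * (weight C * (β ^ s * w ^ t))         ≡⟨ lem F₀ (weight C) (β ^ s) (w ^ t) ⟩
      weight C * (β ^ s * F₀) * w ^ t           ≤⟨ *-monoˡ-≤ (w ^ t) (*-monoˡ-≤ (β ^ s * F₀) (∑-mono orders (λ σ _ → le (1 ≤ᵇ s) (2 * count (inA C) 𝓙 ≤ᵇ N) (bf σ)))) ⟩
      ∑ orders (λ σ → 𝟙 (bf σ)) * (β ^ s * F₀) * w ^ t
        -- The avoided part β′ of the boundary is taken to be t D, a multiple of the set whose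
        -- avoidance has probability below 1/w.
        ≤⟨ *-monoˡ-≤ (w ^ t) (count-before (memᵇ C) (crossing (inA C)) β (t * D) h T 𝓚 s M refl refl (count-mem-≤ C)) ⟩
      Ω * (s ! * 4 ^ s * ff (T ∸ t * D) M) * w ^ t ≡⟨ lem′ Ω (s ! * 4 ^ s) (ff (T ∸ t * D) M) (w ^ t) ⟩
      Ω * (s ! * 4 ^ s) * (w ^ t * ff (T ∸ t * D) M) ≤⟨ *-monoʳ-≤ (Ω * (s ! * 4 ^ s)) (avoid-power t) ⟩
      Ω * (s ! * 4 ^ s) * F₀                    ≡⟨ *-comm (Ω * (s ! * 4 ^ s)) F₀ ⟩
      F₀ * (Ω * (s ! * 4 ^ s)) ∎)
      where
      open ≤-Reasoning
      s = length C
      β = boundary C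
      bf : List (Subset n) → Bool
      bf σ = before (memᵇ C) (crossing (inA C)) s M σ
      le : ∀ a b c → 𝟙 (a ∧ (b ∧ c)) ≤ 𝟙 c
      le true  true  c = ≤-refl
      le true  false c = z≤n
      le false b     c = z≤n
      lem : ∀ a b c d → a * (b * (c * d)) ≡ b * (c * a) * d
      lem = solve-∀
      lem′ : ∀ a b c d → a * (b * c) * d ≡ a * b * (d * c)
      lem′ = solve-∀

    module _ (κ≥3 : 3 ≤ κ) (1≤w : 1 ≤ w) (2j≤n : 2 * j ≤ n)
             (stable : 8 * D ≤ 9 * bin (n ∸ 8 * c₁ * k) (suc i))
             (w²-large : Λ * Eₖ ≤ w * w) (w-large : c₂ ^ (8 * c₁) ≤ w) where

      private
        G^ : ∀ s → G ^ s ≡ (2 ^ suc κ) ^ s * D ^ s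
        G^ s = ^-distribʳ-* s (2 ^ suc κ) D

        c₁≥1 : 1 ≤ c₁
        c₁≥1 = *-mono-≤ (*-mono-≤ (*-mono-≤ (m^n>0 2 j) (1≤n! j)) (s≤s (z≤n {1})))
          (*-mono-≤ (*-mono-≤ 1≤j (^-pos κ j κ≥1)) (*-mono-≤ κ≥1 κ≥1))

      -- The bound D ≤ β cancels the factor D^s of G^s. What remains is at most the constant `Eₖ`,
      -- and the two factors w outweigh `Λ * Eₖ`.
      small-case : ∀ C → Explored C → 1 ≤ length C → length C ≤ 8 * c₁ → Λ * G ^ length C * weight C ≤ Ω
      small-case C ex 1≤s s≤K = *-cancel-pos-≤ (w * w) (*-mono-≤ 1≤w 1≤w) (begin
        w * w * (Λ * G ^ s * weight C)                          ≡⟨ cong (λ z → w * w * (Λ * z * weight C)) (G^ s) ⟩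
        w * w * (Λ * (q ^ s * D ^ s) * weight C)                ≡⟨ lem w Λ (q ^ s) (D ^ s) (weight C) ⟩
        Λ * q ^ s * (weight C * (D ^ s * w ^ 2))                ≤⟨ *-monoʳ-≤ (Λ * q ^ s) (*-monoʳ-≤ (weight C) (*-monoˡ-≤ (w ^ 2) (^-monoˡ-≤ s D≤β))) ⟩
        Λ * q ^ s * (weight C * (boundary C ^ s * w ^ 2))       ≤⟨ *-monoʳ-≤ (Λ * q ^ s) (weight-bound C 2 8D≤3β′) ⟩
        Λ * q ^ s * (Ω * (s ! * 4 ^ s))                         ≡⟨ lem′ Λ (q ^ s) Ω (s !) (4 ^ s) ⟩
        Λ * (q ^ s * 4 ^ s * s !) * Ω                           ≤⟨ *-monoˡ-≤ Ω (*-monoʳ-≤ Λ (*-mono-≤ pow (!-mono s≤K))) ⟩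
        Λ * Eₖ * Ω                                              ≤⟨ *-monoˡ-≤ Ω w²-large ⟩
        w * w * Ω ∎)
        where
        open ≤-Reasoning
        s = length C
        q = 2 ^ suc κ
        lem : ∀ w l q d c → w * w * (l * (q * d) * c) ≡ l * q * (c * (d * (w * (w * 1))))
        lem = solve-∀
        lem′ : ∀ l q o f p → l * q * (o * (f * p)) ≡ l * (q * p * f) * o
        lem′ = solve-∀
        pow : q ^ s * 4 ^ s ≤ (q * 4) ^ (8 * c₁)
        pow = ≤-trans (≤-reflexive (sym (^-distribʳ-* s q 4))) (^-monoʳ-≤ (q * 4) {{>-nonZero (*-mono-≤ (m^n>0 2 (suc κ)) (s≤s (z≤n {3})))}} s≤K)
        8D≤3β : 8 * D ≤ 3 * boundary C
        8D≤3β = begin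
          8 * D                                      ≤⟨ stable ⟩
          9 * bin (n ∸ 8 * c₁ * k) (suc i)           ≤⟨ *-monoʳ-≤ 9 (bin-monoˡ (suc i) (∸-monoʳ-≤ n (*-monoˡ-≤ k s≤K))) ⟩
          9 * bin (n ∸ s * k) (suc i)                ≡⟨ *-assoc 3 3 (bin (n ∸ s * k) (suc i)) ⟩
          3 * (3 * bin (n ∸ s * k) (suc i))          ≤⟨ *-monoʳ-≤ 3 (*-monoˡ-≤ (bin (n ∸ s * k) (suc i)) κ≥3) ⟩
          3 * (κ * bin (n ∸ s * k) (suc i))          ≤⟨ *-monoʳ-≤ 3 (boundary-small 1≤j ex 1≤s) ⟩
          3 * boundary C ∎
        8D≤3β′ : 4 * (2 * D) ≤ 3 * boundary C
        8D≤3β′ = ≤-trans (≤-reflexive (sym (*-assoc 4 2 D))) 8D≤3β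
        D≤β : D ≤ boundary C
        D≤β = *-cancelˡ-≤ 3 (≤-trans (*-monoˡ-≤ D (s≤s (s≤s (s≤s (z≤n {5}))))) 8D≤3β)

      -- With sD ≤ c₁β and s! ≤ s^s, both D^s and s^s cancel, and c₂^s Λ has to be beaten by w^t.
      -- Two of the factors w pay for Λ, the other t - 2 for c₂^s.
      large-case : ∀ C → Explored C → 8 * c₁ < length C → 2 * count (inA C) 𝓙 ≤ N → Λ * G ^ length C * weight C ≤ Ω
      large-case C ex K<s 2a≤N = *-cancel-pos-≤ (s ^ s * w ^ t) (*-mono-≤ (^-pos s s 1≤s) (^-pos w t 1≤w)) (begin
        s ^ s * w ^ t * (Λ * G ^ s * weight C)                     ≡⟨ cong (λ z → s ^ s * w ^ t * (Λ * z * weight C)) (G^ s) ⟩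
        s ^ s * w ^ t * (Λ * (q ^ s * D ^ s) * weight C)           ≡⟨ lem (s ^ s) (w ^ t) Λ (q ^ s) (D ^ s) (weight C) ⟩
        Λ * q ^ s * (weight C * (s ^ s * D ^ s * w ^ t))           ≡⟨ cong (λ z → Λ * q ^ s * (weight C * (z * w ^ t))) (sym (^-distribʳ-* s s D)) ⟩
        Λ * q ^ s * (weight C * ((s * D) ^ s * w ^ t))             ≤⟨ *-monoʳ-≤ (Λ * q ^ s) (*-monoʳ-≤ (weight C) (*-monoˡ-≤ (w ^ t)
                                                                        (≤-trans (^-monoˡ-≤ s sD≤cβ) (≤-reflexive (^-distribʳ-* s c₁ (boundary C)))))) ⟩
        Λ * q ^ s * (weight C * (c₁ ^ s * boundary C ^ s * w ^ t)) ≡⟨ lem₂ Λ (q ^ s) (weight C) (c₁ ^ s) (boundary C ^ s) (w ^ t) ⟩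
        Λ * q ^ s * c₁ ^ s * (weight C * (boundary C ^ s * w ^ t)) ≤⟨ *-monoʳ-≤ (Λ * q ^ s * c₁ ^ s) (weight-bound C t 4tD≤3β) ⟩
        Λ * q ^ s * c₁ ^ s * (Ω * (s ! * 4 ^ s))                   ≤⟨ *-monoʳ-≤ (Λ * q ^ s * c₁ ^ s) (*-monoʳ-≤ Ω (*-monoˡ-≤ (4 ^ s) (!≤^ s))) ⟩
        Λ * q ^ s * c₁ ^ s * (Ω * (s ^ s * 4 ^ s))                 ≡⟨ lem₃ Λ (q ^ s) (c₁ ^ s) Ω (s ^ s) (4 ^ s) ⟩
        Λ * (q ^ s * (4 ^ s * c₁ ^ s)) * (s ^ s * Ω)               ≡⟨ cong (λ z → Λ * z * (s ^ s * Ω)) (trans (cong (q ^ s *_) (sym (^-distribʳ-* s 4 c₁))) (sym (^-distribʳ-* s q (4 * c₁)))) ⟩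
        Λ * c₂ ^ s * (s ^ s * Ω)                                   ≤⟨ *-monoˡ-≤ (s ^ s * Ω) entropy ⟩
        w ^ t * (s ^ s * Ω)                                        ≡⟨ lem₄ (w ^ t) (s ^ s) Ω ⟩
        s ^ s * w ^ t * Ω ∎)
        where
        open ≤-Reasoning
        instance
          _ = >-nonZero (*-mono-≤ {1} {2} (s≤s z≤n) c₁≥1)
        s = length C
        q = 2 ^ suc κ
        -- From 2c₁t ≤ s and sD ≤ c₁β follows 2tD ≤ β, and so 4tD ≤ 3β. The threshold s > 8c₁ makes
        -- t at least 4.
        t = s / (2 * c₁)
        t′ = t ∸ 2
        1≤s : 1 ≤ s
        1≤s = ≤-trans (s≤s z≤n) K<s
        lem : ∀ p w l q d c → p * w * (l * (q * d) * c) ≡ l * q * (c * (p * d * w))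
        lem = solve-∀
        lem₂ : ∀ l q c a b w → l * q * (c * (a * b * w)) ≡ l * q * a * (c * (b * w))
        lem₂ = solve-∀
        lem₃ : ∀ l q c o p f → l * q * c * (o * (p * f)) ≡ l * (q * (f * c)) * (p * o)
        lem₃ = solve-∀
        lem₄ : ∀ a b c → a * (b * c) ≡ b * a * c
        lem₄ = solve-∀
        sD≤cβ : s * D ≤ c₁ * boundary C
        sD≤cβ = ≤-trans (*-monoˡ-≤ D (explored-size ex)) (Isoperimetry.isoperimetry (inA C) 2j≤n 1≤D 2a≤N)
        2ct≤s : t * (2 * c₁) ≤ s
        2ct≤s = m/n*n≤m s (2 * c₁)
        4tD≤3β : 4 * (t * D) ≤ 3 * boundary C
        4tD≤3β = *-cancel-pos-≤ c₁ c₁≥1 (begin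
          c₁ * (4 * (t * D))       ≡⟨ l₁ c₁ t D ⟩
          2 * (t * (2 * c₁) * D)   ≤⟨ *-monoʳ-≤ 2 (≤-trans (*-monoˡ-≤ D 2ct≤s) sD≤cβ) ⟩
          2 * (c₁ * boundary C)    ≤⟨ *-monoˡ-≤ (c₁ * boundary C) (n≤1+n 2) ⟩
          3 * (c₁ * boundary C)    ≡⟨ l₂ c₁ (boundary C) ⟩
          c₁ * (3 * boundary C) ∎)
          where
          l₁ : ∀ c t d → c * (4 * (t * d)) ≡ 2 * (t * (2 * c) * d)
          l₁ = solve-∀
          l₂ : ∀ c b → 3 * (c * b) ≡ c * (3 * b)
          l₂ = solve-∀
        4≤t : 4 ≤ t
        4≤t = ≤-trans (≤-reflexive (sym (m*n/n≡m 4 (2 * c₁)))) (/-monoˡ-≤ (2 * c₁) (≤-trans (≤-reflexive (l c₁)) (<⇒≤ K<s)))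
          where
          l : ∀ c → 4 * (2 * c) ≡ 8 * c
          l = solve-∀
        t≡ : 2 + t′ ≡ t
        t≡ = m+[n∸m]≡n (≤-trans (s≤s (s≤s z≤n)) 4≤t)
        1≤t′ : 1 ≤ t′
        1≤t′ = ≤-trans (s≤s z≤n) (∸-monoˡ-≤ 2 4≤t)
        -- Rounding gives s ≤ 2c₁(t + 1) = 2c₁(t′ + 3), and t′ ≥ 1 absorbs the 3. Each factor w
        -- beyond the first two thus answers for at most 8c₁ edges.
        s≤ : s ≤ 8 * c₁ * t′
        s≤ = begin
          s                                         ≡⟨ m≡m%n+[m/n]*n s (2 * c₁) ⟩
          s % (2 * c₁) + t * (2 * c₁)               ≤⟨ +-monoˡ-≤ (t * (2 * c₁)) (<⇒≤ (m%n<n s (2 * c₁))) ⟩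
          2 * c₁ + t * (2 * c₁)                     ≡⟨ cong (λ z → 2 * c₁ + z * (2 * c₁)) (sym t≡) ⟩
          2 * c₁ + (2 + t′) * (2 * c₁)              ≡⟨ l₁ c₁ t′ ⟩
          6 * c₁ * 1 + 2 * c₁ * t′                  ≤⟨ +-monoˡ-≤ (2 * c₁ * t′) (*-monoʳ-≤ (6 * c₁) 1≤t′) ⟩
          6 * c₁ * t′ + 2 * c₁ * t′                 ≡⟨ l₂ c₁ t′ ⟩
          8 * c₁ * t′ ∎
          where
          l₁ : ∀ c t → 2 * c + (2 + t) * (2 * c) ≡ 6 * c * 1 + 2 * c * t
          l₁ = solve-∀
          l₂ : ∀ c t → 6 * c * t + 2 * c * t ≡ 8 * c * t
          l₂ = solve-∀
        c₂≥1 : 1 ≤ c₂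
        c₂≥1 = *-mono-≤ (m^n>0 2 (suc κ)) (*-mono-≤ {1} {4} (s≤s z≤n) c₁≥1)
        Eₖ≥1 : 1 ≤ Eₖ
        Eₖ≥1 = *-mono-≤ (^-pos (q * 4) (8 * c₁) (*-mono-≤ (m^n>0 2 (suc κ)) (s≤s (z≤n {3})))) (1≤n! (8 * c₁))
        entropy : Λ * c₂ ^ s ≤ w ^ t
        entropy = begin
          Λ * c₂ ^ s                       ≤⟨ *-mono-≤ (≤-trans (m≤m*n Λ Eₖ {{>-nonZero Eₖ≥1}}) w²-large) (^-monoʳ-≤ c₂ {{>-nonZero c₂≥1}} s≤) ⟩
          w * w * c₂ ^ (8 * c₁ * t′)       ≡⟨ cong (w * w *_) (sym (^-*-assoc c₂ (8 * c₁) t′)) ⟩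
          w * w * (c₂ ^ (8 * c₁)) ^ t′     ≤⟨ *-monoʳ-≤ (w * w) (^-monoˡ-≤ t′ w-large) ⟩
          w * w * w ^ t′                   ≡⟨ *-assoc w w (w ^ t′) ⟩
          w ^ (2 + t′)                     ≡⟨ cong (w ^_) t≡ ⟩
          w ^ t ∎

      weight-zero : ∀ C → (∀ σ → smallComponent M C σ ≡ false) → Λ * G ^ length C * weight C ≤ Ω
      weight-zero C h = ≤-trans (≤-reflexive (trans (cong (Λ * G ^ length C *_) (∑-zero orders (λ σ → cong 𝟙 (h σ)))) (*-zeroʳ (Λ * G ^ length C)))) z≤n

      weight-≤ : ∀ C → Explored C → Λ * G ^ length C * weight C ≤ Ω
      weight-≤ C ex with 1 ≤? length C | 2 * count (inA C) 𝓙 ≤? N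
      ... | no s≱1  | _       = weight-zero C (λ σ → ∧-falseˡ (≤ᵇ-false s≱1))
      ... | yes _   | no 2a≰N = weight-zero C (λ σ → ∧-falseʳ (1 ≤ᵇ length C) (∧-falseˡ (≤ᵇ-false 2a≰N)))
      ... | yes 1≤s | yes 2a≤N with length C ≤? 8 * c₁
      ... | yes s≤K = small-case C ex 1≤s s≤K
      ... | no s≰K  = large-case C ex (≰⇒> s≰K) 2a≤N

      -- A union bound over the starting j-sets and the explorations from each. A single pending
      -- j-set gives 2Ω/Λ per start, and N/Λ = 1/u.
      few-small-components : u * count (someSmallComponent M) orders ≤ 2 * Ω
      few-small-components = *-cancel-pos-≤ N N≥1 (begin
        N * (u * count (someSmallComponent M) orders)                  ≡⟨ lem N u (count (someSmallComponent M) orders) ⟩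
        Λ * count (someSmallComponent M) orders                        ≤⟨ *-monoʳ-≤ Λ (∑-mono orders (λ σ _ → union σ)) ⟩
        Λ * ∑ orders (λ σ → ∑ 𝓙 (λ J → ∑ (lv J) (λ C → 𝟙 (smallComponent M C σ))))
          ≡⟨ cong (Λ *_) (trans (∑-swap orders 𝓙 (λ σ J → ∑ (lv J) (λ C → 𝟙 (smallComponent M C σ))))
               (∑-ext 𝓙 (λ J → ∑-swap orders (lv J) (λ σ C → 𝟙 (smallComponent M C σ))))) ⟩
        Λ * ∑ 𝓙 (λ J → ∑ (lv J) weight)                                ≡⟨ sym (∑-*ˡ 𝓙 Λ (λ J → ∑ (lv J) weight)) ⟩
        ∑ 𝓙 (λ J → Λ * ∑ (lv J) weight)                                ≤⟨ ∑-bound 𝓙 (2 * Ω) per ⟩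
        length 𝓙 * (2 * Ω)                                             ≡⟨ cong (_* (2 * Ω)) length-𝓙 ⟩
        N * (2 * Ω) ∎)
        where
        open ≤-Reasoning
        lv : Subset n → List (List (Subset n))
        lv J = leaves fuel (J ∷ []) []
        lem : ∀ a b c → a * (b * c) ≡ b * a * c
        lem = solve-∀
        union : ∀ σ → 𝟙 (someSmallComponent M σ) ≤ ∑ 𝓙 (λ J → ∑ (lv J) (λ C → 𝟙 (smallComponent M C σ)))
        union σ = ≤-trans (anyᵇ-≤-count (λ J → anyᵇ (λ C → smallComponent M C σ) (lv J)) 𝓙)
          (∑-mono 𝓙 (λ J _ → anyᵇ-≤-count (λ C → smallComponent M C σ) (lv J)))
        per : ∀ J → J ∈ 𝓙 → Λ * ∑ (lv J) weight ≤ 2 * Ω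
        per J J∈ = ≤-trans (≤-reflexive (cong (_* ∑ (lv J) weight) (sym (*-identityʳ Λ))))
          (∑-leaves 1≤D Λ Ω weight weight-≤ fuel (J ∷ []) [] (λ { J′ (here refl) → ∈-ksets⁻ j J∈ }) [])

-- Combining the two error bounds at the critical time

≤ᵇ-sound : ∀ {a b} → (a ≤ᵇ b) ≡ true → a ≤ b
≤ᵇ-sound {a} {b} h = ≤ᵇ⇒≤ a b (subst Data.Bool.T (sym h) tt)

module Conclusion (n j i m g w : ℕ) (j<n : j < n) (1≤j : 1 ≤ j) where
  open Sets n j i j<n
  open Deterministic n j i j<n

  -- Each of the two failure events has probability at most 2/u, so together they have at most 1/(m
  -- + 1).
  u T : ℕ
  u = 4 * suc m
  T = length 𝓚

  module _ (1≤D : 1 ≤ D) (8D≤T : 8 * D ≤ T) (2og≤D : 2 * (D₁ * g) ≤ D) (g≤D : g ≤ D)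
    (expo : w * u ^ g < suc u ^ g) (uw≤N : u * w ≤ N) (κ≥3 : 3 ≤ κ) (1≤w : 1 ≤ w) (2j≤n : 2 * j ≤ n)
    (stable : 8 * D ≤ 9 * bin (n ∸ 8 * c₁ * k) (suc i))
    (w²-large : u * N * ((2 ^ suc κ * 4) ^ (8 * c₁) * (8 * c₁) !) ≤ w * w)
    (w-large : (2 ^ suc κ * (4 * c₁)) ^ (8 * c₁) ≤ w) where

    sparse : ℕ → Bool
    sparse M = suc (w * ff (T ∸ D) M) ≤ᵇ ff T M

    sparse-end : sparse T ≡ true
    sparse-end = ≤ᵇ-true (≤-trans (s≤s (≤-reflexive (trans (cong (w *_) (ff-zero (T ∸ D) T T∸D<T)) (*-zeroʳ w)))) (ff-pos T T ≤-refl))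
      where
      D≤T : D ≤ T
      D≤T = ≤-trans (m≤n*m D 8) 8D≤T
      T∸D<T : T ∸ D < T
      T∸D<T = ∸-monoʳ-< {T} {D} {0} 1≤D D≤T

    -- The last time at which a given j-set is isolated with probability at least 1/w.
    critical : ∃ λ M₀ → M₀ ≤ T × ff T M₀ ≤ w * ff (T ∸ D) M₀ × w * ff (T ∸ D) (suc M₀) < ff T (suc M₀)
    critical with least sparse T sparse-end
    ... | zero   , _  , h , _   = contradiction (≤-trans (s≤s (≤-trans 1≤w (≤-reflexive (sym (*-identityʳ w))))) (≤ᵇ-sound {suc (w * 1)} {1} h)) λ { (s≤s ()) }
    ... | suc M₀ , ≤T , h , min = M₀ , <⇒≤ ≤T , ≮⇒≥ (λ lt → contradiction (trans (sym (≤ᵇ-true lt)) (min M₀ ≤-refl)) λ ()) , ≤ᵇ-sound {suc (w * ff (T ∸ D) (suc M₀))} {ff T (suc M₀)} h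

    conclusion : Σ (List (List (Subset n))) λ good →
      good ⊆ orderings n k × All (TauCEqTauI j) good ×
      m * (length (orderings n k) ∸ length good) ≤ length (orderings n k)
    conclusion with critical
    ... | M₀ , M₀≤T , dense , rare = good , filter-⊆ (Data.Bool.T? ∘ ok) orders ,
        filterᵇ-All ok (TauCEqTauI j) orders ok⇒ , final
      where
      module S = SecondMoment n j i j<n M₀ g u w
      module U = Unlikely n j i j<n 1≤j (suc M₀) u w
      orders = orderings n k
      bad ok : List (Subset n) → Bool
      bad σ = (S.X σ ≡ᵇ 0) ∨ someSmallComponent (suc M₀) σ
      ok σ = not (bad σ)
      good = filterᵇ ok orders

      ok⇒ : ∀ σ → σ ∈ orders → ok σ ≡ true → TauCEqTauI j σ
      ok⇒ σ σ∈ h = τC≡τI M₀ σ σ∈ 1≤D (proj₁ (∨-false (not-true {bad σ} h))) (proj₂ (∨-false (not-true {bad σ} h)))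
        where
        ∨-false : ∀ {a b} → a ∨ b ≡ false → a ≡ false × b ≡ false
        ∨-false {false} h = refl , h

      E₁ E₂ : ℕ
      E₁ = count (λ σ → S.X σ ≡ᵇ 0) orders
      E₂ = count (someSmallComponent (suc M₀)) orders

      length-orders : length orders ≡ T !
      length-orders = trans (sym (∑-one orders)) (length-permutations T 𝓚 refl)

      bad≤ : count bad orders ≤ E₁ + E₂
      bad≤ = ≤-trans (∑-mono orders (λ σ _ → 𝟙-∨-≤ (S.X σ ≡ᵇ 0) (someSmallComponent (suc M₀) σ)))
        (≤-reflexive (∑-+ orders (λ σ → 𝟙 (S.X σ ≡ᵇ 0)) (λ σ → 𝟙 (someSmallComponent (suc M₀) σ))))

      E₁≤ : u * E₁ ≤ 2 * T !
      E₁≤ = S.few-without-isolated M₀≤T 1≤D 8D≤T dense 2og≤D g≤D (s≤s z≤n) expo uw≤N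

      E₂≤ : u * E₂ ≤ 2 * T !
      E₂≤ = U.few-small-components 1≤D rare κ≥3 1≤w 2j≤n stable w²-large w-large

      final : m * (length orders ∸ length good) ≤ length orders
      final = *-cancelˡ-≤ 4 (begin
        4 * (m * (length orders ∸ length good))
          ≡⟨ cong (λ x → 4 * (m * (x ∸ length good))) (sym (count-not bad orders)) ⟩
        4 * (m * (count bad orders + count ok orders ∸ length good))
          ≡⟨ cong (λ x → 4 * (m * (count bad orders + count ok orders ∸ x))) (length-filterᵇ ok orders) ⟩
        4 * (m * (count bad orders + count ok orders ∸ count ok orders))
          ≡⟨ cong (λ x → 4 * (m * x)) (m+n∸n≡m (count bad orders) (count ok orders)) ⟩
        4 * (m * count bad orders)       ≡⟨ sym (*-assoc 4 m (count bad orders)) ⟩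
        4 * m * count bad orders         ≤⟨ *-mono-≤ (*-monoʳ-≤ 4 (n≤1+n m)) bad≤ ⟩
        u * (E₁ + E₂)                    ≡⟨ *-distribˡ-+ u E₁ E₂ ⟩
        u * E₁ + u * E₂                  ≤⟨ +-mono-≤ E₁≤ E₂≤ ⟩
        2 * T ! + 2 * T !                ≡⟨ lem (T !) ⟩
        4 * T !                          ≡⟨ cong (4 *_) (sym length-orders) ⟩
        4 * length orders ∎)
        where
        open ≤-Reasoning
        lem : ∀ a → 2 * a + 2 * a ≡ 4 * a
        lem = solve-∀

-- Choice of the parameters for large n

-- With h = n / c, Bernoulli's inequality gives (1 + 1/u)^h ≥ (u + h)/u ≥ n/(uc). Its power j + 1
-- exceeds n^j once n > (uc)^(j+1), so no logarithm is called for.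
exponential-beats-power : ∀ n j c u → 1 ≤ u → .{{_ : NonZero c}} → (u * c) ^ suc j < n →
  n ^ j * u ^ (suc j * (n / c)) < suc u ^ (suc j * (n / c))
exponential-beats-power n j c u 1≤u big = *-cancelʳ-< (u ^ suc j) (n ^ j * u ^ (suc j * h)) (suc u ^ (suc j * h)) (begin-strict
  n ^ j * u ^ (suc j * h) * u ^ suc j           ≡⟨ lem (n ^ j) (u ^ (suc j * h)) (u ^ suc j) ⟩
  u ^ (suc j * h) * (n ^ j * u ^ suc j)         <⟨ *-monoʳ-< (u ^ (suc j * h)) {{>-nonZero (^-pos u (suc j * h) 1≤u)}} below ⟩
  u ^ (suc j * h) * (u + h) ^ suc j             ≡⟨ cong (_* (u + h) ^ suc j) (power u) ⟩
  (u ^ h) ^ suc j * (u + h) ^ suc j             ≡⟨ sym (^-distribʳ-* (suc j) (u ^ h) (u + h)) ⟩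
  (u ^ h * (u + h)) ^ suc j                     ≤⟨ ^-monoˡ-≤ (suc j) (bernoulli u h) ⟩
  (u * suc u ^ h) ^ suc j                       ≡⟨ ^-distribʳ-* (suc j) u (suc u ^ h) ⟩
  u ^ suc j * (suc u ^ h) ^ suc j               ≡⟨ cong (u ^ suc j *_) (sym (power (suc u))) ⟩
  u ^ suc j * suc u ^ (suc j * h)               ≡⟨ *-comm (u ^ suc j) (suc u ^ (suc j * h)) ⟩
  suc u ^ (suc j * h) * u ^ suc j ∎)
  where
  open ≤-Reasoning
  h = n / c
  lem : ∀ a b c → a * b * c ≡ b * (a * c)
  lem = solve-∀
  power : ∀ x → x ^ (suc j * h) ≡ (x ^ h) ^ suc j
  power x = trans (cong (x ^_) (*-comm (suc j) h)) (sym (^-*-assoc x h (suc j)))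
  n≤ : n ≤ c * (u + h)
  n≤ = begin
    n                ≡⟨ m≡m%n+[m/n]*n n c ⟩
    n % c + h * c    ≤⟨ +-monoˡ-≤ (h * c) (<⇒≤ (m%n<n n c)) ⟩
    c + h * c        ≡⟨ lem′ c h ⟩
    c * (1 + h)      ≤⟨ *-monoʳ-≤ c (+-monoˡ-≤ h 1≤u) ⟩
    c * (u + h) ∎
    where
    lem′ : ∀ c h → c + h * c ≡ c * (1 + h)
    lem′ = solve-∀
  1≤n : 1 ≤ n
  1≤n = ≤-trans (s≤s z≤n) big
  below : n ^ j * u ^ suc j < (u + h) ^ suc j
  below = *-cancelˡ-< (c ^ suc j) (n ^ j * u ^ suc j) ((u + h) ^ suc j) (begin-strict
    c ^ suc j * (n ^ j * u ^ suc j)   ≡⟨ lem′ (c ^ suc j) (n ^ j) (u ^ suc j) ⟩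
    u ^ suc j * c ^ suc j * n ^ j     ≡⟨ cong (_* n ^ j) (sym (^-distribʳ-* (suc j) u c)) ⟩
    (u * c) ^ suc j * n ^ j           <⟨ *-monoˡ-< (n ^ j) {{>-nonZero (^-pos n j 1≤n)}} big ⟩
    n ^ suc j                         ≤⟨ ^-monoˡ-≤ (suc j) n≤ ⟩
    (c * (u + h)) ^ suc j             ≡⟨ ^-distribʳ-* (suc j) c (u + h) ⟩
    c ^ suc j * (u + h) ^ suc j ∎)
    where
    lem′ : ∀ a b c → a * (b * c) ≡ c * a * b
    lem′ = solve-∀

-- Already a single vertex lies in only a fraction k/n ≤ 1/8 of all k-sets, and j ≥ 1.
8*bin≤bin : ∀ n j i → 1 ≤ j → j < n → 8 * suc (j + i) ≤ n → 8 * bin (n ∸ j) (suc i) ≤ bin n (suc (j + i))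
8*bin≤bin (suc n) (suc j) i 1≤j (s≤s j<n) 8k≤n = *-cancelˡ-≤ k (begin
  k * (8 * D)            ≡⟨ lem k D ⟩
  8 * k * D              ≤⟨ *-mono-≤ 8k≤n D≤ ⟩
  suc n * bin n (suc (j + i)) ≡⟨ sym (bin-absorb n (suc (j + i))) ⟩
  k * bin (suc n) k ∎)
  where
  open ≤-Reasoning
  k = suc (suc j + i)
  D = bin (n ∸ j) (suc i)
  lem : ∀ k D → k * (8 * D) ≡ 8 * k * D
  lem = solve-∀
  D≤ : D ≤ bin n (suc (j + i))
  D≤ = ≤-trans (bin-diag-≤ (n ∸ j) j (suc i)) (≤-reflexive (cong₂ bin (m+[n∸m]≡n (<⇒≤ j<n)) (+-suc j i)))

module Asymptotics (j i m : ℕ) (1≤j : 1 ≤ j) (3≤k : 3 ≤ suc (j + i)) where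

  -- `v` bounds the number of vertices of 8 c₁ edges. `c` is such that g = (j+1)(n / c) satisfies
  -- 2g(i+1) ≤ n - j. In `w₀`, the term 2u²E₀ is what u N E₀ ≤ w² requires of w once N ≤ 2uw is
  -- inserted.
  k κ c₁ u E₀ w₀ v c : ℕ
  k  = suc (j + i)
  κ  = bin k j
  c₁ = 2 ^ j * j ! * 2 * (j * κ ^ j * (κ * κ))
  u  = 4 * suc m
  E₀ = (2 ^ suc κ * 4) ^ (8 * c₁) * (8 * c₁) !
  w₀ = suc (2 * (u * u) * E₀ + (2 ^ suc κ * (4 * c₁)) ^ (8 * c₁))
  v  = 8 * c₁ * k
  c  = 4 * (k * suc j)

  -- Summand by summand: w ≥ w₀; (1 + 1/u)^g exceeds w; 8D ≤ T and 2j ≤ n; and `D-stable` applies to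
  -- v vertices.
  n₀ : ℕ
  n₀ = u * w₀ + (suc ((u * c) ^ suc j) + (8 * k + (9 * v * suc i + (j + v))))

  module _ (n : ℕ) (n₀≤n : n₀ ≤ n) where

    uw₀≤n : u * w₀ ≤ n
    uw₀≤n = ≤-trans (m≤m+n (u * w₀) _) n₀≤n

    rest₁ : suc ((u * c) ^ suc j) + (8 * k + (9 * v * suc i + (j + v))) ≤ n
    rest₁ = ≤-trans (m≤n+m _ (u * w₀)) n₀≤n

    rest₂ : 8 * k + (9 * v * suc i + (j + v)) ≤ n
    rest₂ = ≤-trans (m≤n+m _ (suc ((u * c) ^ suc j))) rest₁

    rest₃ : 9 * v * suc i + (j + v) ≤ n
    rest₃ = ≤-trans (m≤n+m _ (8 * k)) rest₂

    8k≤n : 8 * k ≤ n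
    8k≤n = ≤-trans (m≤m+n (8 * k) _) rest₂

    k≤n : k ≤ n
    k≤n = ≤-trans (m≤n*m k 8) 8k≤n

    j<k : j < k
    j<k = s≤s (m≤m+n j i)

    j<n : j < n
    j<n = ≤-trans j<k k≤n

    open Sets n j i j<n using (N; D; D₁; D₁≤D; D-absorb; 𝓚)

    2j≤n : 2 * j ≤ n
    2j≤n = ≤-trans (*-mono-≤ {2} {8} (s≤s (s≤s z≤n)) (<⇒≤ j<k)) 8k≤n

    w h g : ℕ
    w = N / u
    h = n / c
    g = suc j * h

    n≤N : n ≤ N
    n≤N = bin-≥n n j 1≤j j<n

    w₀≤w : w₀ ≤ w
    w₀≤w = ≤-trans (≤-reflexive (sym (m*n/n≡m w₀ u))) (/-monoˡ-≤ u (≤-trans (≤-reflexive (*-comm w₀ u)) (≤-trans uw₀≤n n≤N)))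

    1≤w : 1 ≤ w
    1≤w = ≤-trans (s≤s z≤n) w₀≤w

    uw≤N : u * w ≤ N
    uw≤N = ≤-trans (≤-reflexive (*-comm u w)) (m/n*n≤m N u)

    N≤2uw : N ≤ 2 * (u * w)
    N≤2uw = begin
      N                 ≡⟨ m≡m%n+[m/n]*n N u ⟩
      N % u + w * u     ≤⟨ +-monoˡ-≤ (w * u) (<⇒≤ (m%n<n N u)) ⟩
      u + w * u         ≡⟨ cong (_+ w * u) (sym (*-identityˡ u)) ⟩
      1 * u + w * u     ≤⟨ +-monoˡ-≤ (w * u) (*-monoˡ-≤ u 1≤w) ⟩
      w * u + w * u     ≡⟨ lem w u ⟩
      2 * (u * w) ∎
      where
      open ≤-Reasoning
      lem : ∀ w u → w * u + w * u ≡ 2 * (u * w)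
      lem = solve-∀

    w²-large : u * N * E₀ ≤ w * w
    w²-large = begin
      u * N * E₀                  ≤⟨ *-monoˡ-≤ E₀ (*-monoʳ-≤ u N≤2uw) ⟩
      u * (2 * (u * w)) * E₀      ≡⟨ lem u w E₀ ⟩
      w * (2 * (u * u) * E₀)      ≤⟨ *-monoʳ-≤ w (≤-trans (≤-trans (m≤m+n _ _) (n≤1+n _)) w₀≤w) ⟩
      w * w ∎
      where
      open ≤-Reasoning
      lem : ∀ u w e → u * (2 * (u * w)) * e ≡ w * (2 * (u * u) * e)
      lem = solve-∀

    w-large : (2 ^ suc κ * (4 * c₁)) ^ (8 * c₁) ≤ w
    w-large = ≤-trans (≤-trans (m≤n+m _ (2 * (u * u) * E₀)) (n≤1+n _)) w₀≤w

    expo : w * u ^ g < suc u ^ g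
    expo = ≤-trans (s≤s (*-monoˡ-≤ (u ^ g) (≤-trans (≤-trans (m≤n*m w u) uw≤N) (bin-≤^ n j))))
      (exponential-beats-power n j c u (s≤s z≤n) (≤-trans (m≤m+n _ _) rest₁))

    D₁≥1 : 1 ≤ D₁
    D₁≥1 = bin-≥1 (n ∸ suc j) i (m+n≤o⇒m≤o∸n i (≤-trans (≤-reflexive (+-comm i (suc j))) k≤n))

    half : 2 * g * suc i ≤ n ∸ j
    half = m+n≤o⇒m≤o∸n (2 * g * suc i) (*-cancelˡ-≤ 2 (begin
      2 * (2 * g * suc i + j)        ≡⟨ lem g (suc i) j ⟩
      4 * (g * suc i) + 2 * j        ≤⟨ +-mono-≤ (*-monoʳ-≤ 4 (*-monoʳ-≤ g (s≤s (m≤n+m i j)))) 2j≤n ⟩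
      4 * (g * k) + n                ≡⟨ cong (_+ n) (lem′ (suc j) h k) ⟩
      h * c + n                      ≤⟨ +-monoˡ-≤ n (m/n*n≤m n c) ⟩
      n + n                          ≡⟨ cong (n +_) (sym (+-identityʳ n)) ⟩
      2 * n ∎))
      where
      open ≤-Reasoning
      lem : ∀ g i j → 2 * (2 * g * i + j) ≡ 4 * (g * i) + 2 * j
      lem = solve-∀
      lem′ : ∀ j h k → 4 * (j * h * k) ≡ h * (4 * (k * j))
      lem′ = solve-∀

    2og≤D : 2 * (D₁ * g) ≤ D
    2og≤D = *-cancelˡ-≤ (suc i) (begin
      suc i * (2 * (D₁ * g))   ≡⟨ lem (suc i) D₁ g ⟩
      2 * g * suc i * D₁       ≤⟨ *-monoˡ-≤ D₁ half ⟩
      (n ∸ j) * D₁             ≡⟨ sym D-absorb ⟩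
      suc i * D ∎)
      where
      open ≤-Reasoning
      lem : ∀ i d g → i * (2 * (d * g)) ≡ 2 * g * i * d
      lem = solve-∀

    g≤D : g ≤ D
    g≤D = ≤-trans (m≤n*m g D₁ {{>-nonZero D₁≥1}}) (≤-trans (m≤n*m (D₁ * g) 2) 2og≤D)

    8D≤T : 8 * D ≤ length 𝓚
    8D≤T = ≤-trans (8*bin≤bin n j i 1≤j j<n 8k≤n) (≤-reflexive (sym (length-ksets n k)))

    κ≥k : k ≤ κ
    κ≥k = bin-≥n k j 1≤j j<k

    j≤v : j ≤ v
    j≤v = ≤-trans (<⇒≤ j<k) (m≤n*m k (8 * c₁) {{>-nonZero 8c₁≥1}})
      where
      κ≥1 : 1 ≤ κ
      κ≥1 = ≤-trans (s≤s z≤n) κ≥k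
      8c₁≥1 : 1 ≤ 8 * c₁
      8c₁≥1 = *-mono-≤ {1} {8} (s≤s z≤n) (*-mono-≤ (*-mono-≤ (*-mono-≤ (m^n>0 2 j) (1≤n! j)) (s≤s (z≤n {1})))
        (*-mono-≤ (*-mono-≤ 1≤j (^-pos κ j κ≥1)) (*-mono-≤ κ≥1 κ≥1)))

    stable : 8 * D ≤ 9 * bin (n ∸ v) (suc i)
    stable = Exploration.D-stable n j i j<n v j≤v (≤-trans (m≤n+m v j) (≤-trans (m≤n+m (j + v) (9 * v * suc i)) rest₃))
      (m+n≤o⇒m≤o∸n (9 * v * suc i) (≤-trans (+-monoʳ-≤ (9 * v * suc i) (m≤m+n j v)) rest₃))

    result : Σ (List (List (Subset n))) λ good →
      good ⊆ orderings n k × All (TauCEqTauI j) good ×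
      m * (length (orderings n k) ∸ length good) ≤ length (orderings n k)
    result = Conclusion.conclusion n j i m g w j<n 1≤j (≤-trans D₁≥1 D₁≤D) 8D≤T 2og≤D g≤D expo uw≤N
      (≤-trans 3≤k κ≥k) 1≤w 2j≤n stable w²-large w-large

theorem5 : (k j : ℕ) → 3 ≤ k → 1 ≤ j → j < k →
    (m : ℕ) → Σ ℕ λ N → (n : ℕ) → N ≤ n →
    Σ (List (List (Subset n))) λ good →
    good ⊆ orderings n k ×
    All (TauCEqTauI j) good ×
    m * (length (orderings n k) ∸ length good) ≤ length (orderings n k)
theorem5 k j 3≤k 1≤j j<k m with m≤n⇒∃[o]m+o≡n j<k
... | i , refl = Asymptotics.n₀ j i m 1≤j 3≤k , Asymptotics.result j i m 1≤j 3≤k
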